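{- Let $H$ be an inner-abelian metacyclic $3$-group and let $\Gamma$ be a finite, connected, simple, undirected cubic edge-transitive graph which is a bi-Cayley graph over $H$. Then $\Gamma$ is isomorphic to $\Gamma_t$ or to $\Sigma_t$ for some positive integer $t$, where $\Gamma_t=\mathrm{BiCay}(\mathcal{G},\emptyset,\emptyset,\{1,a,a^{ -1}b\})$ with $\mathcal{G}=\langle a,b\mid a^{3^{t+1}}=b^{3^t}=1,\ b^{ -1}ab=a^{1+3^t}\rangle$, and $\Sigma_t=\mathrm{BiCay}(\mathcal{H},\emptyset,\emptyset,\{1,b,b^{ -1}a\})$ with $\mathcal{H}=\langle a,b\mid a^{3^{t+1}}=b^{3^{t+1}}=1,\ b^{ -1}ab=a^{1+3^t}\rangle$.
   Context: A non-abelian group is inner-abelian if all its proper subgroups are abelian. A group is metacyclic if it has a cyclic normal subgroup with cyclic quotient. A graph $\Gamma$ is a bi-Cayley graph over $H$ if $\mathrm{Aut}(\Gamma)$ contains a subgroup isomorphic to $H$ acting semiregularly on $V(\Gamma)$ with exactly two orbits. For a group $H$ and subsets $R=R^{ -1}$, $L=L^{ -1}$, $S$ of $H$ with $1\notin R\cup L$, $\mathrm{BiCay}(H,R,L,S)$ is the graph with vertex set $H_0\cup H_1$, $H_i=\{h_i:h\in H\}$, and edges $\{h_0,g_0\}$ for $gh^{ -1}\in R$, $\{h_1,g_1\}$ for $gh^{ -1}\in L$, and $\{h_0,g_1\}$ for $gh^{ -1}\in S$. Edge-transitive means $\mathrm{Aut}(\Gamma)$ is transitive on edges. -}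

module Defs where

open import Level using (Level)
open import Data.Nat using (ℕ; zero; suc; _+_; _*_; _^_; _≤_; NonZero)
open import Data.Nat.Properties using (m^n≢0)
open import Data.Nat.DivMod using (_mod_)
open import Data.Fin using (Fin; toℕ) renaming (zero to fzero; suc to fsuc)
import Data.Fin as Fin
open import Data.Fin.Permutation using (Permutation′; _⟨$⟩ʳ_)
open import Data.Bool using (Bool; true; false; if_then_else_; _∧_; _∨_)
open import Data.List using (List; []; _∷_; allFin; map)
open import Data.Nat.ListAction using (sum)
open import Data.Bool.ListAction using (any)
open import Data.Product using (Σ; ∃; _×_; _,_; proj₁; proj₂)
open import Data.Sum using (_⊎_)
open import Relation.Nullary using (¬_; does)
open import Relation.Binary.PropositionalEquality using (_≡_)
open import Algebra.Structures using (IsGroup)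
open import Function.Bundles using (_↔_; Inverse)

record FinGroup : Set where
  infixl 7 _∙_
  field
    order   : ℕ
    _∙_     : Fin order → Fin order → Fin order
    ε       : Fin order
    _⁻¹     : Fin order → Fin order
    isGroup : IsGroup _≡_ _∙_ ε _⁻¹

module GroupNotions (G : FinGroup) where
  open FinGroup G

  Elem : Set
  Elem = Fin order

  pow : Elem → ℕ → Elem
  pow x zero    = ε
  pow x (suc k) = x ∙ pow x k

  record IsSubgroup (P : Elem → Set) : Set where
    field
      ε∈  : P ε
      ∙∈  : ∀ {x y} → P x → P y → P (x ∙ y)
      ⁻¹∈ : ∀ {x} → P x → P (x ⁻¹)

  IsProper : (Elem → Set) → Set
  IsProper P = ∃ λ x → ¬ P x

  IsAbelianSub : (Elem → Set) → Set
  IsAbelianSub P = ∀ {x y} → P x → P y → x ∙ y ≡ y ∙ x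

  IsAbelian : Set
  IsAbelian = ∀ x y → x ∙ y ≡ y ∙ x

  IsInnerAbelian : Set₁
  IsInnerAbelian = ¬ IsAbelian × (∀ P → IsSubgroup P → IsProper P → IsAbelianSub P)

  IsNormal : (Elem → Set) → Set
  IsNormal P = ∀ g {x} → P x → P ((g ∙ x) ∙ (g ⁻¹))

  IsCyclicSub : (Elem → Set) → Set
  IsCyclicSub P = ∃ λ g → P g × (∀ {x} → P x → ∃ λ k → x ≡ pow g k)

  QuotientCyclic : (Elem → Set) → Set
  QuotientCyclic P = ∃ λ h → ∀ x → ∃ λ k → P (x ∙ (pow h k ⁻¹))

  IsMetacyclic : Set₁
  IsMetacyclic = ∃ λ P → IsSubgroup P × IsNormal P × IsCyclicSub P × QuotientCyclic P

  Is3Group : Set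
  Is3Group = ∃ λ k → order ≡ 3 ^ k

record Graph : Set where
  field
    size   : ℕ
    adj    : Fin size → Fin size → Bool
    sym    : ∀ u v → adj u v ≡ adj v u
    irrefl : ∀ v → adj v v ≡ false

module GraphNotions (Γ : Graph) where
  open Graph Γ

  V : Set
  V = Fin size

  degree : V → ℕ
  degree v = sum (map (λ w → if adj v w then 1 else 0) (allFin size))

  IsCubic : Set
  IsCubic = ∀ v → degree v ≡ 3

  data Walk : V → V → Set where
    here : ∀ {v} → Walk v v
    step : ∀ {u v w} → adj u v ≡ true → Walk v w → Walk u w

  IsConnected : Set
  IsConnected = ∀ u v → Walk u v

  record Aut : Set where
    field
      perm     : Permutation′ size
      preserve : ∀ u v → adj (perm ⟨$⟩ʳ u) (perm ⟨$⟩ʳ v) ≡ adj u v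

  act : Aut → V → V
  act σ v = Aut.perm σ ⟨$⟩ʳ v

  IsEdgeTransitive : Set
  IsEdgeTransitive = ∀ u v x y → adj u v ≡ true → adj x y ≡ true →
    ∃ λ (σ : Aut) → (act σ u ≡ x × act σ v ≡ y) ⊎ (act σ u ≡ y × act σ v ≡ x)

  -- Aut(Γ) contains a subgroup isomorphic to H acting semiregularly with
  -- exactly two orbits: a homomorphism ρ : H → Aut(Γ) whose action is
  -- semiregular (hence ρ is injective) and has exactly two orbits.
  IsBiCayleyOver : FinGroup → Set
  IsBiCayleyOver H =
    Σ (Elem → Aut) λ ρ →
      (∀ g h v → act (ρ (g ∙ h)) v ≡ act (ρ g) (act (ρ h) v))
      × (∀ g v → act (ρ g) v ≡ v → g ≡ ε)
      × (∃ λ v₀ → ∃ λ v₁ →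
           ¬ (∃ λ g → act (ρ g) v₀ ≡ v₁)
           × (∀ v → (∃ λ g → act (ρ g) v₀ ≡ v) ⊎ (∃ λ g → act (ρ g) v₁ ≡ v)))
    where open FinGroup H
          open GroupNotions H using (Elem)

  IsIsoTo : {W : Set} → (W → W → Bool) → Set
  IsIsoTo {W} adjW = Σ (V ↔ W) λ f →
    ∀ u v → adjW (Inverse.to f u) (Inverse.to f v) ≡ adj u v

-- BiCay(X, R, L, S) for a multiplication on a type X with decidable equality,
-- vertex set Fin 2 × X (side 0 = H₀, side 1 = H₁).
-- {h_i, g_j} is an edge iff g h⁻¹ ∈ R / L / S, i.e. g = s h for some s.

module BiCayley {X : Set} (_≟_ : (x y : X) → Relation.Nullary.Dec (x ≡ y))
                (mul : X → X → X) where
  inMul : List X → X → X → Bool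
  inMul T h g = any (λ s → does (mul s h ≟ g)) T

  BiCay : (R L S : List X) → Fin 2 × X → Fin 2 × X → Bool
  BiCay R L S (fzero , h)        (fzero , g)        = inMul R h g
  BiCay R L S (fsuc fzero , h)   (fsuc fzero , g)   = inMul L h g
  BiCay R L S (fzero , h)        (fsuc fzero , g)   = inMul S h g
  BiCay R L S (fsuc fzero , g)   (fzero , h)        = inMul S h g

-- The metacyclic group ⟨a,b | a^p = b^q = 1, b⁻¹ab = a^r⟩ in normal form:
-- the pair (j , i) ∈ Fin q × Fin p stands for b^j a^i, and
--   (b^j a^i)(b^l a^k) = b^(j+l) a^(i r^l + k).

MC : (q p : ℕ) → Set
MC q p = Fin q × Fin p

_≟MC_ : ∀ {q p} → (x y : MC q p) → Relation.Nullary.Dec (x ≡ y)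
_≟MC_ = Data.Product.Properties.≡-dec Fin._≟_ Fin._≟_
  where import Data.Product.Properties

mulMC : (q p r : ℕ) .{{_ : NonZero q}} .{{_ : NonZero p}} → MC q p → MC q p → MC q p
mulMC q p r (j , i) (l , k) =
  ((toℕ j + toℕ l) mod q , (toℕ i * r ^ toℕ l + toℕ k) mod p)

𝒢 : ℕ → Set
𝒢 t = MC (3 ^ t) (3 ^ suc t)

mul𝒢 : (t : ℕ) → 𝒢 t → 𝒢 t → 𝒢 t
mul𝒢 t = mulMC (3 ^ t) (3 ^ suc t) (1 + 3 ^ t) {{m^n≢0 3 t}} {{m^n≢0 3 (suc t)}}

ℋ : ℕ → Set
ℋ t = MC (3 ^ suc t) (3 ^ suc t)

mulℋ : (t : ℕ) → ℋ t → ℋ t → ℋ t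
mulℋ t = mulMC (3 ^ suc t) (3 ^ suc t) (1 + 3 ^ t) {{m^n≢0 3 (suc t)}} {{m^n≢0 3 (suc t)}}

elt : (q p : ℕ) .{{_ : NonZero q}} .{{_ : NonZero p}} → ℕ → ℕ → MC q p
elt q p j i = (j mod q , i mod p)

Γ-adj : (t : ℕ) → Fin 2 × 𝒢 t → Fin 2 × 𝒢 t → Bool
Γ-adj t = BiCay [] [] (one ∷ a ∷ a⁻¹b ∷ [])
  where
    open BiCayley (_≟MC_ {3 ^ t} {3 ^ suc t}) (mul𝒢 t)
    q = 3 ^ t
    p = 3 ^ suc t
    instance
      nzq : NonZero q
      nzq = m^n≢0 3 t
      nzp : NonZero p
      nzp = m^n≢0 3 (suc t)
    one a a⁻¹b : 𝒢 t
    one  = elt q p 0 0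
    a    = elt q p 0 1
    -- a⁻¹ b = b (b⁻¹ a⁻¹ b) = b a^(-r), with -r ≡ p·r - r (mod p)
    a⁻¹b = elt q p 1 (p * (1 + q) Data.Nat.∸ (1 + q))

Σ-adj : (t : ℕ) → Fin 2 × ℋ t → Fin 2 × ℋ t → Bool
Σ-adj t = BiCay [] [] (one ∷ b ∷ b⁻¹a ∷ [])
  where
    open BiCayley (_≟MC_ {3 ^ suc t} {3 ^ suc t}) (mulℋ t)
    q = 3 ^ suc t
    p = 3 ^ suc t
    instance
      nzq : NonZero q
      nzq = m^n≢0 3 (suc t)
    one b b⁻¹a : ℋ t
    one  = elt q p 0 0
    b    = elt q p 1 0
    b⁻¹a = elt q p (q Data.Nat.∸ 1) 1

{-# OPTIONS --safe #-}

-- Let A = Aut Γ. The number of arcs shows that 3 divides |A : H|, so H, a 3-group acting on H\A,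
-- has a number of fixed cosets divisible by 3; by Cauchy's theorem some σ of order 3 normalises H
-- and fixes a vertex v₀. If σ fixed a neighbour of v₀ it would fix everything, so it rotates the
-- neighbours w, xw, yw of v₀. Hence Γ = BiCay(H, ∅, ∅, {1, x, y}), and conjugation by σ is an
-- automorphism α of H = ⟨x, αx⟩ with y = α(x) x and α²(x) α(x) x = 1.
--
-- In an inner-abelian metacyclic 3-group the commutators are the powers of a central element c of
-- order 3, and c is a cube. So H/⟨c⟩ is a cyclic module over the Eisenstein integers, isomorphic to
-- ℤ[ω]/(λᵐ) with λ = 1 − ω, and since c is a cube the relations of H are determined by m up to
-- replacing c by c⁻¹, that is, up to exchanging the two sides of Γ. The graph is Γ_t for m = 2t and
-- Σ_t for m = 2t + 1.

module Submission where

open import Defs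
open import Algebra.Bundles using (Group; AbelianGroup)
open import Algebra.Structures using (IsGroup)
import Algebra.Properties.AbelianGroup
import Algebra.Properties.CommutativeMonoid.Mult
import Algebra.Properties.CommutativeSemigroup
import Algebra.Properties.Group
import Algebra.Solver.Monoid
open import Data.Bool using (Bool; true; false; if_then_else_; _∨_; _xor_)
import Data.Bool as Bool
open import Data.Bool.Properties using (T-irrelevant; ¬-not)
open import Data.Fin using (Fin; toℕ; combine; finToFun; funToFin)
import Data.Fin as Fin
open import Data.Fin.Permutation using (_⟨$⟩ʳ_; _⟨$⟩ˡ_)
import Data.Fin.Permutation as Perm
import Data.Fin.Properties as Finₚ
open import Data.List using (List; []; _∷_; length; map; filter; allFin; applyUpTo; cartesianProduct)
open import Data.List.Membership.Propositional using (_∈_; _∉_)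
open import Data.List.Membership.Propositional.Properties using (∈-filter⁺; ∈-filter⁻; ∈-map⁺; ∈-map⁻; ∈-allFin; ∈-cartesianProduct⁺; ∈-cartesianProduct⁻; ∈-applyUpTo⁺; ∈-applyUpTo⁻)
open import Data.List.Membership.Propositional.Properties.WithK using (unique∧set⇒bag)
open import Data.List.Properties using (length-map; length-applyUpTo; length-tabulate; length-++; filter-++)
open import Data.List.Relation.Binary.BagAndSetEquality using (∼bag⇒↭)
open import Data.List.Relation.Binary.Permutation.Propositional.Properties using (↭-length)
open import Data.List.Relation.Unary.All using ([]; _∷_)
import Data.List.Relation.Unary.All as All
open import Data.List.Relation.Unary.AllPairs using ([]; _∷_)
open import Data.List.Relation.Unary.Any using (here; there)
open import Data.List.Relation.Unary.Unique.Propositional using (Unique)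
import Data.List.Relation.Unary.Unique.Propositional.Properties as Uniq
open import Data.Nat using (ℕ; zero; suc; _+_; _*_; _∸_; _^_; _≤_; _<_; z≤n; s≤s; NonZero)
open import Data.Nat.Divisibility using (_∣_; divides; ∣-refl; ∣m+n∣m⇒∣n; ∣m∣n⇒∣m+n; _∣0; ∣m⇒∣m*n; ∣n⇒∣m*n; 1∣_; *-monoˡ-∣; *-monoʳ-∣)
open import Data.Nat.DivMod using (_%_; _/_; _mod_; m≡m%n+[m/n]*n; m%n<n)
open import Data.Nat.Induction using (<-wellFounded)
open import Data.Nat.ListAction using (sum)
open import Data.Nat.Properties hiding (_≟_)
open import Data.Nat.Tactic.RingSolver using (solve-∀)
open import Data.Product using (Σ; ∃; ∃₂; _×_; _,_; proj₁; proj₂)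
import Data.Product.Properties as Prodₚ
open import Data.Sum using (_⊎_; inj₁; inj₂)
open import Data.Unit using (⊤; tt)
open import Function using (_∘_; id)
open import Function.Bundles using (mk⇔; mk↔ₛ′)
open import Induction.WellFounded using (Acc; acc)
open import Level using (0ℓ)
open import Relation.Binary.Definitions using (DecidableEquality)
open import Relation.Binary.PropositionalEquality using (_≡_; _≢_; refl; sym; trans; cong; cong₂; subst; module ≡-Reasoning)
import Relation.Binary.Reasoning.Setoid
open import Relation.Nullary using (¬_; Dec; yes; no; does; contradiction)
open import Relation.Nullary.Decidable using (True; toWitness; fromWitness; ¬?; _×-dec_)
open import Relation.Unary using (Decidable)

-- Counting

-- The module structure sees H only modulo `c`. Write z for αx. What remains to be found is one
-- exponent n: in x^(3^t) = cⁿ for m = 2t, and in x^(3^t) = cⁿ z^(3^t) for m = 2t + 1; the power of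
-- z then follows, because α fixes `c`. If n were 0, every word x^i z^j that is trivial modulo `c`
-- would be trivial in H; but `c`, being a cube, is itself such a word. The values 1 and 2 are
-- exchanged by passing to x⁻¹ and y⁻¹, which keeps the commutator `c` and inverts the powers. H
-- acts from the left, so the connection set multiplies from the right, and the groups of the
-- statement appear with reversed multiplication. This is why the generator that completes x to a
-- presentation is y x. Modulo `c` it is z + 2x = (2 + ω)x = (1 - ω²)x, an associate of λx, which
-- explains why its powers vanish modulo `c` just when half-integral powers of 3 in the Eisenstein
-- integers do.

record Enum {A : Set} (P : A → Set) : Set where
  field
    list     : List A
    unique   : Unique list
    sound    : ∀ {a} → a ∈ list → P a
    complete : ∀ {a} → P a → a ∈ list

open Enum

card : {A : Set} {P : A → Set} → Enum P → ℕ
card E = length (list E)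

unique-length : {A : Set} {xs ys : List A} → Unique xs → Unique ys →
  (∀ {a} → a ∈ xs → a ∈ ys) → (∀ {a} → a ∈ ys → a ∈ xs) → length xs ≡ length ys
unique-length u v f g = ↭-length (∼bag⇒↭ (unique∧set⇒bag u v (mk⇔ f g)))

map-unique : {A B : Set} {xs : List A} (f : A → B) → Unique xs →
  (∀ {a b} → a ∈ xs → b ∈ xs → f a ≡ f b → a ≡ b) → Unique (map f xs)
map-unique f [] inj = []
map-unique {xs = x ∷ xs} f (x∉ ∷ u) inj =
  All.tabulate fresh ∷ map-unique f u (λ a b → inj (there a) (there b))
  where
  fresh : ∀ {b} → b ∈ map f xs → f x ≢ b
  fresh b∈ eq with ∈-map⁻ f b∈
  ... | a , a∈ , refl = All.lookup x∉ a∈ (inj (here refl) (there a∈) eq)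

card-bij : {A B : Set} {P : A → Set} {Q : B → Set} (E : Enum P) (F : Enum Q)
  (f : A → B) (g : B → A) → (∀ {a} → P a → Q (f a)) → (∀ {b} → Q b → P (g b)) →
  (∀ {a} → P a → g (f a) ≡ a) → (∀ {b} → Q b → f (g b) ≡ b) → card E ≡ card F
card-bij E F f g PQ QP gf fg = trans (sym (length-map f (list E)))
  (unique-length (map-unique f (unique E) inj) (unique F) to from)
  where
  inj : ∀ {a b} → a ∈ list E → b ∈ list E → f a ≡ f b → a ≡ b
  inj a∈ b∈ eq = trans (sym (gf (sound E a∈))) (trans (cong g eq) (gf (sound E b∈)))
  to : ∀ {b} → b ∈ map f (list E) → b ∈ list F
  to b∈ with ∈-map⁻ f b∈
  ... | a , a∈ , refl = complete F (PQ (sound E a∈))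
  from : ∀ {b} → b ∈ list F → b ∈ map f (list E)
  from b∈ = subst (_∈ map f (list E)) (fg (sound F b∈)) (∈-map⁺ f (complete E (QP (sound F b∈))))

-- Lets a set such as the normaliser, whose defining predicate `Nrm` comes with no decision
-- procedure, be counted through an equivalent decidable condition.
enum-⇔ : {A : Set} {P Q : A → Set} → (∀ {a} → P a → Q a) → (∀ {a} → Q a → P a) → Enum P → Enum Q
enum-⇔ f g E = record { list = list E ; unique = unique E ; sound = f ∘ sound E ; complete = complete E ∘ g }

enum-Fin : ∀ n → Enum {Fin n} (λ _ → ⊤)
enum-Fin n = record { list = allFin n ; unique = Uniq.allFin⁺ n ; sound = λ _ → tt ; complete = λ {a} _ → ∈-allFin a }

enum-Bool : Enum {Bool} (λ _ → ⊤)
enum-Bool = record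
  { list = true ∷ false ∷ [] ; unique = ((λ ()) ∷ []) ∷ ([] ∷ []) ; sound = λ _ → tt
  ; complete = λ { {true} _ → here refl ; {false} _ → there (here refl) } }

card-Fin : ∀ n → card (enum-Fin n) ≡ n
card-Fin n = length-tabulate id

enum-× : {A B : Set} {P : A → Set} {Q : B → Set} → Enum P → Enum Q →
  Enum {A × B} (λ ab → P (proj₁ ab) × Q (proj₂ ab))
enum-× E F = record
  { list = cartesianProduct (list E) (list F)
  ; unique = Uniq.cartesianProduct⁺ (unique E) (unique F)
  ; sound = λ ab∈ → let (a∈ , b∈) = ∈-cartesianProduct⁻ (list E) (list F) ab∈ in sound E a∈ , sound F b∈
  ; complete = λ (p , q) → ∈-cartesianProduct⁺ (complete E p) (complete F q) }

length-cartesianProduct : {A B : Set} (xs : List A) (ys : List B) →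
  length (cartesianProduct xs ys) ≡ length xs * length ys
length-cartesianProduct []       ys = refl
length-cartesianProduct (x ∷ xs) ys = trans (length-++ (map (x ,_) ys))
  (cong₂ _+_ (length-map (x ,_) ys) (length-cartesianProduct xs ys))

card-× : {A B : Set} {P : A → Set} {Q : B → Set} (E : Enum P) (F : Enum Q) →
  card (enum-× E F) ≡ card E * card F
card-× E F = length-cartesianProduct (list E) (list F)

enum-filter : {A : Set} {P Q : A → Set} → Decidable Q → Enum P → Enum (λ a → P a × Q a)
enum-filter Q? E = record
  { list = filter Q? (list E)
  ; unique = Uniq.filter⁺ Q? (unique E)
  ; sound = λ a∈ → let (a∈′ , q) = ∈-filter⁻ Q? a∈ in sound E a∈′ , q
  ; complete = λ (p , q) → ∈-filter⁺ Q? (complete E p) q }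

length-filter-split : {A : Set} {Q : A → Set} (Q? : Decidable Q) (xs : List A) →
  length xs ≡ length (filter Q? xs) + length (filter (¬? ∘ Q?) xs)
length-filter-split Q? [] = refl
length-filter-split Q? (x ∷ xs) with Q? x
... | yes _ = cong suc (length-filter-split Q? xs)
... | no  _ = trans (cong suc (length-filter-split Q? xs)) (sym (+-suc _ _))

card-split : {A : Set} {P Q : A → Set} (Q? : Decidable Q) (E : Enum P) →
  card E ≡ card (enum-filter Q? E) + card (enum-filter (¬? ∘ Q?) E)
card-split Q? E = length-filter-split Q? (list E)

Σ-True-≡ : {A : Set} {Q : A → Set} (Q? : Decidable Q) {a b : Σ A (λ a → True (Q? a))} → proj₁ a ≡ proj₁ b → a ≡ b
Σ-True-≡ Q? {a , p} {_ , q} refl = cong (a ,_) (T-irrelevant p q)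

enum-Σ : {A : Set} {P Q : A → Set} (Q? : Decidable Q) → Enum P →
  Enum {Σ A (λ a → True (Q? a))} (P ∘ proj₁)
enum-Σ {A} {P} {Q} Q? E = record
  { list = lift (list E)
  ; unique = unique-lift (list E) (unique E)
  ; sound = λ a∈ → sound E (∈-lift⁻ (list E) a∈)
  ; complete = λ p → ∈-lift⁺ (list E) (complete E p) }
  where
  B : Set
  B = Σ A (λ a → True (Q? a))
  lift : List A → List B
  lift [] = []
  lift (x ∷ xs) with Q? x
  ... | yes q = (x , fromWitness q) ∷ lift xs
  ... | no  _ = lift xs
  ∈-lift⁻ : ∀ xs {b} → b ∈ lift xs → proj₁ b ∈ xs
  ∈-lift⁻ (x ∷ xs) b∈ with Q? x
  ∈-lift⁻ (x ∷ xs) (here refl) | yes q = here refl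
  ∈-lift⁻ (x ∷ xs) (there b∈)  | yes q = there (∈-lift⁻ xs b∈)
  ... | no _ = there (∈-lift⁻ xs b∈)
  ∈-lift⁺ : ∀ xs {b} → proj₁ b ∈ xs → b ∈ lift xs
  ∈-lift⁺ (x ∷ xs) {b} b∈ with Q? x
  ∈-lift⁺ (x ∷ xs) {b} (here e)   | yes q = here (Σ-True-≡ Q? e)
  ∈-lift⁺ (x ∷ xs) {b} (there b∈) | yes q = there (∈-lift⁺ xs b∈)
  ∈-lift⁺ (x ∷ xs) {_ , p} (here refl) | no ¬q = contradiction (toWitness p) ¬q
  ∈-lift⁺ (x ∷ xs) {b} (there b∈) | no ¬q = ∈-lift⁺ xs b∈
  unique-lift : ∀ xs → Unique xs → Unique (lift xs)
  unique-lift [] [] = []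
  unique-lift (x ∷ xs) (x∉ ∷ u) with Q? x
  ... | yes q = All.tabulate (λ b∈ e → All.lookup x∉ (∈-lift⁻ xs b∈) (cong proj₁ e)) ∷ unique-lift xs u
  ... | no _ = unique-lift xs u

iter : {A : Set} → (A → A) → ℕ → A → A
iter f zero    a = a
iter f (suc n) a = f (iter f n a)

iter-+ : {A : Set} (f : A → A) (m n : ℕ) (a : A) → iter f (m + n) a ≡ iter f m (iter f n a)
iter-+ f zero    n a = refl
iter-+ f (suc m) n a = cong f (iter-+ f m n a)

iter-* : {A : Set} (f : A → A) (m n : ℕ) (a : A) → iter f (m * n) a ≡ iter (iter f n) m a
iter-* f zero    n a = refl
iter-* f (suc m) n a = trans (iter-+ f n (m * n) a) (cong (iter f n) (iter-* f m n a))

iter-fix : {A : Set} (f : A → A) (n : ℕ) {a : A} → f a ≡ a → iter f n a ≡ a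
iter-fix f zero    e = refl
iter-fix f (suc n) e = trans (cong f (iter-fix f n e)) e

module _ {A : Set} (_≟A_ : DecidableEquality A) where

  open import Data.List.Membership.DecPropositional _≟A_ using (_∈?_)

  -- Remove one orbit at a time.
  orbits-∣-card : (f : A → A) (m : ℕ) {P : A → Set} (E : Enum P) →
    (∀ {a} → P a → P (f a)) →
    (∀ {a} → P a → iter f (suc m) a ≡ a) →
    (∀ {a} i → P a → i < m → iter f (suc i) a ≢ a) →
    suc m ∣ card E
  orbits-∣-card f m E = go E (<-wellFounded (card E))
    where
    go : {P : A → Set} (E : Enum P) → Acc _<_ (card E) →
      (∀ {a} → P a → P (f a)) → (∀ {a} → P a → iter f (suc m) a ≡ a) →
      (∀ {a} i → P a → i < m → iter f (suc i) a ≢ a) → suc m ∣ card E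
    go {P} E (acc rs) Pf fm free = peel (list E) refl
      where
      peel : ∀ ys → list E ≡ ys → suc m ∣ card E
      peel [] eq = subst (suc m ∣_) (sym (cong length eq)) (suc m ∣0)
      peel (x ∷ xs) eq = subst (suc m ∣_) (sym split)
        (∣m∣n⇒∣m+n ∣-refl (go E′ (rs smaller) P′f (fm ∘ proj₁) (λ i → free i ∘ proj₁)))
        where
        Px : P x
        Px = sound E (subst (x ∈_) (sym eq) (here refl))
        P-iter : ∀ i → P (iter f i x)
        P-iter zero    = Px
        P-iter (suc i) = Pf (P-iter i)
        O : List A
        O = applyUpTo (λ i → iter f i x) (suc m)
        -- A coincidence would make `iter f i x` a fixed point of the power of `f` with exponent j -
        -- i, which lies between 1 and m.
        distinct : ∀ {i j} → i < j → j < suc m → iter f i x ≢ iter f j x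
        distinct {i} {j} i<j (s≤s j≤m) e = free (j ∸ suc i) (P-iter i)
          (<-≤-trans (subst (j ∸ suc i <_) (sym (+-∸-assoc 1 i<j)) (n<1+n _)) (≤-trans (m∸n≤m j i) j≤m))
          (trans (sym (iter-+ f (suc (j ∸ suc i)) i x)) (trans (cong (λ n → iter f n x) arith) (sym e)))
          where
          arith : suc (j ∸ suc i) + i ≡ j
          arith = trans (sym (+-suc (j ∸ suc i) i)) (m∸n+n≡m i<j)
        E′ : Enum (λ a → P a × a ∉ O)
        E′ = enum-filter (λ a → ¬? (a ∈? O)) E
        O-card : card (enum-filter (_∈? O) E) ≡ suc m
        O-card = trans (unique-length (unique (enum-filter (_∈? O) E)) (Uniq.applyUpTo⁺₁ (λ i → iter f i x) (suc m) distinct)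
            (λ a∈ → proj₂ (sound (enum-filter (_∈? O) E) a∈)) (λ a∈ → complete (enum-filter (_∈? O) E) (inP a∈ , a∈)))
          (length-applyUpTo (λ i → iter f i x) (suc m))
          where
          inP : ∀ {a} → a ∈ O → P a
          inP a∈ with ∈-applyUpTo⁻ (λ i → iter f i x) {n = suc m} a∈
          ... | i , _ , refl = P-iter i
        split : card E ≡ suc m + card E′
        split = trans (card-split (_∈? O) E) (cong (_+ card E′) O-card)
        smaller : card E′ < card E
        smaller = subst (card E′ <_) (sym split) (m<n+m (card E′) (s≤s z≤n))
        -- f⁻¹ = f^m maps the orbit to itself.
        P′f : ∀ {a} → P a × a ∉ O → P (f a) × f a ∉ O
        P′f {a} (p , a∉) = Pf p , λ fa∈ → a∉ (back fa∈)
          where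
          back : f a ∈ O → a ∈ O
          back fa∈ with ∈-applyUpTo⁻ (λ i → iter f i x) {n = suc m} fa∈
          ... | zero , _ , e = subst (_∈ O) (trans (sym a≡) (fm p))
                (∈-applyUpTo⁺ (λ i → iter f i x) (n<1+n m))
            where
            a≡ : iter f (suc m) a ≡ iter f m x
            a≡ = trans (cong (λ n → iter f n a) (+-comm 1 m)) (trans (iter-+ f m 1 a) (cong (iter f m) e))
          ... | suc i , s≤s i<m , e = subst (_∈ O) (trans (sym a≡) (fm p))
                (∈-applyUpTo⁺ (λ i → iter f i x) (<-trans i<m (n<1+n m)))
            where
            a≡ : iter f (suc m) a ≡ iter f i x
            a≡ = trans (cong (λ n → iter f n a) (+-comm 1 m)) (trans (iter-+ f m 1 a) (trans (cong (iter f m) e)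
              (trans (sym (iter-+ f m (suc i) x)) (trans (cong (λ n → iter f n x) (trans (+-comm m (suc i)) (sym (+-suc i m))))
              (trans (iter-+ f i (suc m) x) (cong (iter f i) (fm Px)))))))

  3∣card : (A → Set) → Set
  3∣card P = Σ (Enum P) (λ E → 3 ∣ card E)

  3∣card-⇔ : {P Q : A → Set} → (∀ {a} → P a → Q a) → (∀ {a} → Q a → P a) → 3∣card P → 3∣card Q
  3∣card-⇔ f g (E , d) = enum-⇔ f g E , d

  -- Off the fixed points every orbit has exactly three elements: `f (f a) ≡ a` together with
  -- `f (f (f a)) ≡ a` forces `f a ≡ a`.
  3∣card-fix-cube : (f : A → A) {P : A → Set} → (∀ {a} → P a → P (f a)) →
    (∀ {a} → P a → f (f (f a)) ≡ a) → 3∣card P → 3∣card (λ a → P a × f a ≡ a)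
  3∣card-fix-cube f {P} Pf f³ (E , d) = Fx , ∣m+n∣m⇒∣n (subst (3 ∣_) (trans (card-split fix? E) (+-comm (card Fx) (card Mv))) d)
      (orbits-∣-card f 2 Mv moved (f³ ∘ proj₁) free)
    where
    fix? : Decidable (λ a → f a ≡ a)
    fix? a = f a ≟A a
    Fx = enum-filter fix? E
    Mv = enum-filter (¬? ∘ fix?) E
    moved : ∀ {a} → P a × f a ≢ a → P (f a) × f (f a) ≢ f a
    moved (p , ne) = Pf p , λ e → ne (sym (trans (sym (f³ p)) (trans (cong f e) e)))
    free : ∀ {a} i → P a × f a ≢ a → i < 2 → iter f (suc i) a ≢ a
    free zero (p , ne) _ = ne
    free (suc zero) (p , ne) _ e = ne (trans (sym (cong f e)) (f³ p))
    free (suc (suc i)) _ (s≤s (s≤s ()))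

  -- The fixed point theorem for a cyclic 3-group, by induction on the exponent: the cube of
  -- `iter f (3 ^ n)` is the identity, and on the fixed points of that map `f` satisfies the
  -- hypothesis for the smaller exponent.
  3∣card-fix : (f : A → A) (n : ℕ) {P : A → Set} → (∀ {a} → P a → P (f a)) →
    (∀ {a} → P a → iter f (3 ^ n) a ≡ a) → 3∣card P → 3∣card (λ a → P a × f a ≡ a)
  3∣card-fix f zero    Pf fn D = 3∣card-⇔ (λ p → p , fn p) proj₁ D
  3∣card-fix f (suc n) {P} Pf fn D =
    3∣card-⇔ (λ ((p , _) , e) → p , e) (λ (p , e) → (p , iter-fix f (3 ^ n) e) , e)
      (3∣card-fix f n (λ {a} (p , e) → Pf p , trans (iter-comm (3 ^ n) a) (cong f e)) proj₂
        (3∣card-fix-cube (iter f (3 ^ n)) P-iter (λ {a} p → trans (sym (iter-* f 3 (3 ^ n) a)) (fn p)) D))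
    where
    iter-comm : ∀ m a → iter f m (f a) ≡ f (iter f m a)
    iter-comm zero    a = refl
    iter-comm (suc m) a = cong f (iter-comm m a)
    P-iter′ : ∀ m {a} → P a → P (iter f m a)
    P-iter′ zero    p = p
    P-iter′ (suc m) p = Pf (P-iter′ m p)
    P-iter : ∀ {a} → P a → P (iter f (3 ^ n) a)
    P-iter = P-iter′ (3 ^ n)

  3∣card-other : {P : A → Set} → 3∣card P → {a : A} → P a → ∃ λ b → P b × b ≢ a
  3∣card-other {P} (E , d) {a} p = pick (list E) (sound E) (unique E) (complete E p) d
    where
    pick : ∀ ys → (∀ {b} → b ∈ ys → P b) → Unique ys → a ∈ ys → 3 ∣ length ys → ∃ λ b → P b × b ≢ a
    pick (x ∷ []) _ _ _ (divides zero ())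
    pick (x ∷ []) _ _ _ (divides (suc q) ())
    pick (x ∷ y ∷ _) s ((x≢y ∷ _) ∷ _) _ _ with x ≟A a
    ... | no x≢a   = x , s (here refl) , x≢a
    ... | yes refl = y , s (there (here refl)) , x≢y ∘ sym

-- Finite groups

data Mod3 : ℕ → Set where
  mod0 : ∀ q → Mod3 (3 * q)
  mod1 : ∀ q → Mod3 (1 + 3 * q)
  mod2 : ∀ q → Mod3 (2 + 3 * q)

mod3 : ∀ n → Mod3 n
mod3 zero = mod0 0
mod3 (suc n) with mod3 n
... | mod0 q = mod1 q
... | mod1 q = mod2 q
... | mod2 q = subst Mod3 (eq q) (mod0 (suc q))
  where
  eq : ∀ q → 3 * suc q ≡ suc (2 + 3 * q)
  eq = solve-∀

least : {P : ℕ → Set} → Decidable P → ∀ n → P n → ∃ λ m → P m × (∀ i → i < m → ¬ P i)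
least P? zero p = zero , p , λ _ ()
least {P} P? (suc n) p with P? 0
... | yes p₀ = zero , p₀ , λ _ ()
... | no ¬p₀ with least {P ∘ suc} (P? ∘ suc) n p
... | m , pm , below = suc m , pm , below′
  where
  below′ : ∀ i → i < suc m → ¬ P i
  below′ zero    _         = ¬p₀
  below′ (suc i) (s≤s i<m) = below i i<m

-- Finds the exact exponent at which a 3-power multiple becomes trivial: `P n` will say that the
-- power with exponent `3 ^ n` vanishes.
switch : {P : ℕ → Set} → Decidable P → ∀ n → P n → ¬ P 0 → ∃ λ m → ¬ P m × P (suc m)
switch P? zero p ¬p₀ = contradiction p ¬p₀
switch P? (suc n) p ¬p₀ with P? n
... | yes q = switch P? n q ¬p₀
... | no ¬q = n , ¬q , p

module FinGroupProps (H : FinGroup) where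
  open FinGroup H public
  open GroupNotions H public
  open IsGroup isGroup public using (assoc; identityˡ; identityʳ; inverseˡ; inverseʳ)

  group : Group 0ℓ 0ℓ
  group = record { isGroup = isGroup }

  open Algebra.Properties.Group group public
    using (∙-cancelˡ; ∙-cancelʳ; ⁻¹-anti-homo-∙; ε⁻¹≈ε; ⁻¹-involutive; ⁻¹-injective; inverseˡ-unique; inverseʳ-unique; //-rightDividesˡ; //-rightDividesʳ)
  open Algebra.Solver.Monoid (Group.monoid group) public using (solve; _⊕_; _⊜_)

  _≟ᵉ_ : (u v : Elem) → Dec (u ≡ v)
  _≟ᵉ_ = Fin._≟_

  pow-+ : ∀ u m n → pow u (m + n) ≡ pow u m ∙ pow u n
  pow-+ u zero    n = sym (identityˡ _)
  pow-+ u (suc m) n = trans (cong (u ∙_) (pow-+ u m n)) (sym (assoc _ _ _))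

  pow-* : ∀ u m n → pow u (m * n) ≡ pow (pow u n) m
  pow-* u zero    n = refl
  pow-* u (suc m) n = trans (pow-+ u n (m * n)) (cong (pow u n ∙_) (pow-* u m n))

  pow-ε : ∀ n → pow ε n ≡ ε
  pow-ε zero    = refl
  pow-ε (suc n) = trans (identityˡ _) (pow-ε n)

  pow-1 : ∀ u → pow u 1 ≡ u
  pow-1 u = identityʳ u

  Comm : Elem → Elem → Set
  Comm u v = u ∙ v ≡ v ∙ u

  comm-ε : ∀ u → Comm u ε
  comm-ε u = trans (identityʳ u) (sym (identityˡ u))

  comm-∙ : ∀ {u v w} → Comm u v → Comm u w → Comm u (v ∙ w)
  comm-∙ {u} {v} {w} p q = begin
    u ∙ (v ∙ w) ≡⟨ assoc u v w ⟨
    (u ∙ v) ∙ w ≡⟨ cong (_∙ w) p ⟩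
    (v ∙ u) ∙ w ≡⟨ assoc v u w ⟩
    v ∙ (u ∙ w) ≡⟨ cong (v ∙_) q ⟩
    v ∙ (w ∙ u) ≡⟨ assoc v w u ⟨
    (v ∙ w) ∙ u ∎
    where open ≡-Reasoning

  comm-pow : ∀ {u v} n → Comm u v → Comm u (pow v n)
  comm-pow zero    p = comm-ε _
  comm-pow (suc n) p = comm-∙ p (comm-pow n p)

  comm-inv : ∀ {u v} → Comm u v → Comm u (v ⁻¹)
  comm-inv {u} {v} p = ∙-cancelʳ v _ _ (begin
    (u ∙ v ⁻¹) ∙ v ≡⟨ assoc _ _ _ ⟩
    u ∙ (v ⁻¹ ∙ v) ≡⟨ cong (u ∙_) (inverseˡ v) ⟩
    u ∙ ε          ≡⟨ comm-ε u ⟩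
    ε ∙ u          ≡⟨ cong (_∙ u) (inverseˡ v) ⟨
    (v ⁻¹ ∙ v) ∙ u ≡⟨ assoc _ _ _ ⟩
    v ⁻¹ ∙ (v ∙ u) ≡⟨ cong (v ⁻¹ ∙_) p ⟨
    v ⁻¹ ∙ (u ∙ v) ≡⟨ assoc _ _ _ ⟨
    (v ⁻¹ ∙ u) ∙ v ∎)
    where open ≡-Reasoning

  pow-suc′ : ∀ u n → pow u (suc n) ≡ pow u n ∙ u
  pow-suc′ u n = comm-pow n refl

  pow-∙ : ∀ {u v} n → Comm u v → pow (u ∙ v) n ≡ pow u n ∙ pow v n
  pow-∙ zero p = sym (identityˡ ε)
  pow-∙ {u} {v} (suc n) p = begin
    (u ∙ v) ∙ pow (u ∙ v) n         ≡⟨ cong ((u ∙ v) ∙_) (pow-∙ n p) ⟩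
    (u ∙ v) ∙ (pow u n ∙ pow v n)   ≡⟨ solve 4 (λ a b c d → (a ⊕ b) ⊕ (c ⊕ d) ⊜ (a ⊕ (b ⊕ c)) ⊕ d) refl u v (pow u n) (pow v n) ⟩
    (u ∙ (v ∙ pow u n)) ∙ pow v n   ≡⟨ cong (λ w → (u ∙ w) ∙ pow v n) (comm-pow n (sym p)) ⟩
    (u ∙ (pow u n ∙ v)) ∙ pow v n   ≡⟨ solve 4 (λ a b c d → (a ⊕ (b ⊕ c)) ⊕ d ⊜ (a ⊕ b) ⊕ (c ⊕ d)) refl u (pow u n) v (pow v n) ⟩
    (u ∙ pow u n) ∙ (v ∙ pow v n)   ∎
    where open ≡-Reasoning

  pow-⁻¹ : ∀ u n → pow (u ⁻¹) n ≡ (pow u n) ⁻¹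
  pow-⁻¹ u n = inverseˡ-unique _ _ (begin
    pow (u ⁻¹) n ∙ pow u n ≡⟨ pow-∙ n (sym (comm-inv refl)) ⟨
    pow (u ⁻¹ ∙ u) n       ≡⟨ cong (λ w → pow w n) (inverseˡ u) ⟩
    pow ε n                ≡⟨ pow-ε n ⟩
    ε                      ∎)
    where open ≡-Reasoning

  pow-3 : ∀ {u} → pow u 3 ≡ ε → ∀ n → pow u (3 * n) ≡ ε
  pow-3 {u} u³ n = trans (cong (pow u) (*-comm 3 n)) (trans (pow-* u n 3) (trans (cong (λ w → pow w n) u³) (pow-ε n)))

  pow-conj : ∀ {a b} r → b ∙ a ≡ pow a r ∙ b → ∀ m i → pow b m ∙ pow a i ≡ pow a (i * r ^ m) ∙ pow b m
  pow-conj {a} {b} r e = go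
    where
    open ≡-Reasoning
    one : ∀ i → b ∙ pow a i ≡ pow a (i * r) ∙ b
    one zero = comm-ε b
    one (suc i) = begin
      b ∙ (a ∙ pow a i)             ≡⟨ assoc _ _ _ ⟨
      (b ∙ a) ∙ pow a i             ≡⟨ cong (_∙ pow a i) e ⟩
      (pow a r ∙ b) ∙ pow a i       ≡⟨ assoc _ _ _ ⟩
      pow a r ∙ (b ∙ pow a i)       ≡⟨ cong (pow a r ∙_) (one i) ⟩
      pow a r ∙ (pow a (i * r) ∙ b) ≡⟨ assoc _ _ _ ⟨
      (pow a r ∙ pow a (i * r)) ∙ b ≡⟨ cong (_∙ b) (pow-+ a r (i * r)) ⟨
      pow a (suc i * r) ∙ b         ∎
    go : ∀ m i → pow b m ∙ pow a i ≡ pow a (i * r ^ m) ∙ pow b m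
    go zero i = trans (identityˡ _) (trans (cong (pow a) (sym (*-identityʳ i))) (sym (identityʳ _)))
    go (suc m) i = begin
      (b ∙ pow b m) ∙ pow a i                     ≡⟨ assoc _ _ _ ⟩
      b ∙ (pow b m ∙ pow a i)                     ≡⟨ cong (b ∙_) (go m i) ⟩
      b ∙ (pow a (i * r ^ m) ∙ pow b m)           ≡⟨ assoc _ _ _ ⟨
      (b ∙ pow a (i * r ^ m)) ∙ pow b m           ≡⟨ cong (_∙ pow b m) (one (i * r ^ m)) ⟩
      (pow a (i * r ^ m * r) ∙ b) ∙ pow b m       ≡⟨ assoc _ _ _ ⟩
      pow a (i * r ^ m * r) ∙ (b ∙ pow b m)       ≡⟨ cong (λ n → pow a n ∙ (b ∙ pow b m)) (trans (*-assoc i (r ^ m) r) (cong (i *_) (*-comm (r ^ m) r))) ⟩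
      pow a (i * r ^ suc m) ∙ (b ∙ pow b m)       ∎

  iter-∙ : ∀ u n v → iter (u ∙_) n v ≡ pow u n ∙ v
  iter-∙ u zero    v = sym (identityˡ v)
  iter-∙ u (suc n) v = trans (cong (u ∙_) (iter-∙ u n v)) (sym (assoc _ _ _))

  abstract
    finite-order : ∀ u → ∃ λ n → pow u (suc n) ≡ ε
    finite-order u with Finₚ.pigeonhole (n<1+n order) (pow u ∘ toℕ)
    ... | i , j , i<j , e = toℕ j ∸ suc (toℕ i) , sym (∙-cancelʳ (pow u (toℕ i)) _ _ (begin
        ε ∙ pow u (toℕ i)                                   ≡⟨ identityˡ _ ⟩
        pow u (toℕ i)                                       ≡⟨ e ⟩
        pow u (toℕ j)                                       ≡⟨ cong (pow u) (trans (sym (+-suc (toℕ j ∸ suc (toℕ i)) (toℕ i))) (m∸n+n≡m i<j)) ⟨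
        pow u (suc (toℕ j ∸ suc (toℕ i)) + toℕ i)           ≡⟨ pow-+ u (suc (toℕ j ∸ suc (toℕ i))) (toℕ i) ⟩
        pow u (suc (toℕ j ∸ suc (toℕ i))) ∙ pow u (toℕ i)   ∎))
      where open ≡-Reasoning

    -- Lagrange's theorem: left multiplication by `u` splits the group into orbits whose common size
    -- is the order of `u`.
    pow-order : ∀ u → pow u order ≡ ε
    pow-order u with finite-order u
    ... | n , e with least (λ m → pow u (suc m) ≟ᵉ ε) n e
    ... | m , um , below with subst (suc m ∣_) (card-Fin order)
          (orbits-∣-card _≟ᵉ_ (u ∙_) m (enum-Fin order) _
            (λ {a} _ → trans (iter-∙ u (suc m) a) (trans (cong (_∙ a) um) (identityˡ a)))
            (λ {a} i _ i<m e′ → below i i<m (∙-cancelʳ a _ _ (trans (sym (iter-∙ u (suc i) a)) (trans e′ (sym (identityˡ a)))))))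
    ... | divides q eq = trans (cong (pow u) eq) (trans (pow-* u q (suc m)) (trans (cong (λ w → pow w q) um) (pow-ε q)))

    pow-inverse : ∀ u → u ⁻¹ ≡ pow u (order ∸ 1)
    pow-inverse u = sym (inverseʳ-unique _ _ (trans (cong (pow u) (m+[n∸m]≡n (1≤order ε))) (pow-order u)))
      where
      1≤order : ∀ {n} → Fin n → 1 ≤ n
      1≤order {suc n} _ = s≤s z≤n

  submonoid⇒subgroup : {P : Elem → Set} → P ε → (∀ {u v} → P u → P v → P (u ∙ v)) → IsSubgroup P
  submonoid⇒subgroup {P} P-ε P-∙ = record
    { ε∈ = P-ε ; ∙∈ = P-∙ ; ⁻¹∈ = λ {u} p → subst P (sym (pow-inverse u)) (P-pow (order ∸ 1) p) }
    where
    P-pow : ∀ n {u} → P u → P (pow u n)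
    P-pow zero    p = P-ε
    P-pow (suc n) p = P-∙ p (P-pow n p)

-- Commutators in inner-abelian metacyclic 3-groups

record CubeCommutators (H : FinGroup) : Set where
  open FinGroupProps H
  field
    c       : Elem
    c≢ε     : c ≢ ε
    c³      : pow c 3 ≡ ε
    central : ∀ u → Comm c u
    -- The extraspecial group of order 27 and exponent 3 satisfies every other field; a cube root of
    -- `c` excludes it.
    root    : Elem
    root³   : pow root 3 ≡ c
    commute : ∀ u v → ∃ λ n → u ∙ v ≡ pow c n ∙ (v ∙ u)

-- 2 is -1 modulo 3 and `3 ^ k` is odd. It will follow that an element of 3-power order cannot
-- invert an element of order 3.
^3^-mod2 : ∀ k q → ∃ λ a → (2 + 3 * q) ^ (3 ^ k) ≡ 2 + 3 * a
^3^-mod2 zero q = q , *-identityʳ (2 + 3 * q)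
^3^-mod2 (suc k) q with ^3^-mod2 k q
... | a , e = 2 + 12 * a + 18 * (a * a) + 9 * (a * a * a) , (begin
    (2 + 3 * q) ^ (3 * 3 ^ k)                          ≡⟨ cong ((2 + 3 * q) ^_) (*-comm 3 (3 ^ k)) ⟩
    (2 + 3 * q) ^ (3 ^ k * 3)                          ≡⟨ ^-*-assoc (2 + 3 * q) (3 ^ k) 3 ⟨
    ((2 + 3 * q) ^ (3 ^ k)) ^ 3                        ≡⟨ cong (_^ 3) e ⟩
    (2 + 3 * a) ^ 3                                    ≡⟨ lemma a ⟩
    2 + 3 * (2 + 12 * a + 18 * (a * a) + 9 * (a * a * a)) ∎)
  where
  open ≡-Reasoning
  lemma : ∀ a → (2 + 3 * a) * ((2 + 3 * a) * ((2 + 3 * a) * 1)) ≡ 2 + 3 * (2 + 12 * a + 18 * (a * a) + 9 * (a * a * a))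
  lemma = solve-∀

record Metacyclic (H : FinGroup) : Set where
  open FinGroupProps H
  field
    g h   : Elem
    span  : ∀ u → ∃₂ λ i j → u ≡ pow g i ∙ pow h j
    r     : ℕ
    conj  : h ∙ g ≡ pow g r ∙ h

metacyclic-generators : (H : FinGroup) → GroupNotions.IsMetacyclic H → Metacyclic H
metacyclic-generators H (P , sub , normal , (g , Pg , gen) , (h , quot)) = record
  { g = g ; h = h ; span = span ; r = proj₁ (gen (normal h Pg)) ; conj = conj }
  where
  open FinGroupProps H
  open ≡-Reasoning
  span : ∀ u → ∃₂ λ i j → u ≡ pow g i ∙ pow h j
  span u with quot u
  ... | j , p with gen p
  ... | i , e = i , j , trans (sym (//-rightDividesˡ (pow h j) u)) (cong (_∙ pow h j) e)
  conj : h ∙ g ≡ pow g (proj₁ (gen (normal h Pg))) ∙ h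
  conj = trans (sym (//-rightDividesˡ h (h ∙ g))) (cong (_∙ h) (proj₂ (gen (normal h Pg))))

module InnerAbelian (H : FinGroup) (M : Metacyclic H) (k : ℕ) (ord : FinGroup.order H ≡ 3 ^ k)
    (inner : GroupNotions.IsInnerAbelian H) where
  open FinGroupProps H
  open Metacyclic M
  open ≡-Reasoning

  abstract
    torsion : ∀ u → pow u (3 ^ k) ≡ ε
    torsion u = subst (λ n → pow u n ≡ ε) ord (pow-order u)

  gh-comm⇒abelian : Comm g h → IsAbelian
  gh-comm⇒abelian e u v with span u | span v
  ... | i , j , refl | i′ , j′ , refl =
    comm-∙ (sym (comm-∙ (comm-pow i refl′) (comm-pow j (gᵢ-h i′)))) (sym (comm-∙ (comm-pow i (sym (gᵢ-h′ j′))) (comm-pow j (sym (hⱼ-h j′)))))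
    where
    refl′ : Comm (pow g i′) g
    refl′ = sym (comm-pow i′ refl)
    gᵢ-h : ∀ n → Comm (pow g n) h
    gᵢ-h n = sym (comm-pow n (sym e))
    gᵢ-h′ : ∀ n → Comm g (pow h n)
    gᵢ-h′ n = comm-pow n e
    hⱼ-h : ∀ n → Comm h (pow h n)
    hⱼ-h n = comm-pow n refl

  gh-noncomm : ¬ Comm g h
  gh-noncomm e = proj₁ inner (gh-comm⇒abelian e)

  -- Test the action of h on a power of g of order 3.
  r≡1mod3 : ∃ λ s → r ≡ 1 + 3 * s
  r≡1mod3 = test (switch (λ n → pow g (3 ^ n) ≟ᵉ ε) k (torsion g)
                 (λ e → gh-noncomm (subst (λ w → Comm w h) (sym (trans (sym (pow-1 g)) e)) (sym (comm-ε h)))))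
    where
    test : (∃ λ n → pow g (3 ^ n) ≢ ε × pow g (3 ^ suc n) ≡ ε) → ∃ λ s → r ≡ 1 + 3 * s
    test (n , f≢ε , f³) = helper (mod3 r) refl
      where
      f : Elem
      f = pow g (3 ^ n)
      f^3 : pow f 3 ≡ ε
      f^3 = trans (sym (pow-* g 3 (3 ^ n))) f³
      hf : h ∙ f ≡ pow f r ∙ h
      hf = trans (sym (cong (_∙ f) (pow-1 h))) (trans (pow-conj r conj 1 (3 ^ n))
        (cong₂ _∙_ (trans (cong (pow g) (trans (*-comm (3 ^ n) (r ^ 1)) (cong (_* 3 ^ n) (^-identityʳ r)))) (pow-* g r (3 ^ n))) (pow-1 h)))
      reduce : ∀ i q → pow f (i + 3 * q) ≡ pow f i
      reduce i q = trans (pow-+ f i (3 * q)) (trans (cong (pow f i ∙_) (pow-3 f^3 q)) (identityʳ _))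
      helper : ∀ {r′} → Mod3 r′ → r ≡ r′ → ∃ λ s → r ≡ 1 + 3 * s
      helper (mod1 q) eq = q , eq
      helper (mod0 q) eq = contradiction (∙-cancelˡ h f ε (begin
        h ∙ f               ≡⟨ hf ⟩
        pow f r ∙ h         ≡⟨ cong (λ m → pow f m ∙ h) eq ⟩
        pow f (3 * q) ∙ h   ≡⟨ cong (_∙ h) (pow-3 f^3 q) ⟩
        ε ∙ h               ≡⟨ comm-ε h ⟨
        h ∙ ε               ∎)) f≢ε
      -- Here `h` inverts `f`, hence so does its odd power `pow h (3 ^ k)`. That power is trivial,
      -- so f = f².
      helper (mod2 q) eq = let (a , ea) = ^3^-mod2 k q in contradiction (sym (∙-cancelˡ f ε f (begin
        f ∙ ε                              ≡⟨ comm-ε f ⟩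
        ε ∙ f                              ≡⟨ cong₂ _∙_ (sym (torsion h)) (sym (pow-1 f)) ⟩
        pow h (3 ^ k) ∙ pow f 1            ≡⟨ pow-conj r hf (3 ^ k) 1 ⟩
        pow f (1 * r ^ (3 ^ k)) ∙ pow h (3 ^ k) ≡⟨ cong₂ _∙_ (cong (pow f) (trans (*-identityˡ _) (trans (cong (_^ (3 ^ k)) eq) ea))) (torsion h) ⟩
        pow f (2 + 3 * a) ∙ ε              ≡⟨ identityʳ _ ⟩
        pow f (2 + 3 * a)                  ≡⟨ reduce 2 a ⟩
        f ∙ (f ∙ ε)                        ≡⟨ cong (f ∙_) (identityʳ f) ⟩
        f ∙ f                              ∎))) f≢ε

  s : ℕ
  s = proj₁ r≡1mod3

  -- The subgroup generated by `pow g 3` and `h`. Once it is known to be proper, inner-abelianness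
  -- makes these two elements commute.
  K : Elem → Set
  K u = ∃₂ λ i j → u ≡ pow g (3 * i) ∙ pow h j

  K-subgroup : IsSubgroup K
  K-subgroup = submonoid⇒subgroup (0 , 0 , sym (identityˡ ε)) mult
    where
    mult : ∀ {u v} → K u → K v → K (u ∙ v)
    mult (i , j , refl) (i′ , j′ , refl) = i + i′ * r ^ j , j + j′ , (begin
      (pow g (3 * i) ∙ pow h j) ∙ (pow g (3 * i′) ∙ pow h j′)
        ≡⟨ solve 4 (λ a b c d → (a ⊕ b) ⊕ (c ⊕ d) ⊜ (a ⊕ (b ⊕ c)) ⊕ d) refl _ _ _ _ ⟩
      (pow g (3 * i) ∙ (pow h j ∙ pow g (3 * i′))) ∙ pow h j′
        ≡⟨ cong (λ w → (pow g (3 * i) ∙ w) ∙ pow h j′) (pow-conj r conj j (3 * i′)) ⟩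
      (pow g (3 * i) ∙ (pow g (3 * i′ * r ^ j) ∙ pow h j)) ∙ pow h j′
        ≡⟨ solve 4 (λ a b c d → (a ⊕ (b ⊕ c)) ⊕ d ⊜ (a ⊕ b) ⊕ (c ⊕ d)) refl _ _ _ _ ⟩
      (pow g (3 * i) ∙ pow g (3 * i′ * r ^ j)) ∙ (pow h j ∙ pow h j′)
        ≡⟨ cong₂ _∙_ (pow-+ g (3 * i) (3 * i′ * r ^ j)) (pow-+ h j j′) ⟨
      pow g (3 * i + 3 * i′ * r ^ j) ∙ pow h (j + j′)
        ≡⟨ cong (λ n → pow g n ∙ pow h (j + j′)) (arith i i′ (r ^ j)) ⟩
      pow g (3 * (i + i′ * r ^ j)) ∙ pow h (j + j′) ∎)
      where
      arith : ∀ i i′ x → 3 * i + 3 * i′ * x ≡ 3 * (i + i′ * x)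
      arith = solve-∀

  -- If g = g^{3i} κ with κ a power of h, then iterating g ∈ ⟨g^{3ⁿ}⟩ ⟨κ⟩ for all n, so g is a power of h.
  K-proper : IsProper K
  K-proper = g , λ (i , j , e) → gh-noncomm (comm i (pow h j) e (comm-pow j refl))
    where
    comm : ∀ i κ → g ≡ pow g (3 * i) ∙ κ → Comm h κ → Comm g h
    comm i κ e hκ = finish (go k)
      where
      -- `κ` is the quotient of two powers of `g`.
      κg : Comm κ g
      κg = ∙-cancelˡ (pow g (3 * i)) _ _ (begin
        pow g (3 * i) ∙ (κ ∙ g) ≡⟨ assoc _ _ _ ⟨
        (pow g (3 * i) ∙ κ) ∙ g ≡⟨ cong (_∙ g) e ⟨
        g ∙ g                   ≡⟨ cong (g ∙_) e ⟩
        g ∙ (pow g (3 * i) ∙ κ) ≡⟨ assoc _ _ _ ⟨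
        (g ∙ pow g (3 * i)) ∙ κ ≡⟨ cong (_∙ κ) (comm-pow (3 * i) refl) ⟩
        (pow g (3 * i) ∙ g) ∙ κ ≡⟨ assoc _ _ _ ⟩
        pow g (3 * i) ∙ (g ∙ κ) ∎)
      go : ∀ n → ∃₂ λ u m → g ≡ pow g (u * 3 ^ n) ∙ pow κ m
      go zero = 1 , 0 , sym (trans (identityʳ _) (pow-1 g))
      go (suc n) = step (go n)
        where
        step : (∃₂ λ u m → g ≡ pow g (u * 3 ^ n) ∙ pow κ m) → ∃₂ λ u m → g ≡ pow g (u * 3 ^ suc n) ∙ pow κ m
        step (u , m , eq) = u * i , u * 3 ^ n + m , (begin
          g                                                    ≡⟨ eq ⟩
          pow g (u * 3 ^ n) ∙ pow κ m                          ≡⟨ cong (λ w → pow w (u * 3 ^ n) ∙ pow κ m) e ⟩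
          pow (pow g (3 * i) ∙ κ) (u * 3 ^ n) ∙ pow κ m        ≡⟨ cong (_∙ pow κ m) (pow-∙ (u * 3 ^ n) (sym (comm-pow (3 * i) κg))) ⟩
          (pow (pow g (3 * i)) (u * 3 ^ n) ∙ pow κ (u * 3 ^ n)) ∙ pow κ m ≡⟨ assoc _ _ _ ⟩
          pow (pow g (3 * i)) (u * 3 ^ n) ∙ (pow κ (u * 3 ^ n) ∙ pow κ m) ≡⟨ cong₂ _∙_ (pow-* g (u * 3 ^ n) (3 * i)) (pow-+ κ (u * 3 ^ n) m) ⟨
          pow g (u * 3 ^ n * (3 * i)) ∙ pow κ (u * 3 ^ n + m)  ≡⟨ cong (λ l → pow g l ∙ pow κ (u * 3 ^ n + m)) (arith u (3 ^ n) i) ⟩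
          pow g (u * i * 3 ^ suc n) ∙ pow κ (u * 3 ^ n + m)    ∎)
          where
          arith : ∀ u t i → u * t * (3 * i) ≡ u * i * (3 * t)
          arith = solve-∀
      finish : (∃₂ λ u m → g ≡ pow g (u * 3 ^ k) ∙ pow κ m) → Comm g h
      finish (u , m , eq) = subst (λ w → Comm w h) (sym (trans eq (trans (cong (_∙ pow κ m) (trans (pow-* g u (3 ^ k)) (trans (cong (λ w → pow w u) (torsion g)) (pow-ε u)))) (identityˡ _))))
        (sym (comm-pow m hκ))

  g³h : Comm (pow g 3) h
  g³h = proj₂ inner K K-subgroup K-proper (1 , 0 , sym (identityʳ _)) (0 , 1 , sym (trans (identityˡ _) (pow-1 h)))

  -- The commutator of `h` and `g`, because r = 1 + 3s. As a power of `pow g 3` it commutes with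
  -- both generators, and it is visibly the cube of `pow g s`.
  c : Elem
  c = pow g (3 * s)

  c-g³ : c ≡ pow (pow g 3) s
  c-g³ = trans (cong (pow g) (*-comm 3 s)) (pow-* g s 3)

  central : ∀ u → Comm c u
  central u with span u
  ... | i , j , refl = comm-∙ (comm-pow i (sym (comm-pow (3 * s) refl)))
    (comm-pow j (subst (λ w → Comm w h) (sym c-g³) (sym (comm-pow s (sym g³h)))))

  hg : h ∙ g ≡ c ∙ (g ∙ h)
  hg = begin
    h ∙ g                   ≡⟨ conj ⟩
    pow g r ∙ h             ≡⟨ cong (λ n → pow g n ∙ h) (trans (proj₂ r≡1mod3) (+-comm 1 (3 * s))) ⟩
    pow g (3 * s + 1) ∙ h   ≡⟨ cong (_∙ h) (pow-+ g (3 * s) 1) ⟩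
    (c ∙ pow g 1) ∙ h       ≡⟨ cong (λ w → (c ∙ w) ∙ h) (pow-1 g) ⟩
    (c ∙ g) ∙ h             ≡⟨ assoc _ _ _ ⟩
    c ∙ (g ∙ h)             ∎

  swap : ∀ j i → pow h j ∙ pow g i ≡ pow c (j * i) ∙ (pow g i ∙ pow h j)
  swap = go
    where
    one : ∀ i → h ∙ pow g i ≡ pow c i ∙ (pow g i ∙ h)
    one zero = trans (comm-ε h) (sym (trans (identityˡ _) refl))
    one (suc i) = begin
      h ∙ (g ∙ pow g i)                      ≡⟨ assoc _ _ _ ⟨
      (h ∙ g) ∙ pow g i                      ≡⟨ cong (_∙ pow g i) hg ⟩
      (c ∙ (g ∙ h)) ∙ pow g i                ≡⟨ solve 4 (λ a b d e → (a ⊕ (b ⊕ d)) ⊕ e ⊜ a ⊕ (b ⊕ (d ⊕ e))) refl _ _ _ _ ⟩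
      c ∙ (g ∙ (h ∙ pow g i))                ≡⟨ cong (λ w → c ∙ (g ∙ w)) (one i) ⟩
      c ∙ (g ∙ (pow c i ∙ (pow g i ∙ h)))    ≡⟨ solve 5 (λ a b d e f → a ⊕ (b ⊕ (d ⊕ (e ⊕ f))) ⊜ a ⊕ ((b ⊕ d) ⊕ (e ⊕ f))) refl _ _ _ _ _ ⟩
      c ∙ ((g ∙ pow c i) ∙ (pow g i ∙ h))    ≡⟨ cong (λ w → c ∙ (w ∙ (pow g i ∙ h))) (comm-pow i (sym (central g))) ⟩
      c ∙ ((pow c i ∙ g) ∙ (pow g i ∙ h))    ≡⟨ solve 5 (λ a b d e f → a ⊕ ((b ⊕ d) ⊕ (e ⊕ f)) ⊜ (a ⊕ b) ⊕ ((d ⊕ e) ⊕ f)) refl _ _ _ _ _ ⟩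
      (c ∙ pow c i) ∙ ((g ∙ pow g i) ∙ h)    ∎
    go : ∀ j i → pow h j ∙ pow g i ≡ pow c (j * i) ∙ (pow g i ∙ pow h j)
    go zero i = trans (identityˡ _) (sym (trans (identityˡ _) (identityʳ _)))
    go (suc j) i = begin
      (h ∙ pow h j) ∙ pow g i                               ≡⟨ assoc _ _ _ ⟩
      h ∙ (pow h j ∙ pow g i)                               ≡⟨ cong (h ∙_) (go j i) ⟩
      h ∙ (pow c (j * i) ∙ (pow g i ∙ pow h j))             ≡⟨ solve 4 (λ a b d e → a ⊕ (b ⊕ (d ⊕ e)) ⊜ (a ⊕ b) ⊕ (d ⊕ e)) refl _ _ _ _ ⟩
      (h ∙ pow c (j * i)) ∙ (pow g i ∙ pow h j)             ≡⟨ cong (_∙ (pow g i ∙ pow h j)) (comm-pow (j * i) (sym (central h))) ⟩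
      (pow c (j * i) ∙ h) ∙ (pow g i ∙ pow h j)             ≡⟨ solve 4 (λ a b d e → (a ⊕ b) ⊕ (d ⊕ e) ⊜ a ⊕ ((b ⊕ d) ⊕ e)) refl _ _ _ _ ⟩
      pow c (j * i) ∙ ((h ∙ pow g i) ∙ pow h j)             ≡⟨ cong (λ w → pow c (j * i) ∙ (w ∙ pow h j)) (one i) ⟩
      pow c (j * i) ∙ ((pow c i ∙ (pow g i ∙ h)) ∙ pow h j) ≡⟨ solve 5 (λ a b d e f → a ⊕ ((b ⊕ (d ⊕ e)) ⊕ f) ⊜ (a ⊕ b) ⊕ (d ⊕ (e ⊕ f))) refl _ _ _ _ _ ⟩
      (pow c (j * i) ∙ pow c i) ∙ (pow g i ∙ (h ∙ pow h j)) ≡⟨ cong (_∙ (pow g i ∙ (h ∙ pow h j))) (trans (sym (pow-+ c (j * i) i)) (cong (pow c) (+-comm (j * i) i))) ⟩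
      pow c (suc j * i) ∙ (pow g i ∙ (h ∙ pow h j))         ∎

  -- Moving `h` past `pow g 3` costs `pow c 3`, but these two elements commute.
  c³ : pow c 3 ≡ ε
  c³ = ∙-cancelʳ (pow g 3 ∙ h) _ _ (begin
    pow c 3 ∙ (pow g 3 ∙ h)                 ≡⟨ cong (λ w → pow c 3 ∙ (pow g 3 ∙ w)) (pow-1 h) ⟨
    pow c (1 * 3) ∙ (pow g 3 ∙ pow h 1)     ≡⟨ swap 1 3 ⟨
    pow h 1 ∙ pow g 3                       ≡⟨ cong (_∙ pow g 3) (pow-1 h) ⟩
    h ∙ pow g 3                             ≡⟨ g³h ⟨
    pow g 3 ∙ h                             ≡⟨ identityˡ _ ⟨
    ε ∙ (pow g 3 ∙ h)                       ∎)

  pow-c-comm : ∀ n u → Comm (pow c n) u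
  pow-c-comm n u = sym (comm-pow n (sym (central u)))

  product : ∀ i j i′ j′ → (pow g i ∙ pow h j) ∙ (pow g i′ ∙ pow h j′) ≡ pow c (j * i′) ∙ (pow g (i + i′) ∙ pow h (j + j′))
  product i j i′ j′ = begin
    (pow g i ∙ pow h j) ∙ (pow g i′ ∙ pow h j′)
      ≡⟨ solve 4 (λ a b d e → (a ⊕ b) ⊕ (d ⊕ e) ⊜ a ⊕ ((b ⊕ d) ⊕ e)) refl _ _ _ _ ⟩
    pow g i ∙ ((pow h j ∙ pow g i′) ∙ pow h j′)
      ≡⟨ cong (λ w → pow g i ∙ (w ∙ pow h j′)) (swap j i′) ⟩
    pow g i ∙ ((pow c (j * i′) ∙ (pow g i′ ∙ pow h j)) ∙ pow h j′)
      ≡⟨ solve 5 (λ a b d e f → a ⊕ ((b ⊕ (d ⊕ e)) ⊕ f) ⊜ (a ⊕ b) ⊕ (d ⊕ (e ⊕ f))) refl _ _ _ _ _ ⟩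
    (pow g i ∙ pow c (j * i′)) ∙ (pow g i′ ∙ (pow h j ∙ pow h j′))
      ≡⟨ cong (_∙ (pow g i′ ∙ (pow h j ∙ pow h j′))) (pow-c-comm (j * i′) (pow g i)) ⟨
    (pow c (j * i′) ∙ pow g i) ∙ (pow g i′ ∙ (pow h j ∙ pow h j′))
      ≡⟨ solve 4 (λ a b d e → (a ⊕ b) ⊕ (d ⊕ e) ⊜ a ⊕ ((b ⊕ d) ⊕ e)) refl _ _ _ _ ⟩
    pow c (j * i′) ∙ ((pow g i ∙ pow g i′) ∙ (pow h j ∙ pow h j′))
      ≡⟨ cong (pow c (j * i′) ∙_) (cong₂ _∙_ (pow-+ g i i′) (pow-+ h j j′)) ⟨
    pow c (j * i′) ∙ (pow g (i + i′) ∙ pow h (j + j′)) ∎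

  commute : ∀ u v → ∃ λ n → u ∙ v ≡ pow c n ∙ (v ∙ u)
  commute u v with span u | span v
  -- The factor 2 stands for -1, which is legitimate because `c` has order 3.
  ... | i , j , refl | i′ , j′ , refl = j * i′ + 2 * (j′ * i) , sym (begin
    pow c (j * i′ + 2 * (j′ * i)) ∙ ((pow g i′ ∙ pow h j′) ∙ (pow g i ∙ pow h j))
      ≡⟨ cong (pow c (j * i′ + 2 * (j′ * i)) ∙_) (product i′ j′ i j) ⟩
    pow c (j * i′ + 2 * (j′ * i)) ∙ (pow c (j′ * i) ∙ (pow g (i′ + i) ∙ pow h (j′ + j)))
      ≡⟨ assoc _ _ _ ⟨
    (pow c (j * i′ + 2 * (j′ * i)) ∙ pow c (j′ * i)) ∙ (pow g (i′ + i) ∙ pow h (j′ + j))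
      ≡⟨ cong₂ _∙_ coeff (cong₂ (λ a b → pow g a ∙ pow h b) (+-comm i′ i) (+-comm j′ j)) ⟩
    pow c (j * i′) ∙ (pow g (i + i′) ∙ pow h (j + j′))
      ≡⟨ product i j i′ j′ ⟨
    (pow g i ∙ pow h j) ∙ (pow g i′ ∙ pow h j′) ∎)
    where
    coeff : pow c (j * i′ + 2 * (j′ * i)) ∙ pow c (j′ * i) ≡ pow c (j * i′)
    coeff = begin
      pow c (j * i′ + 2 * (j′ * i)) ∙ pow c (j′ * i) ≡⟨ pow-+ c (j * i′ + 2 * (j′ * i)) (j′ * i) ⟨
      pow c (j * i′ + 2 * (j′ * i) + j′ * i)         ≡⟨ cong (pow c) (arith (j * i′) (j′ * i)) ⟩
      pow c (j * i′ + 3 * (j′ * i))                  ≡⟨ pow-+ c (j * i′) (3 * (j′ * i)) ⟩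
      pow c (j * i′) ∙ pow c (3 * (j′ * i))          ≡⟨ cong (pow c (j * i′) ∙_) (pow-3 c³ (j′ * i)) ⟩
      pow c (j * i′) ∙ ε                             ≡⟨ identityʳ _ ⟩
      pow c (j * i′)                                 ∎
      where
      arith : ∀ a b → a + 2 * b + b ≡ a + 3 * b
      arith = solve-∀

  cubeCommutators : CubeCommutators H
  cubeCommutators = record
    { c = c
    ; c≢ε = λ e → gh-noncomm (sym (trans hg (trans (cong (_∙ (g ∙ h)) e) (identityˡ _))))
    ; c³ = c³ ; central = central ; root = pow g s
    ; root³ = sym (pow-* g 3 s)
    ; commute = commute }

-- Cyclic modules over the Eisenstein integers

module Eisenstein (Q : AbelianGroup 0ℓ 0ℓ) (ω : AbelianGroup.Carrier Q → AbelianGroup.Carrier Q)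
  (ω-cong : ∀ {u v} → AbelianGroup._≈_ Q u v → AbelianGroup._≈_ Q (ω u) (ω v))
  (ω-homo : ∀ u v → AbelianGroup._≈_ Q (ω (AbelianGroup._∙_ Q u v)) (AbelianGroup._∙_ Q (ω u) (ω v))) where

  open AbelianGroup Q renaming (Carrier to C; _∙_ to _⊹_; ε to 0#; ∙-cong to ⊹-cong; ∙-congˡ to ⊹-congˡ; ∙-congʳ to ⊹-congʳ; identityˡ to ⊹-idˡ; identityʳ to ⊹-idʳ; refl to ≈-refl; sym to ≈-sym; trans to ≈-trans; assoc to ⊹-assoc; comm to ⊹-comm)
  open Algebra.Properties.AbelianGroup Q using (∙-cancelˡ; ∙-cancelʳ; identityʳ-unique)
  open Algebra.Properties.CommutativeMonoid.Mult commutativeMonoid renaming (_×_ to _·_; ×-congʳ to ·-congʳ; ×-congˡ to ·-congˡ; ×-homo-+ to ·-homo-+; ×-assocˡ to ·-assocˡ; ×-distrib-+ to ·-distrib-+)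
  open Algebra.Properties.CommutativeSemigroup commutativeSemigroup using (interchange)
  open Relation.Binary.Reasoning.Setoid setoid

  ·-0# : ∀ n → n · 0# ≈ 0#
  ·-0# zero    = ≈-refl
  ·-0# (suc n) = ≈-trans (⊹-idˡ _) (·-0# n)

  ω-0# : ω 0# ≈ 0#
  ω-0# = identityʳ-unique (ω 0#) (ω 0#) (≈-trans (≈-sym (ω-homo 0# 0#)) (ω-cong (⊹-idˡ 0#)))

  ω-· : ∀ n u → ω (n · u) ≈ n · ω u
  ω-· zero    u = ω-0#
  ω-· (suc n) u = ≈-trans (ω-homo u (n · u)) (⊹-congˡ (ω-· n u))

  ·-comm : ∀ m n u → m · (n · u) ≈ n · (m · u)
  ·-comm m n u = ≈-trans (·-assocˡ u m n) (≈-trans (·-congˡ (*-comm m n)) (≈-sym (·-assocˡ u n m)))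

  ·-zero : ∀ m {u} → u ≈ 0# → m · u ≈ 0#
  ·-zero m e = ≈-trans (·-congʳ m e) (·-0# m)

  ·3*-zero : ∀ m {u} → 3 · u ≈ 0# → (3 * m) · u ≈ 0#
  ·3*-zero m {u} e = ≈-trans (·-congˡ {u} (*-comm 3 m)) (≈-trans (≈-sym (·-assocˡ u m 3)) (·-zero m e))

  -- Says that 1 + ω + ω² kills `e`, so that the span of `e` and `ω e` is a cyclic module over the
  -- Eisenstein integers, whatever `ω` does on the rest of the group.
  TraceZero : C → Set
  TraceZero e = e ⊹ (ω e ⊹ ω (ω e)) ≈ 0#

  traceZero-· : ∀ n {e} → TraceZero e → TraceZero (n · e)
  traceZero-· n {e} tr = begin
    n · e ⊹ (ω (n · e) ⊹ ω (ω (n · e)))    ≈⟨ ⊹-congˡ (⊹-cong (ω-· n e) (≈-trans (ω-cong (ω-· n e)) (ω-· n (ω e)))) ⟩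
    n · e ⊹ (n · ω e ⊹ n · ω (ω e))        ≈⟨ ⊹-congˡ (·-distrib-+ (ω e) (ω (ω e)) n) ⟨
    n · e ⊹ n · (ω e ⊹ ω (ω e))            ≈⟨ ·-distrib-+ e _ n ⟨
    n · (e ⊹ (ω e ⊹ ω (ω e)))              ≈⟨ ·-zero n tr ⟩
    0# ∎

  -- 1 + 3A − 3B acts as a unit on 3-power torsion.
  unit-kills : ∀ m A B {u} → (3 ^ m) · u ≈ 0# → (1 + 3 * A) · u ≈ (3 * B) · u → u ≈ 0#
  unit-kills zero A B {u} tor e = ≈-trans (≈-sym (⊹-idʳ u)) tor
  unit-kills (suc m) A B {u} tor e = unit-kills m A B f≈0 e
    where
    f = (3 ^ m) · u
    3f : 3 · f ≈ 0#
    3f = ≈-trans (·-assocˡ u 3 (3 ^ m)) tor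
    f≈0 : f ≈ 0#
    f≈0 = begin
      f                        ≈⟨ ⊹-idʳ f ⟨
      f ⊹ 0#                   ≈⟨ ⊹-congˡ (·3*-zero A 3f) ⟨
      (1 + 3 * A) · f          ≈⟨ ·-comm (1 + 3 * A) (3 ^ m) u ⟩
      (3 ^ m) · ((1 + 3 * A) · u) ≈⟨ ·-congʳ (3 ^ m) e ⟩
      (3 ^ m) · ((3 * B) · u)  ≈⟨ ·-comm (3 ^ m) (3 * B) u ⟩
      (3 * B) · f              ≈⟨ ·3*-zero B 3f ⟩
      0#                       ∎

  -- The norm i² − ij + j² of i + jω kills e; both sides are arranged to avoid subtraction.
  norm : ∀ i j {e} → TraceZero e → i · e ⊹ j · ω e ≈ 0# → (i * i + j * j) · e ≈ (i * j) · e
  norm i j {e} tr rel = ∙-cancelʳ ((i * j) · (ω e ⊹ ω (ω e))) _ _ (begin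
    (i * i + j * j) · e ⊹ (i * j) · (ω e ⊹ ω (ω e))
      ≈⟨ ⊹-cong (·-homo-+ e (i * i) (j * j)) (·-distrib-+ (ω e) (ω (ω e)) (i * j)) ⟩
    ((i * i) · e ⊹ (j * j) · e) ⊹ ((i * j) · ω e ⊹ (i * j) · ω (ω e))
      ≈⟨ interchange _ _ _ _ ⟩
    ((i * i) · e ⊹ (i * j) · ω e) ⊹ ((j * j) · e ⊹ (i * j) · ω (ω e))
      ≈⟨ ⊹-cong first second ⟩
    0# ⊹ 0#
      ≈⟨ ⊹-idˡ 0# ⟩
    0#
      ≈⟨ ·-zero (i * j) tr ⟨
    (i * j) · (e ⊹ (ω e ⊹ ω (ω e)))
      ≈⟨ ·-distrib-+ e _ (i * j) ⟩
    (i * j) · e ⊹ (i * j) · (ω e ⊹ ω (ω e)) ∎)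
    where
    -- `first` is i times the relation and `second` is jω² times it: together they multiply i + jω
    -- by its conjugate i + jω². Their sum contains ij(ω + ω²), which is -ij on `e`.
    first : (i * i) · e ⊹ (i * j) · ω e ≈ 0#
    first = begin
      (i * i) · e ⊹ (i * j) · ω e   ≈⟨ ⊹-cong (·-assocˡ e i i) (·-assocˡ (ω e) i j) ⟨
      i · (i · e) ⊹ i · (j · ω e)   ≈⟨ ·-distrib-+ _ _ i ⟨
      i · (i · e ⊹ j · ω e)         ≈⟨ ·-zero i rel ⟩
      0# ∎
    -- multiply the relation by ω²
    rel² : i · ω (ω e) ⊹ j · e ≈ 0#
    rel² = begin
      i · ω (ω e) ⊹ j · e                  ≈⟨ ⊹-congˡ (·-congʳ j ω³) ⟩
      i · ω (ω e) ⊹ j · ω (ω (ω e))        ≈⟨ ⊹-cong (ω²-· i e) (ω²-· j (ω e)) ⟨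
      ω (ω (i · e)) ⊹ ω (ω (j · ω e))      ≈⟨ ω-homo _ _ ⟨
      ω (ω (i · e) ⊹ ω (j · ω e))          ≈⟨ ω-cong (ω-homo _ _) ⟨
      ω (ω (i · e ⊹ j · ω e))              ≈⟨ ω-cong (ω-cong rel) ⟩
      ω (ω 0#)                             ≈⟨ ω-cong ω-0# ⟩
      ω 0#                                 ≈⟨ ω-0# ⟩
      0# ∎
      where
      ω²-· : ∀ n u → ω (ω (n · u)) ≈ n · ω (ω u)
      ω²-· n u = ≈-trans (ω-cong (ω-· n u)) (ω-· n (ω u))
      ω³ : e ≈ ω (ω (ω e))
      -- The trace relation and its image under `ω` share the terms ω e and ω² e.
      ω³ = ∙-cancelʳ (ω e ⊹ ω (ω e)) _ _ (begin
        e ⊹ (ω e ⊹ ω (ω e))                ≈⟨ tr ⟩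
        0#                                 ≈⟨ ω-0# ⟨
        ω 0#                               ≈⟨ ω-cong tr ⟨
        ω (e ⊹ (ω e ⊹ ω (ω e)))            ≈⟨ ω-homo _ _ ⟩
        ω e ⊹ ω (ω e ⊹ ω (ω e))            ≈⟨ ⊹-congˡ (ω-homo _ _) ⟩
        ω e ⊹ (ω (ω e) ⊹ ω (ω (ω e)))      ≈⟨ ⊹-assoc _ _ _ ⟨
        (ω e ⊹ ω (ω e)) ⊹ ω (ω (ω e))      ≈⟨ ⊹-comm _ _ ⟩
        ω (ω (ω e)) ⊹ (ω e ⊹ ω (ω e))      ∎)
    second : (j * j) · e ⊹ (i * j) · ω (ω e) ≈ 0#
    second = begin
      (j * j) · e ⊹ (i * j) · ω (ω e)   ≈⟨ ⊹-cong (·-assocˡ e j j) (≈-trans (·-assocˡ _ j i) (·-congˡ (*-comm j i))) ⟨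
      j · (j · e) ⊹ j · (i · ω (ω e))   ≈⟨ ·-distrib-+ _ _ j ⟨
      j · (j · e ⊹ i · ω (ω e))         ≈⟨ ·-zero j (≈-trans (⊹-comm _ _) rel²) ⟩
      0# ∎

  cancel-· : ∀ n {a b a′ b′} {e} → a ≡ n + a′ → b ≡ n + b′ → a · e ≈ b · e → a′ · e ≈ b′ · e
  cancel-· n {a′ = a′} {b′} {e} refl refl eq = ∙-cancelˡ (n · e) _ _
    (≈-trans (≈-sym (·-homo-+ e n a′)) (≈-trans eq (·-homo-+ e n b′)))

  -- The three cases are the possible valuations of i + jω at the prime λ = 1 - ω: zero, one, or at
  -- least two. Since ω is 1 modulo λ, the valuation is positive exactly when 3 divides i + j; since
  -- 3 is an associate of λ², it is at least two exactly when 3 divides both i and j. In `socle` the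
  -- element is killed by λ, which is what `e ≈ ω e` says.
  data Descent (i j : ℕ) (e : C) : Set where
    trivial : e ≈ 0# → Descent i j e
    socle   : 3 · e ≈ 0# → e ≈ ω e → 3 ∣ i + j → Descent i j e
    divide  : 3 ∣ i → 3 ∣ j → Descent i j e

  -- The residues of i and j modulo 3 decide the case. Passing to the norm replaces a relation over
  -- the Eisenstein integers by an integral one, to which `unit-kills` applies: the norm is prime to
  -- 3 for valuation zero and 3 times a unit for valuation one.
  descent : ∀ m i j {e} → (3 ^ m) · e ≈ 0# → TraceZero e → i · e ⊹ j · ω e ≈ 0# → Descent i j e
  descent m i j {e} tor tr rel = cases (mod3 i) (mod3 j) rel (norm i j tr rel)
    where
    unit : ∀ A B → (1 + 3 * A) · e ≈ (3 * B) · e → ∀ {i j} → Descent i j e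
    unit A B eq = trivial (unit-kills m A B tor eq)
    -- here the norm is 3 times a unit
    half : ∀ A B → (3 * (1 + 3 * A)) · e ≈ (3 * (3 * B)) · e → 3 · e ≈ 0#
    half A B eq = unit-kills m A B (≈-trans (·-comm (3 ^ m) 3 e) (·-zero 3 tor)) (begin
      (1 + 3 * A) · (3 · e)       ≈⟨ ·-assocˡ e (1 + 3 * A) 3 ⟩
      ((1 + 3 * A) * 3) · e       ≈⟨ ·-congˡ (*-comm (1 + 3 * A) 3) ⟩
      (3 * (1 + 3 * A)) · e       ≈⟨ eq ⟩
      (3 * (3 * B)) · e           ≈⟨ ·-congˡ (*-comm 3 (3 * B)) ⟩
      (3 * B * 3) · e             ≈⟨ ·-assocˡ e (3 * B) 3 ⟨
      (3 * B) · (3 · e)           ∎)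
    ω-3 : 3 · e ≈ 0# → 3 · ω e ≈ 0#
    ω-3 3e = ≈-trans (≈-sym (ω-· 3 e)) (≈-trans (ω-cong 3e) ω-0#)
    reduce : ∀ n q {f} → 3 · f ≈ 0# → (n + 3 * q) · f ≈ n · f
    reduce n q {f} 3f = ≈-trans (·-homo-+ f n (3 * q)) (≈-trans (⊹-congˡ (·3*-zero q 3f)) (⊹-idʳ _))
    cases : ∀ {i j} → Mod3 i → Mod3 j → i · e ⊹ j · ω e ≈ 0# → (i * i + j * j) · e ≈ (i * j) · e → Descent i j e
    cases (mod0 u) (mod0 v) _ N = divide (divides u (*-comm 3 u)) (divides v (*-comm 3 v))
    -- In every case of valuation zero, `a` and `b` write i² + j² and ij as a common number (0, 1 or
    -- 4) plus 1 + 3A and 3B respectively, so that the norm i² - ij + j² is 1 + 3(A - B).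
    cases (mod0 u) (mod1 v) _ N = unit (3 * (u * u) + 2 * v + 3 * (v * v)) (u + 3 * (u * v)) (cancel-· 0 (a u v) (b u v) N)
      where
      a : ∀ u v → 3 * u * (3 * u) + (1 + 3 * v) * (1 + 3 * v) ≡ 1 + 3 * (3 * (u * u) + 2 * v + 3 * (v * v))
      a = solve-∀
      b : ∀ u v → 3 * u * (1 + 3 * v) ≡ 3 * (u + 3 * (u * v))
      b = solve-∀
    cases (mod0 u) (mod2 v) _ N = unit (1 + 3 * (u * u) + 4 * v + 3 * (v * v)) (2 * u + 3 * (u * v)) (cancel-· 0 (a u v) (b u v) N)
      where
      a : ∀ u v → 3 * u * (3 * u) + (2 + 3 * v) * (2 + 3 * v) ≡ 1 + 3 * (1 + 3 * (u * u) + 4 * v + 3 * (v * v))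
      a = solve-∀
      b : ∀ u v → 3 * u * (2 + 3 * v) ≡ 3 * (2 * u + 3 * (u * v))
      b = solve-∀
    cases (mod1 u) (mod0 v) _ N = unit (3 * (v * v) + 2 * u + 3 * (u * u)) (v + 3 * (u * v)) (cancel-· 0 (a u v) (b u v) N)
      where
      a : ∀ u v → (1 + 3 * u) * (1 + 3 * u) + 3 * v * (3 * v) ≡ 1 + 3 * (3 * (v * v) + 2 * u + 3 * (u * u))
      a = solve-∀
      b : ∀ u v → (1 + 3 * u) * (3 * v) ≡ 3 * (v + 3 * (u * v))
      b = solve-∀
    cases (mod2 u) (mod0 v) _ N = unit (1 + 3 * (v * v) + 4 * u + 3 * (u * u)) (2 * v + 3 * (u * v)) (cancel-· 0 (a u v) (b u v) N)
      where
      a : ∀ u v → (2 + 3 * u) * (2 + 3 * u) + 3 * v * (3 * v) ≡ 1 + 3 * (1 + 3 * (v * v) + 4 * u + 3 * (u * u))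
      a = solve-∀
      b : ∀ u v → (2 + 3 * u) * (3 * v) ≡ 3 * (2 * v + 3 * (u * v))
      b = solve-∀
    cases (mod1 u) (mod1 v) _ N = unit (2 * u + 3 * (u * u) + 2 * v + 3 * (v * v)) (u + v + 3 * (u * v)) (cancel-· 1 (a u v) (b u v) N)
      where
      a : ∀ u v → (1 + 3 * u) * (1 + 3 * u) + (1 + 3 * v) * (1 + 3 * v) ≡ 1 + (1 + 3 * (2 * u + 3 * (u * u) + 2 * v + 3 * (v * v)))
      a = solve-∀
      b : ∀ u v → (1 + 3 * u) * (1 + 3 * v) ≡ 1 + 3 * (u + v + 3 * (u * v))
      b = solve-∀
    cases (mod2 u) (mod2 v) _ N = unit (1 + 4 * u + 3 * (u * u) + 4 * v + 3 * (v * v)) (2 * u + 2 * v + 3 * (u * v)) (cancel-· 4 (a u v) (b u v) N)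
      where
      a : ∀ u v → (2 + 3 * u) * (2 + 3 * u) + (2 + 3 * v) * (2 + 3 * v) ≡ 4 + (1 + 3 * (1 + 4 * u + 3 * (u * u) + 4 * v + 3 * (v * v)))
      a = solve-∀
      b : ∀ u v → (2 + 3 * u) * (2 + 3 * v) ≡ 4 + 3 * (2 * u + 2 * v + 3 * (u * v))
      b = solve-∀
    -- Now i² + j² and ij leave 3(1 + 3A) and 9B after cancelling the common summand, which gives 3e
    -- = 0. The relation then reads e + 2ωe = 0, and comparing it with 3ωe = 0 yields e = ωe.
    cases (mod1 u) (mod2 v) rel N = socle 3e e≈ωe (divides (1 + u + v) (c u v))
      where
      a : ∀ u v → (1 + 3 * u) * (1 + 3 * u) + (2 + 3 * v) * (2 + 3 * v) ≡ (2 + 6 * u + 3 * v) + 3 * (1 + 3 * (u * u + v + v * v))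
      a = solve-∀
      b : ∀ u v → (1 + 3 * u) * (2 + 3 * v) ≡ (2 + 6 * u + 3 * v) + 3 * (3 * (u * v))
      b = solve-∀
      c : ∀ u v → 1 + 3 * u + (2 + 3 * v) ≡ (1 + u + v) * 3
      c = solve-∀
      3e : 3 · e ≈ 0#
      3e = half (u * u + v + v * v) (u * v) (cancel-· (2 + 6 * u + 3 * v) (a u v) (b u v) N)
      e≈ωe : e ≈ ω e
      e≈ωe = ∙-cancelʳ (2 · ω e) _ _ (begin
        e ⊹ 2 · ω e                               ≈⟨ ⊹-congʳ (⊹-idʳ e) ⟨
        1 · e ⊹ 2 · ω e                           ≈⟨ ⊹-cong (reduce 1 u 3e) (reduce 2 v (ω-3 3e)) ⟨
        (1 + 3 * u) · e ⊹ (2 + 3 * v) · ω e       ≈⟨ rel ⟩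
        0#                                        ≈⟨ ω-3 3e ⟨
        ω e ⊹ 2 · ω e                             ∎)
    cases (mod2 u) (mod1 v) rel N = socle 3e e≈ωe (divides (1 + u + v) (c u v))
      where
      a : ∀ u v → (2 + 3 * u) * (2 + 3 * u) + (1 + 3 * v) * (1 + 3 * v) ≡ (2 + 6 * v + 3 * u) + 3 * (1 + 3 * (v * v + u + u * u))
      a = solve-∀
      b : ∀ u v → (2 + 3 * u) * (1 + 3 * v) ≡ (2 + 6 * v + 3 * u) + 3 * (3 * (v * u))
      b = solve-∀
      c : ∀ u v → 2 + 3 * u + (1 + 3 * v) ≡ (1 + u + v) * 3
      c = solve-∀
      3e : 3 · e ≈ 0#
      3e = half (v * v + u + u * u) (v * u) (cancel-· (2 + 6 * v + 3 * u) (a u v) (b u v) N)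
      e≈ωe : e ≈ ω e
      e≈ωe = ≈-sym (∙-cancelˡ (2 · e) _ _ (begin
        2 · e ⊹ ω e                               ≈⟨ ⊹-congˡ (⊹-idʳ (ω e)) ⟨
        2 · e ⊹ 1 · ω e                           ≈⟨ ⊹-cong (reduce 2 u 3e) (reduce 1 v (ω-3 3e)) ⟨
        (2 + 3 * u) · e ⊹ (1 + 3 * v) · ω e       ≈⟨ rel ⟩
        0#                                        ≈⟨ 3e ⟨
        e ⊹ 2 · e                                 ≈⟨ ⊹-comm _ _ ⟩
        2 · e ⊹ e                                 ∎))

  -- With these hypotheses the annihilator of `x` in the Eisenstein integers is generated by λ to
  -- the power 2s + 1 or 2s + 2. The results bound it from above in terms of the coefficients of i +
  -- jω.
  module Annihilator (x : C) (tr : TraceZero x) (s : ℕ) (nz : ¬ ((3 ^ s) · x ≈ 0#)) (tor : (3 ^ suc s) · x ≈ 0#) where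

    nonzero : ∀ {m} → m ≤ s → ¬ ((3 ^ m) · x ≈ 0#)
    nonzero {m} m≤s e = nz (begin
      (3 ^ s) · x                       ≈⟨ ·-congˡ (trans (cong (3 ^_) (sym (m∸n+n≡m m≤s))) (^-distribˡ-+-* 3 (s ∸ m) m)) ⟩
      (3 ^ (s ∸ m) * 3 ^ m) · x         ≈⟨ ·-assocˡ x (3 ^ (s ∸ m)) (3 ^ m) ⟨
      (3 ^ (s ∸ m)) · ((3 ^ m) · x)     ≈⟨ ·-zero (3 ^ (s ∸ m)) e ⟩
      0# ∎)

    torsion-· : ∀ m → (3 ^ suc s) · (m · x) ≈ 0#
    torsion-· m = ≈-trans (·-comm (3 ^ suc s) m x) (·-zero m tor)

    scale : ∀ m i j → (i * m) · x ⊹ (j * m) · ω x ≈ 0# → i · (m · x) ⊹ j · ω (m · x) ≈ 0#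
    scale m i j rel = begin
      i · (m · x) ⊹ j · ω (m · x)     ≈⟨ ⊹-cong (·-assocˡ x i m) (≈-trans (·-congʳ j (ω-· m x)) (·-assocˡ (ω x) j m)) ⟩
      (i * m) · x ⊹ (j * m) · ω x     ≈⟨ rel ⟩
      0# ∎

    step : ∀ {m i j} → 3 ^ m ∣ i → 3 ^ m ∣ j → i · x ⊹ j · ω x ≈ 0# →
      ∃₂ λ i′ j′ → i ≡ i′ * 3 ^ m × j ≡ j′ * 3 ^ m × Descent i′ j′ ((3 ^ m) · x)
    step {m} (divides i′ refl) (divides j′ refl) rel = i′ , j′ , refl , refl ,
      descent (suc s) i′ j′ (torsion-· (3 ^ m)) (traceZero-· (3 ^ m) tr) (scale (3 ^ m) i′ j′ rel)

    -- Factors 3 are split off one at a time. Below level `s` the element `(3 ^ m) · x` is neither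
    -- zero nor killed by 3, so `descent` can only answer `divide`.
    divisible : ∀ {i j} m → m ≤ s → i · x ⊹ j · ω x ≈ 0# → 3 ^ m ∣ i × 3 ^ m ∣ j
    divisible zero m≤s rel = 1∣ _ , 1∣ _
    divisible {i} {j} (suc m) m<s rel = let (p , q) = divisible {i} {j} m (<⇒≤ m<s) rel in go (step {m} p q rel)
      where
      go : (∃₂ λ i′ j′ → i ≡ i′ * 3 ^ m × j ≡ j′ * 3 ^ m × Descent i′ j′ ((3 ^ m) · x)) → 3 ^ suc m ∣ i × 3 ^ suc m ∣ j
      go (_ , _ , refl , refl , trivial e)   = contradiction e (nonzero (<⇒≤ m<s))
      go (_ , _ , refl , refl , socle e _ _) = contradiction (≈-trans (≈-sym (·-assocˡ x 3 (3 ^ m))) e) (nonzero m<s)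
      go (_ , _ , refl , refl , divide p q)  = *-monoˡ-∣ (3 ^ m) p , *-monoˡ-∣ (3 ^ m) q

    last : ∀ {i j} → i · x ⊹ j · ω x ≈ 0# →
      ∃₂ λ i′ j′ → i ≡ i′ * 3 ^ s × j ≡ j′ * 3 ^ s × Descent i′ j′ ((3 ^ s) · x)
    last {i} {j} rel = let (p , q) = divisible {i} {j} s ≤-refl rel in step {s} p q rel

    -- The hypothesis says that λ does not kill `(3 ^ s) · x`, which rules out `socle` at the last
    -- level as well.
    annihilator-even : ¬ ((3 ^ s) · x ≈ (3 ^ s) · ω x) → ∀ {i j} → i · x ⊹ j · ω x ≈ 0# → 3 ^ suc s ∣ i × 3 ^ suc s ∣ j
    annihilator-even ne {i} {j} rel with last {i} {j} rel
    ... | _ , _ , refl , refl , trivial e   = contradiction e nz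
    ... | _ , _ , refl , refl , socle _ e _ = contradiction (≈-trans e (ω-· (3 ^ s) x)) ne
    ... | _ , _ , refl , refl , divide p q  = *-monoˡ-∣ (3 ^ s) p , *-monoˡ-∣ (3 ^ s) q

    -- The conclusion is membership of i + jω in the ideal generated by `3 ^ s` times λ: an element
    -- i′ + j′ω is divisible by λ exactly when 3 divides i′ + j′.
    annihilator-odd : ∀ {i j} → i · x ⊹ j · ω x ≈ 0# → 3 ^ s ∣ i × 3 ^ s ∣ j × 3 ^ suc s ∣ i + j
    annihilator-odd {i} {j} rel with last {i} {j} rel
    ... | _ , _ , refl , refl , trivial e   = contradiction e nz
    ... | i , j , refl , refl , socle _ _ d = ∣n⇒∣m*n i ∣-refl , ∣n⇒∣m*n j ∣-refl , subst (3 ^ suc s ∣_) (*-distribʳ-+ (3 ^ s) i j) (*-monoˡ-∣ (3 ^ s) d)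
    ... | i , j , refl , refl , divide p q  = ∣n⇒∣m*n i ∣-refl , ∣n⇒∣m*n j ∣-refl , ∣m∣n⇒∣m+n (*-monoˡ-∣ (3 ^ s) p) (*-monoˡ-∣ (3 ^ s) q)

-- Groups whose commutators are powers of a central cube

-- A presentation with unique normal form. The relation `conj` is the relation b⁻¹ab = a^r of the
-- statement read in the opposite group, and `indep` bounds the order of the group from below.
record Coordinates (H : FinGroup) (q p r : ℕ) (a b : GroupNotions.Elem H) : Set where
  open FinGroupProps H
  field
    aᵖ    : pow a p ≡ ε
    bᑫ    : pow b q ≡ ε
    conj  : b ∙ a ≡ pow a r ∙ b
    span  : ∀ u → ∃₂ λ i j → u ≡ pow a i ∙ pow b j
    indep : ∀ i j → pow a i ∙ pow b j ≡ ε → p ∣ i × q ∣ j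


module Central (H : FinGroup) (cc : CubeCommutators H) where
  open FinGroupProps H
  open CubeCommutators cc
  open ≡-Reasoning

  cⁿ-comm : ∀ n u → Comm (pow c n) u
  cⁿ-comm n u = sym (comm-pow n (sym (central u)))

  cⁿ-out : ∀ n u v → u ∙ (pow c n ∙ v) ≡ pow c n ∙ (u ∙ v)
  cⁿ-out n u v = trans (sym (assoc _ _ _)) (trans (cong (_∙ v) (sym (cⁿ-comm n u))) (assoc _ _ _))

  c-out : ∀ u v → u ∙ (c ∙ v) ≡ c ∙ (u ∙ v)
  c-out u v = trans (sym (assoc _ _ _)) (trans (cong (_∙ v) (sym (central u))) (assoc _ _ _))

  cⁿ-merge : ∀ m n u → pow c m ∙ (pow c n ∙ u) ≡ pow c (m + n) ∙ u
  cⁿ-merge m n u = trans (sym (assoc _ _ _)) (cong (_∙ u) (sym (pow-+ c m n)))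

  cⁿ-mod : ∀ n q → pow c (n + 3 * q) ≡ pow c n
  cⁿ-mod n q = trans (pow-+ c n (3 * q)) (trans (cong (pow c n ∙_) (pow-3 c³ q)) (identityʳ _))

  c²≢ε : pow c 2 ≢ ε
  c²≢ε e = c≢ε (trans (sym (identityʳ c)) (trans (cong (c ∙_) (sym e)) c³))

  cⁿ≡ε⇒3∣n : ∀ n → pow c n ≡ ε → 3 ∣ n
  cⁿ≡ε⇒3∣n n e = go (mod3 n) e
    where
    go : ∀ {n} → Mod3 n → pow c n ≡ ε → 3 ∣ n
    go (mod0 q) e = divides q (*-comm 3 q)
    go (mod1 q) e = contradiction (trans (sym (pow-1 c)) (trans (sym (cⁿ-mod 1 q)) e)) c≢ε
    go (mod2 q) e = contradiction (trans (sym (cⁿ-mod 2 q)) e) c²≢ε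

  -- Collecting u v u v u v into u³ v³ takes three transpositions of `v` with `u`. Each contributes
  -- the same central factor `pow c n`, and the cube of that factor is trivial.
  cube-∙ : ∀ u v → pow (u ∙ v) 3 ≡ pow u 3 ∙ pow v 3
  cube-∙ u v = let (n , vu) = commute v u in begin
    (u ∙ v) ∙ ((u ∙ v) ∙ ((u ∙ v) ∙ ε))
      ≡⟨ cong (λ w → (u ∙ v) ∙ ((u ∙ v) ∙ w)) (identityʳ _) ⟩
    (u ∙ v) ∙ ((u ∙ v) ∙ (u ∙ v))
      ≡⟨ solve 2 (λ u v → (u ⊕ v) ⊕ ((u ⊕ v) ⊕ (u ⊕ v)) ⊜ u ⊕ ((v ⊕ u) ⊕ ((v ⊕ u) ⊕ v))) refl u v ⟩
    u ∙ ((v ∙ u) ∙ ((v ∙ u) ∙ v))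
      ≡⟨ cong (λ w → u ∙ (w ∙ (w ∙ v))) vu ⟩
    u ∙ ((pow c n ∙ (u ∙ v)) ∙ ((pow c n ∙ (u ∙ v)) ∙ v))
      ≡⟨ cong (u ∙_) (trans (assoc _ _ _) (cong (λ w → pow c n ∙ ((u ∙ v) ∙ w)) (assoc _ _ _))) ⟩
    u ∙ (pow c n ∙ ((u ∙ v) ∙ (pow c n ∙ ((u ∙ v) ∙ v))))
      ≡⟨ cong (λ w → u ∙ (pow c n ∙ w)) (cⁿ-out n _ _) ⟩
    u ∙ (pow c n ∙ (pow c n ∙ ((u ∙ v) ∙ ((u ∙ v) ∙ v))))
      ≡⟨ cong (u ∙_) (cⁿ-merge n n _) ⟩
    u ∙ (pow c (n + n) ∙ ((u ∙ v) ∙ ((u ∙ v) ∙ v)))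
      ≡⟨ cⁿ-out (n + n) _ _ ⟩
    pow c (n + n) ∙ (u ∙ ((u ∙ v) ∙ ((u ∙ v) ∙ v)))
      ≡⟨ cong (pow c (n + n) ∙_) (solve 2 (λ u v → u ⊕ ((u ⊕ v) ⊕ ((u ⊕ v) ⊕ v)) ⊜ (u ⊕ u) ⊕ ((v ⊕ u) ⊕ (v ⊕ v))) refl u v) ⟩
    pow c (n + n) ∙ ((u ∙ u) ∙ ((v ∙ u) ∙ (v ∙ v)))
      ≡⟨ cong (λ w → pow c (n + n) ∙ ((u ∙ u) ∙ (w ∙ (v ∙ v)))) vu ⟩
    pow c (n + n) ∙ ((u ∙ u) ∙ ((pow c n ∙ (u ∙ v)) ∙ (v ∙ v)))
      ≡⟨ cong (λ w → pow c (n + n) ∙ ((u ∙ u) ∙ w)) (assoc _ _ _) ⟩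
    pow c (n + n) ∙ ((u ∙ u) ∙ (pow c n ∙ ((u ∙ v) ∙ (v ∙ v))))
      ≡⟨ cong (pow c (n + n) ∙_) (cⁿ-out n _ _) ⟩
    pow c (n + n) ∙ (pow c n ∙ ((u ∙ u) ∙ ((u ∙ v) ∙ (v ∙ v))))
      ≡⟨ cⁿ-merge (n + n) n _ ⟩
    pow c (n + n + n) ∙ ((u ∙ u) ∙ ((u ∙ v) ∙ (v ∙ v)))
      ≡⟨ cong₂ _∙_ (trans (cong (pow c) (arith n)) (pow-3 c³ n)) (solve 2 (λ u v → (u ⊕ u) ⊕ ((u ⊕ v) ⊕ (v ⊕ v)) ⊜ (u ⊕ (u ⊕ u)) ⊕ (v ⊕ (v ⊕ v))) refl u v) ⟩
    ε ∙ ((u ∙ (u ∙ u)) ∙ (v ∙ (v ∙ v)))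
      ≡⟨ identityˡ _ ⟩
    (u ∙ (u ∙ u)) ∙ (v ∙ (v ∙ v))
      ≡⟨ cong₂ (λ a b → (u ∙ (u ∙ a)) ∙ (v ∙ (v ∙ b))) (identityʳ u) (identityʳ v) ⟨
    pow u 3 ∙ pow v 3 ∎
    where
    arith : ∀ n → n + n + n ≡ 3 * n
    arith = solve-∀

  pow3^-∙ : ∀ t u v → pow (u ∙ v) (3 ^ t) ≡ pow u (3 ^ t) ∙ pow v (3 ^ t)
  pow3^-∙ zero u v = trans (pow-1 _) (sym (cong₂ _∙_ (pow-1 u) (pow-1 v)))
  pow3^-∙ (suc t) u v = begin
    pow (u ∙ v) (3 * 3 ^ t)                        ≡⟨ pow-* (u ∙ v) 3 (3 ^ t) ⟩
    pow (pow (u ∙ v) (3 ^ t)) 3                    ≡⟨ cong (λ w → pow w 3) (pow3^-∙ t u v) ⟩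
    pow (pow u (3 ^ t) ∙ pow v (3 ^ t)) 3          ≡⟨ cube-∙ _ _ ⟩
    pow (pow u (3 ^ t)) 3 ∙ pow (pow v (3 ^ t)) 3  ≡⟨ cong₂ _∙_ (pow-* u 3 (3 ^ t)) (pow-* v 3 (3 ^ t)) ⟨
    pow u (3 * 3 ^ t) ∙ pow v (3 * 3 ^ t)          ∎

  infix 4 _≈_
  _≈_ : Elem → Elem → Set
  u ≈ v = ∃ λ n → u ≡ pow c n ∙ v

  ≡⇒≈ : ∀ {u v} → u ≡ v → u ≈ v
  ≡⇒≈ {u} {v} e = 0 , trans e (sym (identityˡ v))

  ≈-sym : ∀ {u v} → u ≈ v → v ≈ u
  ≈-sym {u} {v} (n , e) = 2 * n , sym (begin
    pow c (2 * n) ∙ u             ≡⟨ cong (pow c (2 * n) ∙_) e ⟩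
    pow c (2 * n) ∙ (pow c n ∙ v) ≡⟨ cⁿ-merge (2 * n) n v ⟩
    pow c (2 * n + n) ∙ v         ≡⟨ cong (_∙ v) (trans (cong (pow c) (arith n)) (pow-3 c³ n)) ⟩
    ε ∙ v                         ≡⟨ identityˡ v ⟩
    v                             ∎)
    where
    arith : ∀ n → 2 * n + n ≡ 3 * n
    arith = solve-∀

  ≈-trans : ∀ {u v w} → u ≈ v → v ≈ w → u ≈ w
  ≈-trans {w = w} (m , refl) (n , refl) = m + n , cⁿ-merge m n w

  ≈-∙ : ∀ {u v u′ v′} → u ≈ u′ → v ≈ v′ → u ∙ v ≈ u′ ∙ v′
  ≈-∙ {u′ = u} {v} (m , refl) (n , refl) = m + n , (begin
    (pow c m ∙ u) ∙ (pow c n ∙ v) ≡⟨ assoc _ _ _ ⟩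
    pow c m ∙ (u ∙ (pow c n ∙ v)) ≡⟨ cong (pow c m ∙_) (cⁿ-out n u v) ⟩
    pow c m ∙ (pow c n ∙ (u ∙ v)) ≡⟨ cⁿ-merge m n _ ⟩
    pow c (m + n) ∙ (u ∙ v)       ∎)

  ≈-comm : ∀ u v → u ∙ v ≈ v ∙ u
  ≈-comm = commute

  ≈-⁻¹ : ∀ {u v} → u ≈ v → u ⁻¹ ≈ v ⁻¹
  ≈-⁻¹ {u} {v} p = ≈-trans (≡⇒≈ (sym (trans (cong (u ⁻¹ ∙_) (inverseʳ v)) (identityʳ _))))
    (≈-trans (≈-∙ (≡⇒≈ refl) (≈-∙ (≈-sym p) (≡⇒≈ refl)))
      (≡⇒≈ (trans (sym (assoc _ _ _)) (trans (cong (_∙ v ⁻¹) (inverseˡ u)) (identityˡ _)))))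

  _≈?_ : ∀ u v → Dec (u ≈ v)
  u ≈? v with u ≟ᵉ (pow c 0 ∙ v) | u ≟ᵉ (pow c 1 ∙ v) | u ≟ᵉ (pow c 2 ∙ v)
  ... | yes e | _ | _ = yes (0 , e)
  ... | no _ | yes e | _ = yes (1 , e)
  ... | no _ | no _ | yes e = yes (2 , e)
  ... | no ¬0 | no ¬1 | no ¬2 = no λ (n , e) → none (mod3 n) e
    where
    none : ∀ {n} → Mod3 n → ¬ (u ≡ pow c n ∙ v)
    none (mod0 q) e = ¬0 (trans e (cong (_∙ v) (cⁿ-mod 0 q)))
    none (mod1 q) e = ¬1 (trans e (cong (_∙ v) (cⁿ-mod 1 q)))
    none (mod2 q) e = ¬2 (trans e (cong (_∙ v) (cⁿ-mod 2 q)))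

  quotient : AbelianGroup 0ℓ 0ℓ
  quotient = record
    { Carrier = Elem ; _≈_ = _≈_ ; _∙_ = _∙_ ; ε = ε ; _⁻¹ = _⁻¹
    ; isAbelianGroup = record
      { isGroup = record
        { isMonoid = record
          { isSemigroup = record
            { isMagma = record
              { isEquivalence = record { refl = ≡⇒≈ refl ; sym = ≈-sym ; trans = ≈-trans }
              ; ∙-cong = ≈-∙ }
            ; assoc = λ u v w → ≡⇒≈ (assoc u v w) }
          ; identity = (λ u → ≡⇒≈ (identityˡ u)) , (λ u → ≡⇒≈ (identityʳ u)) }
        ; inverse = (λ u → ≡⇒≈ (inverseˡ u)) , (λ u → ≡⇒≈ (inverseʳ u))
        ; ⁻¹-cong = ≈-⁻¹ }
      ; comm = ≈-comm } }

  open Algebra.Properties.CommutativeMonoid.Mult (AbelianGroup.commutativeMonoid quotient) public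
    using (×-distrib-+) renaming (_×_ to _·_)

  ·≡pow : ∀ n u → n · u ≡ pow u n
  ·≡pow zero    u = refl
  ·≡pow (suc n) u = cong (u ∙_) (·≡pow n u)

  ≈-pow-∙ : ∀ n u v → pow (u ∙ v) n ≈ pow u n ∙ pow v n
  ≈-pow-∙ n u v = ≈-trans (≡⇒≈ (sym (·≡pow n (u ∙ v)))) (≈-trans (×-distrib-+ u v n) (≡⇒≈ (cong₂ _∙_ (·≡pow n u) (·≡pow n v))))

  Generates : Elem → Elem → Set₁
  Generates u v = ∀ P → IsSubgroup P → P u → P v → ∀ w → P w

  ZXX-pow : ∀ X Z j → pow (Z ∙ X ∙ X) j ≈ pow X (2 * j) ∙ pow Z j
  ZXX-pow X Z j = ≈-trans (≈-pow-∙ j (Z ∙ X) X) (≈-trans (≈-∙ (≈-pow-∙ j Z X) (≡⇒≈ refl))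
    (≈-trans (≡⇒≈ (assoc _ _ _)) (≈-trans (≈-comm _ _)
      (≡⇒≈ (cong (_∙ pow Z j) (trans (sym (pow-+ X j j)) (cong (λ n → pow X (j + n)) (sym (+-identityʳ j)))))))))

  coordinates-span : ∀ {a b r} → b ∙ a ≡ pow a r ∙ b → Generates a b → ∀ u → ∃₂ λ i j → u ≡ pow a i ∙ pow b j
  coordinates-span {a} {b} {r} e gen = gen _ (submonoid⇒subgroup (0 , 0 , sym (identityˡ ε)) mult)
      (1 , 0 , sym (trans (identityʳ _) (pow-1 a))) (0 , 1 , sym (trans (identityˡ _) (pow-1 b)))
    where
    mult : ∀ {u v} → (∃₂ λ i j → u ≡ pow a i ∙ pow b j) → (∃₂ λ i j → v ≡ pow a i ∙ pow b j) → ∃₂ λ i j → u ∙ v ≡ pow a i ∙ pow b j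
    mult (i , j , refl) (i′ , j′ , refl) = i + i′ * r ^ j , j + j′ , (begin
      (pow a i ∙ pow b j) ∙ (pow a i′ ∙ pow b j′)
        ≡⟨ solve 4 (λ a b c d → (a ⊕ b) ⊕ (c ⊕ d) ⊜ (a ⊕ (b ⊕ c)) ⊕ d) refl _ _ _ _ ⟩
      (pow a i ∙ (pow b j ∙ pow a i′)) ∙ pow b j′
        ≡⟨ cong (λ w → (pow a i ∙ w) ∙ pow b j′) (pow-conj r e j i′) ⟩
      (pow a i ∙ (pow a (i′ * r ^ j) ∙ pow b j)) ∙ pow b j′
        ≡⟨ solve 4 (λ a b c d → (a ⊕ (b ⊕ c)) ⊕ d ⊜ (a ⊕ b) ⊕ (c ⊕ d)) refl _ _ _ _ ⟩
      (pow a i ∙ pow a (i′ * r ^ j)) ∙ (pow b j ∙ pow b j′)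
        ≡⟨ cong₂ _∙_ (pow-+ a i (i′ * r ^ j)) (pow-+ b j j′) ⟨
      pow a (i + i′ * r ^ j) ∙ pow b (j + j′) ∎)

  -- The argument is carried out for an abstract pair because it is needed twice: for x and αx, and
  -- for the pair in `Dual`. `W` is the product y x that serves as second generator.
  module Pair (X Z : Elem) (XZ : X ∙ Z ≡ c ∙ (Z ∙ X)) (gen : Generates X Z) where

    W : Elem
    W = Z ∙ X ∙ X

    Z≡ : Z ≡ W ∙ X ⁻¹ ∙ X ⁻¹
    Z≡ = sym (begin
      Z ∙ X ∙ X ∙ X ⁻¹ ∙ X ⁻¹     ≡⟨ solve 3 (λ z x y → (((z ⊕ x) ⊕ x) ⊕ y) ⊕ y ⊜ z ⊕ (x ⊕ ((x ⊕ y) ⊕ y))) refl Z X (X ⁻¹) ⟩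
      Z ∙ (X ∙ (X ∙ X ⁻¹ ∙ X ⁻¹)) ≡⟨ cong (λ w → Z ∙ (X ∙ w)) (trans (cong (_∙ X ⁻¹) (inverseʳ X)) (identityˡ _)) ⟩
      Z ∙ (X ∙ X ⁻¹)              ≡⟨ cong (Z ∙_) (inverseʳ X) ⟩
      Z ∙ ε                       ≡⟨ identityʳ Z ⟩
      Z                           ∎)

    genXW : Generates X W
    genXW P sub PX PW = gen P sub PX (subst P (sym Z≡) (∙∈ (∙∈ PW (⁻¹∈ PX)) (⁻¹∈ PX)))
      where open IsSubgroup sub

    pow-X3 : ∀ t → pow X (3 ^ suc t) ≡ pow (pow X (3 ^ t)) 3
    pow-X3 t = pow-* X 3 (3 ^ t)

    XW : X ∙ W ≡ c ∙ (W ∙ X)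
    XW = begin
      X ∙ (Z ∙ X ∙ X)         ≡⟨ solve 2 (λ x z → x ⊕ ((z ⊕ x) ⊕ x) ⊜ (x ⊕ z) ⊕ (x ⊕ x)) refl X Z ⟩
      (X ∙ Z) ∙ (X ∙ X)       ≡⟨ cong (_∙ (X ∙ X)) XZ ⟩
      c ∙ (Z ∙ X) ∙ (X ∙ X)   ≡⟨ solve 3 (λ c z x → (c ⊕ (z ⊕ x)) ⊕ (x ⊕ x) ⊜ c ⊕ (((z ⊕ x) ⊕ x) ⊕ x)) refl c Z X ⟩
      c ∙ (Z ∙ X ∙ X ∙ X)     ∎

    -- The exponent 2 is forced: W X is c⁻¹ X W, so it equals `pow X (1 + 3 ^ t) ∙ W` only when the
    -- power of `X` with exponent `3 ^ t` is c⁻¹. The same value for `Z` makes the corresponding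
    -- power of `W` equal to c⁶, which is trivial.
    even : ∀ t → pow X (3 ^ t) ≡ pow c 2 → pow Z (3 ^ t) ≡ pow c 2 →
      (∀ i j → pow X i ∙ pow Z j ≈ ε → 3 ^ t ∣ i × 3 ^ t ∣ j) →
      Coordinates H (3 ^ t) (3 ^ suc t) (1 + 3 ^ t) X W
    even t Xᵗ Zᵗ ann = record
      { aᵖ = trans (pow-X3 t) (trans (cong (λ w → pow w 3) Xᵗ) (trans (sym (pow-* c 3 2)) (pow-3 c³ 2)))
      ; bᑫ = bᑫ
      ; conj = conj
      ; span = coordinates-span {r = 1 + 3 ^ t} conj genXW
      ; indep = indep }
      where
      conj : W ∙ X ≡ pow X (1 + 3 ^ t) ∙ W
      conj = sym (begin
        (X ∙ pow X (3 ^ t)) ∙ W     ≡⟨ cong (λ w → (X ∙ w) ∙ W) Xᵗ ⟩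
        (X ∙ pow c 2) ∙ W           ≡⟨ cong (_∙ W) (cⁿ-comm 2 X) ⟨
        (pow c 2 ∙ X) ∙ W           ≡⟨ assoc _ _ _ ⟩
        pow c 2 ∙ (X ∙ W)           ≡⟨ cong (pow c 2 ∙_) (trans XW (cong (_∙ (W ∙ X)) (sym (pow-1 c)))) ⟩
        pow c 2 ∙ (pow c 1 ∙ (W ∙ X)) ≡⟨ cⁿ-merge 2 1 _ ⟩
        pow c 3 ∙ (W ∙ X)           ≡⟨ cong (_∙ (W ∙ X)) c³ ⟩
        ε ∙ (W ∙ X)                 ≡⟨ identityˡ _ ⟩
        W ∙ X                       ∎)
      bᑫ : pow W (3 ^ t) ≡ ε
      bᑫ = begin
        pow W (3 ^ t)                                     ≡⟨ pow3^-∙ t (Z ∙ X) X ⟩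
        pow (Z ∙ X) (3 ^ t) ∙ pow X (3 ^ t)               ≡⟨ cong (_∙ pow X (3 ^ t)) (pow3^-∙ t Z X) ⟩
        pow Z (3 ^ t) ∙ pow X (3 ^ t) ∙ pow X (3 ^ t)     ≡⟨ cong₂ (λ a b → a ∙ b ∙ b) Zᵗ Xᵗ ⟩
        pow c 2 ∙ pow c 2 ∙ pow c 2                       ≡⟨ cong (_∙ pow c 2) (pow-+ c 2 2) ⟨
        pow c 4 ∙ pow c 2                                 ≡⟨ pow-+ c 4 2 ⟨
        pow c 6                                           ≡⟨ pow-3 c³ 2 ⟩
        ε                                                 ∎
      Wᵗ : ∀ {j} → 3 ^ t ∣ j → pow W j ≡ ε
      Wᵗ (divides j refl) = trans (pow-* W j (3 ^ t)) (trans (cong (λ w → pow w j) bᑫ) (pow-ε j))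
      indep : ∀ i j → pow X i ∙ pow W j ≡ ε → 3 ^ suc t ∣ i × 3 ^ t ∣ j
      indep i j e = 3∣i Xⁱ (proj₁ (ann i 0 (≡⇒≈ (trans (identityʳ _) Xⁱ)))) , 3∣j
        where
        3∣j : 3 ^ t ∣ j
        -- Modulo `c` the power of `W` is X^(2j) Z^j, so the annihilator applies. Divisibility of j
        -- makes the power of `W` vanish, and the power of `X` is then trivial by itself.
        3∣j = proj₂ (ann (i + 2 * j) j (≈-trans (≡⇒≈ (trans (cong (_∙ pow Z j) (pow-+ X i (2 * j))) (assoc _ _ _)))
          (≈-trans (≈-∙ (≡⇒≈ refl) (≈-sym (ZXX-pow X Z j))) (≡⇒≈ e))))
        Xⁱ : pow X i ≡ ε
        Xⁱ = trans (sym (trans (cong (pow X i ∙_) (Wᵗ 3∣j)) (identityʳ _))) e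
        3∣i : ∀ {i} → pow X i ≡ ε → 3 ^ t ∣ i → 3 ^ suc t ∣ i
        -- The power of `X` is c^(2i′), so 3 divides 2i′. This gains the last factor 3 that the
        -- annihilator modulo `c` cannot see.
        3∣i e (divides i′ refl) = *-monoˡ-∣ (3 ^ t) (odd-part {i′} (cⁿ≡ε⇒3∣n (i′ * 2)
          (trans (pow-* c i′ 2) (trans (cong (λ w → pow w i′) (sym Xᵗ)) (trans (sym (pow-* X i′ (3 ^ t))) e)))))
          where
          odd-part : ∀ {n} → 3 ∣ n * 2 → 3 ∣ n
          odd-part {n} d = ∣m+n∣m⇒∣n (subst (3 ∣_) (arith n) (∣n⇒∣m*n n ∣-refl)) d
            where
            arith : ∀ n → n * 3 ≡ n * 2 + n
            arith = solve-∀

    -- Here `W` takes the role of a and `X` that of b. With ζ the power of `Z`, the power of `W`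
    -- with exponent `3 ^ t` is ζ · c²ζ · c²ζ = c⁴ζ³ = c, exactly the factor by which `X ∙ W`
    -- differs from `W ∙ X`.
    odd : ∀ t → pow X (3 ^ t) ≡ pow c 2 ∙ pow Z (3 ^ t) → pow X (3 ^ suc t) ≡ ε → pow Z (3 ^ suc t) ≡ ε →
      (∀ i j → pow X i ∙ pow Z j ≈ ε → 3 ^ t ∣ j × 3 ^ suc t ∣ i + j) →
      Coordinates H (3 ^ suc t) (3 ^ suc t) (1 + 3 ^ t) W X
    odd t Xᵗ Xᵗ⁺¹ Zᵗ⁺¹ ann = record
      { aᵖ = trans (pow-* W 3 (3 ^ t)) (trans (cong (λ w → pow w 3) Wᵗ) c³)
      ; bᑫ = Xᵗ⁺¹
      ; conj = conj
      ; span = coordinates-span {r = 1 + 3 ^ t} conj (λ P sub PW PX → genXW P sub PX PW)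
      ; indep = indep }
      where
      ζ : Elem
      ζ = pow Z (3 ^ t)
      Wᵗ : pow W (3 ^ t) ≡ c
      Wᵗ = begin
        pow W (3 ^ t)                                     ≡⟨ pow3^-∙ t (Z ∙ X) X ⟩
        pow (Z ∙ X) (3 ^ t) ∙ pow X (3 ^ t)               ≡⟨ cong (_∙ pow X (3 ^ t)) (pow3^-∙ t Z X) ⟩
        ζ ∙ pow X (3 ^ t) ∙ pow X (3 ^ t)                 ≡⟨ cong (λ b → ζ ∙ b ∙ b) Xᵗ ⟩
        ζ ∙ (pow c 2 ∙ ζ) ∙ (pow c 2 ∙ ζ)                 ≡⟨ cong (_∙ (pow c 2 ∙ ζ)) (cⁿ-out 2 ζ ζ) ⟩
        pow c 2 ∙ (ζ ∙ ζ) ∙ (pow c 2 ∙ ζ)                 ≡⟨ assoc _ _ _ ⟩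
        pow c 2 ∙ ((ζ ∙ ζ) ∙ (pow c 2 ∙ ζ))               ≡⟨ cong (pow c 2 ∙_) (cⁿ-out 2 (ζ ∙ ζ) ζ) ⟩
        pow c 2 ∙ (pow c 2 ∙ ((ζ ∙ ζ) ∙ ζ))               ≡⟨ cⁿ-merge 2 2 _ ⟩
        pow c 4 ∙ ((ζ ∙ ζ) ∙ ζ)                           ≡⟨ cong₂ _∙_ (cⁿ-mod 1 1) (trans (assoc ζ ζ ζ) (cong (λ w → ζ ∙ (ζ ∙ w)) (sym (identityʳ ζ)))) ⟩
        pow c 1 ∙ pow ζ 3                                 ≡⟨ cong₂ _∙_ (pow-1 c) (trans (sym (pow-* Z 3 (3 ^ t))) Zᵗ⁺¹) ⟩
        c ∙ ε                                             ≡⟨ identityʳ c ⟩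
        c                                                 ∎
      conj : X ∙ W ≡ pow W (1 + 3 ^ t) ∙ X
      conj = begin
        X ∙ W             ≡⟨ XW ⟩
        c ∙ (W ∙ X)       ≡⟨ assoc _ _ _ ⟨
        (c ∙ W) ∙ X       ≡⟨ cong (_∙ X) (central W) ⟩
        (W ∙ c) ∙ X       ≡⟨ cong (λ w → (W ∙ w) ∙ X) Wᵗ ⟨
        (W ∙ pow W (3 ^ t)) ∙ X ∎
      indep : ∀ i j → pow W i ∙ pow X j ≡ ε → 3 ^ suc t ∣ i × 3 ^ suc t ∣ j
      indep i j e = finish Wⁱ (proj₁ rel) , 3∣j
        where
        rel : 3 ^ t ∣ i × 3 ^ suc t ∣ (j + 2 * i) + i
        rel = ann (j + 2 * i) i (≈-trans (≡⇒≈ (trans (cong (_∙ pow Z i) (pow-+ X j (2 * i))) (assoc _ _ _)))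
          (≈-trans (≈-∙ (≡⇒≈ refl) (≈-sym (ZXX-pow X Z i))) (≈-trans (≈-comm _ _) (≡⇒≈ e))))
        3∣j : 3 ^ suc t ∣ j
        3∣j = ∣m+n∣m⇒∣n (subst (3 ^ suc t ∣_) (arith i j) (proj₂ rel)) (*-monoʳ-∣ 3 (proj₁ rel))
          where
          arith : ∀ i j → j + 2 * i + i ≡ 3 * i + j
          arith = solve-∀
        Xʲ : ∀ {j} → 3 ^ suc t ∣ j → pow X j ≡ ε
        Xʲ (divides j′ refl) = trans (pow-* X j′ (3 ^ suc t)) (trans (cong (λ w → pow w j′) Xᵗ⁺¹) (pow-ε j′))
        Wⁱ : pow W i ≡ ε
        Wⁱ = trans (sym (trans (cong (pow W i ∙_) (Xʲ 3∣j)) (identityʳ _))) e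
        finish : ∀ {i} → pow W i ≡ ε → 3 ^ t ∣ i → 3 ^ suc t ∣ i
        finish e (divides i′ refl) = *-monoˡ-∣ (3 ^ t) (cⁿ≡ε⇒3∣n i′
          (trans (cong (λ w → pow w i′) (sym Wᵗ)) (trans (sym (pow-* W i′ (3 ^ t))) e)))

-- Any nontrivial power of `c` can serve as the distinguished commutator. Since n is 1 or -1 modulo
-- 3, it is its own inverse there, which turns an exponent m of `c` into n m for the new element.
renormalise : (H : FinGroup) (cc : CubeCommutators H) (n : ℕ) →
  GroupNotions.pow H (CubeCommutators.c cc) n ≢ FinGroup.ε H →
  Σ (CubeCommutators H) λ cc′ → CubeCommutators.c cc′ ≡ GroupNotions.pow H (CubeCommutators.c cc) n
renormalise H cc n ne = record
  { c = pow c n ; c≢ε = ne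
  ; c³ = trans (sym (pow-* c 3 n)) (pow-3 c³ n)
  ; central = cⁿ-comm n
  ; root = pow root n
  ; root³ = trans (sym (pow-* root 3 n)) (trans (cong (pow root) (*-comm 3 n)) (trans (pow-* root n 3) (cong (λ w → pow w n) root³)))
  ; commute = λ u v → let (m , e) = commute u v in n * m , trans e (cong (_∙ (v ∙ u)) (power (mod3 n) ne m)) } , refl
  where
  open FinGroupProps H
  open CubeCommutators cc
  open Central H cc
  power : ∀ {n} → Mod3 n → pow c n ≢ ε → ∀ m → pow c m ≡ pow (pow c n) (n * m)
  power (mod0 q) ne m = contradiction (pow-3 c³ q) ne
  power (mod1 q) ne m = sym (trans (sym (pow-* c ((1 + 3 * q) * m) (1 + 3 * q)))
    (trans (cong (pow c) (arith q m)) (cⁿ-mod m (m * (2 * q + 3 * (q * q))))))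
    where
    arith : ∀ q m → (1 + 3 * q) * m * (1 + 3 * q) ≡ m + 3 * (m * (2 * q + 3 * (q * q)))
    arith = solve-∀
  power (mod2 q) ne m = sym (trans (sym (pow-* c ((2 + 3 * q) * m) (2 + 3 * q)))
    (trans (cong (pow c) (arith q m)) (cⁿ-mod m (m * (1 + 4 * q + 3 * (q * q))))))
    where
    arith : ∀ q m → (2 + 3 * q) * m * (2 + 3 * q) ≡ m + 3 * (m * (1 + 4 * q + 3 * (q * q)))
    arith = solve-∀

-- The relations between x and its image under α

Γ-Coordinates Σ-Coordinates : (H : FinGroup) (t : ℕ) (x y : GroupNotions.Elem H) → Set
Γ-Coordinates H t x y = Coordinates H (3 ^ t) (3 ^ suc t) (1 + 3 ^ t) x (FinGroup._∙_ H y x)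
Σ-Coordinates H t x y = Coordinates H (3 ^ suc t) (3 ^ suc t) (1 + 3 ^ t) (FinGroup._∙_ H y x) x

-- In the opposite group a⁻¹b becomes b a⁻¹, so a = x, b = y x turns {1, a, a⁻¹b} into {1, x, y};
-- for Σ the roles of a and b are exchanged. The alternatives with inverses describe the same graph
-- with its two sides interchanged.
Classified : (H : FinGroup) (x y : GroupNotions.Elem H) → Set
Classified H x y = ∃ λ t → 1 ≤ t ×
  ((Γ-Coordinates H t x y ⊎ Γ-Coordinates H t (x ⁻¹) (y ⁻¹)) ⊎ (Σ-Coordinates H t x y ⊎ Σ-Coordinates H t (x ⁻¹) (y ⁻¹)))
  where open FinGroup H using (_⁻¹)

module Trigonal (H : FinGroup) (cc : CubeCommutators H) (k : ℕ) (order≡3^k : FinGroup.order H ≡ 3 ^ k)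
    (α : GroupNotions.Elem H → GroupNotions.Elem H)
    (α-homo : ∀ u v → α (FinGroup._∙_ H u v) ≡ FinGroup._∙_ H (α u) (α v))
    (x : GroupNotions.Elem H)
    (trace : FinGroup._∙_ H (α (α x)) (FinGroup._∙_ H (α x) x) ≡ FinGroup.ε H)
    (xz : FinGroup._∙_ H x (α x) ≡ FinGroup._∙_ H (CubeCommutators.c cc) (FinGroup._∙_ H (α x) x))
    (gen : Central.Generates H cc x (α x)) where
  open FinGroupProps H
  open CubeCommutators cc
  open Central H cc
  open ≡-Reasoning

  z y : Elem
  z = α x
  y = z ∙ x

  α-ε : α ε ≡ ε
  α-ε = ∙-cancelˡ (α ε) _ _ (trans (sym (α-homo ε ε)) (trans (cong α (identityˡ ε)) (sym (identityʳ _))))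

  α-pow : ∀ u n → α (pow u n) ≡ pow (α u) n
  α-pow u zero    = α-ε
  α-pow u (suc n) = trans (α-homo _ _) (cong (α u ∙_) (α-pow u n))

  -- z y⁻¹ = α(c) y⁻¹ z, while y z = c z y.
  α-c : α c ≡ c
  α-c = ∙-cancelʳ (α z ∙ z) _ _ (trans (sym αxz) (∙-cancelˡ y _ _ (begin
    y ∙ (z ∙ α z)             ≡⟨ assoc _ _ _ ⟨
    (y ∙ z) ∙ α z             ≡⟨ cong (_∙ α z) yz ⟩
    (c ∙ (z ∙ y)) ∙ α z       ≡⟨ solve 4 (λ c z y w → (c ⊕ (z ⊕ y)) ⊕ w ⊜ c ⊕ (z ⊕ (y ⊕ w))) refl c z y (α z) ⟩
    c ∙ (z ∙ (y ∙ α z))       ≡⟨ cong (λ w → c ∙ (z ∙ w)) yαz ⟩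
    c ∙ (z ∙ ε)               ≡⟨ cong (c ∙_) (comm-ε z) ⟩
    c ∙ (ε ∙ z)               ≡⟨ cong (λ w → c ∙ (w ∙ z)) yαz ⟨
    c ∙ ((y ∙ α z) ∙ z)       ≡⟨ cong (c ∙_) (assoc _ _ _) ⟩
    c ∙ (y ∙ (α z ∙ z))       ≡⟨ c-out y _ ⟨
    y ∙ (c ∙ (α z ∙ z))       ∎)))
    where
    αxz : z ∙ α z ≡ α c ∙ (α z ∙ z)
    αxz = trans (sym (α-homo x z)) (trans (cong α xz) (trans (α-homo c _) (cong (α c ∙_) (α-homo z x))))
    yαz : y ∙ α z ≡ ε
    yαz = trans (cong (y ∙_) (inverseˡ-unique _ _ trace)) (inverseʳ y)
    yz : y ∙ z ≡ c ∙ (z ∙ y)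
    yz = trans (assoc z x z) (trans (cong (z ∙_) xz) (c-out z y))

  α-cong : ∀ {u v} → u ≈ v → α u ≈ α v
  α-cong {v = v} (n , refl) = n , trans (α-homo _ _) (cong (_∙ α v) (trans (α-pow c n) (cong (λ w → pow w n) α-c)))

  open Eisenstein quotient α α-cong (λ u v → ≡⇒≈ (α-homo u v))

  traceZero : TraceZero x
  traceZero = ≈-trans (≈-comm x (z ∙ α z)) (≈-trans (≈-∙ (≈-comm z (α z)) (≡⇒≈ refl)) (≡⇒≈ (trans (assoc _ _ _) trace)))

  x≉ε : ¬ (x ≈ ε)
  x≉ε (n , e) = c≢ε (∙-cancelʳ (z ∙ x) _ _ (trans (sym xz) (trans (trans (cong (_∙ z) e′) (trans (cⁿ-comm n z) (cong (z ∙_) (sym e′)))) (sym (identityˡ _)))))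
    where
    e′ : x ≡ pow c n
    e′ = trans e (identityʳ _)

  x≉z : ¬ (x ≈ z)
  x≉z (n , e) = c≢ε (∙-cancelʳ (z ∙ x) _ _ (trans (sym xz) (trans (begin
    x ∙ z              ≡⟨ cong (_∙ z) e ⟩
    (pow c n ∙ z) ∙ z  ≡⟨ assoc _ _ _ ⟩
    pow c n ∙ (z ∙ z)  ≡⟨ cⁿ-out n z z ⟨
    z ∙ (pow c n ∙ z)  ≡⟨ cong (z ∙_) e ⟨
    z ∙ x              ∎) (sym (identityˡ _)))))

  span : ∀ u → ∃₂ λ i j → u ≈ pow x i ∙ pow z j
  span = gen _ (submonoid⇒subgroup (0 , 0 , ≡⇒≈ (sym (identityˡ ε))) mult)
      (1 , 0 , ≡⇒≈ (sym (trans (identityʳ _) (pow-1 x)))) (0 , 1 , ≡⇒≈ (sym (trans (identityˡ _) (pow-1 z))))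
    where
    mult : ∀ {u v} → (∃₂ λ i j → u ≈ pow x i ∙ pow z j) → (∃₂ λ i j → v ≈ pow x i ∙ pow z j) → ∃₂ λ i j → u ∙ v ≈ pow x i ∙ pow z j
    mult (i , j , p) (i′ , j′ , q) = i + i′ , j + j′ , ≈-trans (≈-∙ p q) (≈-trans
      (≡⇒≈ (solve 4 (λ a b c d → (a ⊕ b) ⊕ (c ⊕ d) ⊜ a ⊕ ((b ⊕ c) ⊕ d)) refl (pow x i) (pow z j) (pow x i′) (pow z j′))) (≈-trans
      (≈-∙ (≡⇒≈ refl) (≈-∙ (≈-comm (pow z j) (pow x i′)) (≡⇒≈ refl)))
      (≡⇒≈ (trans (solve 4 (λ a b c d → a ⊕ ((c ⊕ b) ⊕ d) ⊜ (a ⊕ c) ⊕ (b ⊕ d)) refl (pow x i) (pow z j) (pow x i′) (pow z j′))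
        (sym (cong₂ _∙_ (pow-+ x i i′) (pow-+ z j j′)))))))

  -- `root` is a word in x and z up to a power of `c`, and cubing is multiplicative and kills that
  -- power. The result is an exact equation in H, with which the exponent n = 0 will be refuted.
  c-cube : ∃₂ λ i j → c ≡ pow x (3 * i) ∙ pow z (3 * j)
  c-cube = let (i , j , n , e) = span root in i , j , (begin
    c                                             ≡⟨ root³ ⟨
    pow root 3                                    ≡⟨ cong (λ w → pow w 3) e ⟩
    pow (pow c n ∙ (pow x i ∙ pow z j)) 3         ≡⟨ cube-∙ _ _ ⟩
    pow (pow c n) 3 ∙ pow (pow x i ∙ pow z j) 3   ≡⟨ cong₂ _∙_ (trans (sym (pow-* c 3 n)) (pow-3 c³ n)) (cube-∙ _ _) ⟩
    ε ∙ (pow (pow x i) 3 ∙ pow (pow z j) 3)       ≡⟨ identityˡ _ ⟩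
    pow (pow x i) 3 ∙ pow (pow z j) 3             ≡⟨ cong₂ _∙_ (pow-* x 3 i) (pow-* z 3 j) ⟨
    pow x (3 * i) ∙ pow z (3 * j)                 ∎)

  to· : ∀ {i j} → pow x i ∙ pow z j ≈ ε → (i · x) ∙ (j · z) ≈ ε
  to· {i} {j} = subst (_≈ ε) (sym (cong₂ _∙_ (·≡pow i x) (·≡pow j z)))

  -- X = x⁻¹, Z = y⁻¹ x describe the connection set S⁻¹ seen from the other side.
  module Dual where
    X Z : Elem
    X = x ⁻¹
    Z = y ⁻¹ ∙ x

    xX : ∀ u → x ⁻¹ ∙ (x ∙ u) ≡ u
    xX u = trans (sym (assoc _ _ _)) (trans (cong (_∙ u) (inverseˡ x)) (identityˡ u))

    Z≡ : Z ≡ c ∙ z ⁻¹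
    Z≡ = begin
      (z ∙ x) ⁻¹ ∙ x           ≡⟨ cong (_∙ x) (⁻¹-anti-homo-∙ z x) ⟩
      (x ⁻¹ ∙ z ⁻¹) ∙ x        ≡⟨ assoc _ _ _ ⟩
      x ⁻¹ ∙ (z ⁻¹ ∙ x)        ≡⟨ cong (x ⁻¹ ∙_) z⁻¹x ⟩
      x ⁻¹ ∙ (c ∙ (x ∙ z ⁻¹))  ≡⟨ c-out (x ⁻¹) _ ⟩
      c ∙ (x ⁻¹ ∙ (x ∙ z ⁻¹))  ≡⟨ cong (c ∙_) (xX _) ⟩
      c ∙ z ⁻¹                 ∎
      where
      z⁻¹x : z ⁻¹ ∙ x ≡ c ∙ (x ∙ z ⁻¹)
      z⁻¹x = ∙-cancelˡ z _ _ (∙-cancelʳ z _ _ (begin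
        (z ∙ (z ⁻¹ ∙ x)) ∙ z        ≡⟨ cong (_∙ z) (trans (sym (assoc _ _ _)) (trans (cong (_∙ x) (inverseʳ z)) (identityˡ x))) ⟩
        x ∙ z                       ≡⟨ xz ⟩
        c ∙ (z ∙ x)                 ≡⟨ cong (λ w → c ∙ (z ∙ w)) (trans (assoc _ _ _) (trans (cong (x ∙_) (inverseˡ z)) (identityʳ x))) ⟨
        c ∙ (z ∙ ((x ∙ z ⁻¹) ∙ z))  ≡⟨ cong (c ∙_) (assoc _ _ _) ⟨
        c ∙ ((z ∙ (x ∙ z ⁻¹)) ∙ z)  ≡⟨ assoc _ _ _ ⟨
        (c ∙ (z ∙ (x ∙ z ⁻¹))) ∙ z  ≡⟨ cong (_∙ z) (c-out z _) ⟨
        (z ∙ (c ∙ (x ∙ z ⁻¹))) ∙ z  ∎))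

    -- The commutator is unchanged although `X` is the inverse of x and `Z` is the inverse of z
    -- modulo `c`. Powers are inverted meanwhile, so the exponents 1 and 2 are interchanged.
    XZ : X ∙ Z ≡ c ∙ (Z ∙ X)
    XZ = sym (begin
      c ∙ ((y ⁻¹ ∙ x) ∙ x ⁻¹)  ≡⟨ cong (c ∙_) (trans (assoc _ _ _) (trans (cong (y ⁻¹ ∙_) (inverseʳ x)) (identityʳ _))) ⟩
      c ∙ (z ∙ x) ⁻¹           ≡⟨ cong (c ∙_) (⁻¹-anti-homo-∙ z x) ⟩
      c ∙ (x ⁻¹ ∙ z ⁻¹)        ≡⟨ c-out (x ⁻¹) (z ⁻¹) ⟨
      x ⁻¹ ∙ (c ∙ z ⁻¹)        ≡⟨ cong (x ⁻¹ ∙_) Z≡ ⟨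
      x ⁻¹ ∙ Z                 ∎)

    ZX : Z ∙ X ≡ y ⁻¹
    ZX = trans (assoc _ _ _) (trans (cong (y ⁻¹ ∙_) (inverseʳ x)) (identityʳ _))

    genXZ : Generates X Z
    genXZ P sub PX PZ = gen P sub Px (subst P z≡ (∙∈ (⁻¹∈ (∙∈ PZ PX)) PX))
      where
      open IsSubgroup sub
      Px : P x
      Px = subst P (⁻¹-involutive x) (⁻¹∈ PX)
      z≡ : (Z ∙ X) ⁻¹ ∙ X ≡ z
      z≡ = trans (cong (λ w → w ⁻¹ ∙ X) ZX) (trans (cong (_∙ X) (⁻¹-involutive y)) (trans (assoc _ _ _) (trans (cong (z ∙_) (inverseʳ x)) (identityʳ z))))

    Zⁿ : ∀ n → pow Z n ≡ pow c n ∙ (pow z n) ⁻¹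
    Zⁿ n = trans (cong (λ w → pow w n) Z≡) (trans (pow-∙ n (central _)) (cong (pow c n ∙_) (pow-⁻¹ z n)))

    dual-≈ : ∀ i j → pow X i ∙ pow Z j ≈ ε → pow x i ∙ pow z j ≈ ε
    dual-≈ i j p = ≈-trans (≈-comm (pow x i) (pow z j)) (≈-trans (≈-sym step) (≡⇒≈ ε⁻¹≈ε))
      where
      step : ε ⁻¹ ≈ pow z j ∙ pow x i
      step = ≈-trans (≈-⁻¹ (≈-trans (≈-sym p) (≈-∙ (≡⇒≈ (pow-⁻¹ x i)) (j , Zⁿ j))))
        (≡⇒≈ (trans (⁻¹-anti-homo-∙ _ _) (cong₂ _∙_ (⁻¹-involutive _) (⁻¹-involutive _))))

    c^3ᵗ : ∀ t → pow c (3 ^ suc t) ≡ ε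
    c^3ᵗ t = pow-3 c³ (3 ^ t)

  c⁻¹ : ∀ {u} → c ∙ u ≡ ε → u ≡ pow c 2
  c⁻¹ {u} e = ∙-cancelˡ c _ _ (trans e (sym c³))

  -- The hypotheses put m at 2s + 2. What is left to decide is which power of `c` the element
  -- x^(3^t) is: c² gives the presentation directly, `c` gives it for the inverses, and the trivial
  -- power is impossible.
  classified-even : ∀ s → ¬ (pow x (3 ^ s) ≈ pow z (3 ^ s)) → ¬ (pow x (3 ^ s) ≈ ε) → pow x (3 ^ suc s) ≈ ε → Classified H x y
  classified-even s ne nz (m , tor) = suc s , s≤s z≤n , inj₁ (choose (mod3 m) xᵗ)
    where
    open Annihilator x traceZero s (nz ∘ subst (_≈ ε) (·≡pow (3 ^ s) x)) (m , trans (·≡pow (3 ^ suc s) x) tor)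
    t = suc s
    ann : ∀ i j → pow x i ∙ pow z j ≈ ε → 3 ^ t ∣ i × 3 ^ t ∣ j
    ann i j p = annihilator-even (ne ∘ λ (n , e) → n , trans (sym (·≡pow (3 ^ s) x)) (trans e (cong (pow c n ∙_) (·≡pow (3 ^ s) z)))) {i} {j} (to· {i} {j} p)
    xᵗ : pow x (3 ^ t) ≡ pow c m
    xᵗ = trans tor (identityʳ _)
    zᵗ : ∀ {n} → pow x (3 ^ t) ≡ pow c n → pow z (3 ^ t) ≡ pow c n
    zᵗ {n} e = trans (sym (α-pow x (3 ^ t))) (trans (cong α e) (trans (α-pow c n) (cong (λ w → pow w n) α-c)))
    choose : ∀ {n} → Mod3 n → pow x (3 ^ t) ≡ pow c n → Γ-Coordinates H t x y ⊎ Γ-Coordinates H t (x ⁻¹) (y ⁻¹)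
    choose (mod0 q) e = contradiction c≡ε c≢ε
      where
      x≡ε : pow x (3 ^ t) ≡ pow c 0
      x≡ε = trans e (pow-3 c³ q)
      vanish : ∀ {u i} → pow u (3 ^ t) ≡ ε → 3 ^ t ∣ i → pow u i ≡ ε
      vanish {u} e (divides i′ refl) = trans (pow-* u i′ (3 ^ t)) (trans (cong (λ w → pow w i′) e) (pow-ε i′))
      c≡ε : c ≡ ε
      -- The word x^(3i) z^(3j) for `c` is trivial modulo `c`, so its exponents are multiples of
      -- `3 ^ t`, and both factors vanish.
      c≡ε = let (i , j , e′) = c-cube
                (p , q) = ann (3 * i) (3 * j) (1 , trans (sym e′) (sym (trans (identityʳ _) (pow-1 c))))
            in trans e′ (trans (cong₂ _∙_ (vanish x≡ε p) (vanish (zᵗ {0} x≡ε) q)) (identityˡ ε))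
    choose (mod2 q) e = inj₁ (Pair.even x z xz gen t e₂ (zᵗ {2} e₂) ann)
      where
      e₂ = trans e (cⁿ-mod 2 q)
    choose (mod1 q) e = inj₂ (subst (λ w → Coordinates H (3 ^ t) (3 ^ suc t) (1 + 3 ^ t) X (w ∙ X)) ZX
        (Pair.even X Z XZ genXZ t Xᵗ Zᵗ (λ i j → ann i j ∘ dual-≈ i j)))
      where
      open Dual
      e₁ : pow x (3 ^ t) ≡ pow c 1
      e₁ = trans e (cⁿ-mod 1 q)
      inv : ∀ {u} → u ≡ pow c 1 → u ⁻¹ ≡ pow c 2
      inv refl = c⁻¹ (trans (cong (_∙ (pow c 1) ⁻¹) (sym (pow-1 c))) (inverseʳ _))
      Xᵗ : pow X (3 ^ t) ≡ pow c 2
      Xᵗ = trans (pow-⁻¹ x (3 ^ t)) (inv e₁)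
      Zᵗ : pow Z (3 ^ t) ≡ pow c 2
      Zᵗ = trans (Zⁿ (3 ^ t)) (trans (cong₂ _∙_ (c^3ᵗ s) (inv (zᵗ {1} e₁))) (identityˡ _))

  -- The hypotheses put m at 2t + 1 with t = s + 1. The powers of x and z with exponent `3 ^ t`
  -- agree modulo `c`, and the power of `c` by which they differ is what distinguishes the three
  -- cases.
  classified-odd : ∀ s → pow x (3 ^ suc s) ≈ pow z (3 ^ suc s) → ¬ (pow x (3 ^ suc s) ≈ ε) → pow x (3 ^ suc (suc s)) ≈ ε → Classified H x y
  classified-odd s (m , xᵗ) nz (m′ , tor) = suc s , s≤s z≤n , inj₂ (choose (mod3 m) xᵗ)
    where
    t = suc s
    open Annihilator x traceZero t (nz ∘ subst (_≈ ε) (·≡pow (3 ^ t) x)) (m′ , trans (·≡pow (3 ^ suc t) x) tor)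
    ann : ∀ i j → pow x i ∙ pow z j ≈ ε → 3 ^ t ∣ i × 3 ^ t ∣ j × 3 ^ suc t ∣ i + j
    ann i j p = annihilator-odd {i} {j} (to· {i} {j} p)
    ξ ζ : Elem
    ξ = pow x (3 ^ t)
    ζ = pow z (3 ^ t)
    αξ : α ξ ≡ ζ
    αξ = α-pow x (3 ^ t)
    trace-ξ : α ζ ∙ (ζ ∙ ξ) ≡ ε
    trace-ξ = begin
      α ζ ∙ (ζ ∙ ξ)                           ≡⟨ cong (λ w → w ∙ (ζ ∙ ξ)) (α-pow z (3 ^ t)) ⟩
      pow (α z) (3 ^ t) ∙ (ζ ∙ ξ)             ≡⟨ cong (pow (α z) (3 ^ t) ∙_) (pow3^-∙ t z x) ⟨
      pow (α z) (3 ^ t) ∙ pow (z ∙ x) (3 ^ t) ≡⟨ pow3^-∙ t (α z) (z ∙ x) ⟨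
      pow (α z ∙ (z ∙ x)) (3 ^ t)             ≡⟨ cong (λ w → pow w (3 ^ t)) trace ⟩
      pow ε (3 ^ t)                           ≡⟨ pow-ε (3 ^ t) ⟩
      ε                                       ∎
    ζ≡ : ζ ≡ pow c m ∙ α ζ
    ζ≡ = trans (sym αξ) (trans (cong α xᵗ) (trans (α-homo _ _) (cong (_∙ α ζ) (trans (α-pow c m) (cong (λ w → pow w m) α-c)))))
    -- Substitute ξ = cᵐ ζ and its image ζ = cᵐ α(ζ) into α(ζ) ζ ξ = 1.
    ζ³ : pow ζ 3 ≡ ε
    ζ³ = begin
      ζ ∙ (ζ ∙ (ζ ∙ ε))                             ≡⟨ cong (λ w → ζ ∙ (ζ ∙ w)) (identityʳ ζ) ⟩
      ζ ∙ (ζ ∙ ζ)                                   ≡⟨ cong (_∙ (ζ ∙ ζ)) ζ≡ ⟩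
      (pow c m ∙ α ζ) ∙ (ζ ∙ ζ)                     ≡⟨ cong (_∙ (ζ ∙ ζ)) (cⁿ-comm m (α ζ)) ⟩
      (α ζ ∙ pow c m) ∙ (ζ ∙ ζ)                     ≡⟨ assoc _ _ _ ⟩
      α ζ ∙ (pow c m ∙ (ζ ∙ ζ))                     ≡⟨ cong (α ζ ∙_) (cⁿ-out m ζ ζ) ⟨
      α ζ ∙ (ζ ∙ (pow c m ∙ ζ))                     ≡⟨ cong (λ w → α ζ ∙ (ζ ∙ w)) xᵗ ⟨
      α ζ ∙ (ζ ∙ ξ)                                 ≡⟨ trace-ξ ⟩
      ε                                             ∎
    ξ³ : pow ξ 3 ≡ ε
    ξ³ = trans (cong (λ w → pow w 3) xᵗ) (trans (cube-∙ _ _) (trans (cong₂ _∙_ (trans (sym (pow-* c 3 m)) (pow-3 c³ m)) ζ³) (identityˡ ε)))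
    zᵗ⁺¹ : pow z (3 ^ suc t) ≡ ε
    zᵗ⁺¹ = trans (pow-* z 3 (3 ^ t)) ζ³
    xᵗ⁺¹ : pow x (3 ^ suc t) ≡ ε
    xᵗ⁺¹ = trans (pow-* x 3 (3 ^ t)) ξ³
    choose : ∀ {n} → Mod3 n → ξ ≡ pow c n ∙ ζ → Σ-Coordinates H t x y ⊎ Σ-Coordinates H t (x ⁻¹) (y ⁻¹)
    choose (mod0 q) e = contradiction c≡ε c≢ε
      where
      ξ≡ζ : ξ ≡ ζ
      ξ≡ζ = trans e (trans (cong (_∙ ζ) (pow-3 c³ q)) (identityˡ ζ))
      -- If ξ and ζ were equal, such a word would be a power of z alone, with exponent i + j.
      collapse : ∀ {i j} → 3 ^ t ∣ i → 3 ^ t ∣ j → 3 ^ suc t ∣ i + j → pow x i ∙ pow z j ≡ ε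
      collapse {i} {j} (divides i′ refl) (divides j′ refl) (divides l el) = begin
        pow x (i′ * 3 ^ t) ∙ pow z (j′ * 3 ^ t)  ≡⟨ cong (_∙ pow z j) (trans (pow-* x i′ (3 ^ t)) (trans (cong (λ w → pow w i′) ξ≡ζ) (sym (pow-* z i′ (3 ^ t))))) ⟩
        pow z (i′ * 3 ^ t) ∙ pow z (j′ * 3 ^ t)  ≡⟨ pow-+ z i j ⟨
        pow z (i′ * 3 ^ t + j′ * 3 ^ t)          ≡⟨ cong (pow z) el ⟩
        pow z (l * 3 ^ suc t)                    ≡⟨ pow-* z l (3 ^ suc t) ⟩
        pow (pow z (3 ^ suc t)) l                ≡⟨ cong (λ w → pow w l) zᵗ⁺¹ ⟩
        pow ε l                                  ≡⟨ pow-ε l ⟩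
        ε                                        ∎
      c≡ε : c ≡ ε
      c≡ε = let (i , j , e′) = c-cube
                (p , q , r) = ann (3 * i) (3 * j) (1 , trans (sym e′) (sym (trans (identityʳ _) (pow-1 c))))
            in trans e′ (collapse p q r)
    choose (mod2 q) e = inj₁ (Pair.odd x z xz gen t (trans e (cong (_∙ ζ) (cⁿ-mod 2 q))) xᵗ⁺¹ zᵗ⁺¹ (λ i j → proj₂ ∘ ann i j))
    choose (mod1 q) e = inj₂ (subst (λ w → Coordinates H (3 ^ suc t) (3 ^ suc t) (1 + 3 ^ t) (w ∙ X) X) ZX
        (Pair.odd X Z XZ genXZ t Xᵗ Xᵗ⁺¹ Zᵗ⁺¹ (λ i j → proj₂ ∘ ann i j ∘ dual-≈ i j)))
      where
      open Dual
      Zᵗ≡ : pow Z (3 ^ t) ≡ ζ ⁻¹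
      Zᵗ≡ = trans (Zⁿ (3 ^ t)) (trans (cong (_∙ ζ ⁻¹) (c^3ᵗ s)) (identityˡ _))
      e₁ : ξ ≡ c ∙ ζ
      e₁ = trans e (cong (_∙ ζ) (trans (cⁿ-mod 1 q) (pow-1 c)))
      Xᵗ : pow X (3 ^ t) ≡ pow c 2 ∙ pow Z (3 ^ t)
      Xᵗ = begin
        pow X (3 ^ t)             ≡⟨ pow-⁻¹ x (3 ^ t) ⟩
        ξ ⁻¹                      ≡⟨ cong _⁻¹ e₁ ⟩
        (c ∙ ζ) ⁻¹                ≡⟨ ⁻¹-anti-homo-∙ c ζ ⟩
        ζ ⁻¹ ∙ c ⁻¹               ≡⟨ cong (ζ ⁻¹ ∙_) (c⁻¹ (inverseʳ c)) ⟩
        ζ ⁻¹ ∙ pow c 2            ≡⟨ cⁿ-comm 2 (ζ ⁻¹) ⟨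
        pow c 2 ∙ ζ ⁻¹            ≡⟨ cong (pow c 2 ∙_) Zᵗ≡ ⟨
        pow c 2 ∙ pow Z (3 ^ t)   ∎
      Xᵗ⁺¹ : pow X (3 ^ suc t) ≡ ε
      Xᵗ⁺¹ = trans (pow-⁻¹ x (3 ^ suc t)) (trans (cong _⁻¹ xᵗ⁺¹) ε⁻¹≈ε)
      Zᵗ⁺¹ : pow Z (3 ^ suc t) ≡ ε
      Zᵗ⁺¹ = trans (Zⁿ (3 ^ suc t)) (trans (cong₂ (λ a b → a ∙ b ⁻¹) (c^3ᵗ t) zᵗ⁺¹) (trans (identityˡ _) ε⁻¹≈ε))

  classified : Classified H x y
  classified = go (switch (λ n → pow x (3 ^ n) ≈? ε) k (≡⇒≈ (subst (λ n → pow x n ≡ ε) order≡3^k (pow-order x))) (x≉ε ∘ subst (_≈ ε) (pow-1 x)))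
    where
    go : (∃ λ s → ¬ (pow x (3 ^ s) ≈ ε) × (pow x (3 ^ suc s) ≈ ε)) → Classified H x y
    go (s , nz , tor) = decide s nz tor (pow x (3 ^ s) ≈? pow z (3 ^ s))
      where
      decide : ∀ s → ¬ (pow x (3 ^ s) ≈ ε) → pow x (3 ^ suc s) ≈ ε → Dec (pow x (3 ^ s) ≈ pow z (3 ^ s)) → Classified H x y
      decide s nz tor (no ne) = classified-even s ne nz tor
      -- This is m = 1: x and z would agree modulo the centre and commute. Its exclusion makes t
      -- positive in the odd case.
      decide zero nz tor (yes e) = contradiction (≈-trans (≡⇒≈ (sym (pow-1 x))) (≈-trans e (≡⇒≈ (pow-1 z)))) x≉z
      decide (suc s) nz tor (yes e) = classified-odd s e nz tor

-- The automorphism group as a finite set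

-- Counting requires decidable equality, a complete list, and that automorphisms with the same
-- action be equal. `Aut` contains functions and proofs, so it is replaced by a finite encoding with
-- these properties.
record AutomorphismGroup (Γ : Graph) : Set₁ where
  open Graph Γ using (size; adj)
  open GraphNotions Γ using (V; Aut) renaming (act to actAut)
  infixr 9 _∘A_
  field
    A        : Set
    _≟A_     : DecidableEquality A
    enumA    : Enum {A} (λ _ → ⊤)
    act      : A → V → V
    ext      : ∀ {σ τ} → (∀ v → act σ v ≡ act τ v) → σ ≡ τ
    preserve : ∀ σ u v → adj (act σ u) (act σ v) ≡ adj u v
    one      : A
    act-one  : ∀ v → act one v ≡ v
    _∘A_     : A → A → A
    act-∘    : ∀ σ τ v → act (σ ∘A τ) v ≡ act σ (act τ v)
    inv      : A → A
    act-invˡ : ∀ σ v → act (inv σ) (act σ v) ≡ v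
    act-invʳ : ∀ σ v → act σ (act (inv σ) v) ≡ v
    fromAut  : Aut → A
    act-from : ∀ φ v → act (fromAut φ) v ≡ actAut φ v

funToFin-cong : ∀ {m n} {f g : Fin m → Fin n} → (∀ i → f i ≡ g i) → funToFin f ≡ funToFin g
funToFin-cong {zero}  e = refl
funToFin-cong {suc m} e = cong₂ combine (e Fin.zero) (funToFin-cong (e ∘ Fin.suc))

finToFun-injective : ∀ {m n} {c d : Fin (n ^ m)} → (∀ i → finToFun {n} {m} c i ≡ finToFun d i) → c ≡ d
finToFun-injective {m} {n} {c} {d} e =
  trans (sym (Finₚ.funToFin-finToFin {m} {n} c)) (trans (funToFin-cong e) (Finₚ.funToFin-finToFin {m} {n} d))

-- An automorphism is stored as the tables of a map and of its inverse, with a proof-irrelevant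
-- certificate. Inversion then merely exchanges the tables, and `ext` holds because the first table
-- determines the second.
automorphismGroup : (Γ : Graph) → AutomorphismGroup Γ
automorphismGroup Γ = record
  { A = A ; _≟A_ = _≟A_ ; enumA = enum-⇔ (λ _ → tt) (λ _ → tt , tt) (enum-Σ isAut? (enum-× (enum-Fin _) (enum-Fin _)))
  ; act = act ; ext = ext ; preserve = λ σ → proj₂ (proj₂ (isAut σ))
  ; one = mk id id (λ _ → refl) (λ _ → refl) (λ _ _ → refl)
  ; act-one = Finₚ.finToFun-funToFin id
  ; _∘A_ = λ σ τ → mk (act σ ∘ act τ) (act⁻¹ τ ∘ act⁻¹ σ)
      (λ v → trans (cong (act⁻¹ τ) (left σ (act τ v))) (left τ v))
      (λ v → trans (cong (act σ) (right τ (act⁻¹ σ v))) (right σ v))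
      (λ u v → trans (pres σ _ _) (pres τ u v))
  ; act-∘ = λ σ τ → Finₚ.finToFun-funToFin (act σ ∘ act τ)
  ; inv = λ σ → mk (act⁻¹ σ) (act σ) (right σ) (left σ) (pres⁻¹ σ)
  ; act-invˡ = λ σ v → trans (Finₚ.finToFun-funToFin (act⁻¹ σ) (act σ v)) (left σ v)
  ; act-invʳ = λ σ v → trans (cong (act σ) (Finₚ.finToFun-funToFin (act⁻¹ σ) v)) (right σ v)
  ; fromAut = λ φ → mk (Aut.perm φ ⟨$⟩ʳ_) (Aut.perm φ ⟨$⟩ˡ_) (λ v → Perm.inverseˡ (Aut.perm φ)) (λ v → Perm.inverseʳ (Aut.perm φ)) (Aut.preserve φ)
  ; act-from = λ φ → Finₚ.finToFun-funToFin (Aut.perm φ ⟨$⟩ʳ_)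
  }
  where
  open Graph Γ using (size; adj)
  open GraphNotions Γ using (V; Aut)
  Code : Set
  Code = Fin (size ^ size)
  fn : Code → V → V
  fn = finToFun
  IsAut : Code × Code → Set
  IsAut (c , d) = (∀ v → fn d (fn c v) ≡ v) × (∀ v → fn c (fn d v) ≡ v) × (∀ u v → adj (fn c u) (fn c v) ≡ adj u v)
  isAut? : Decidable IsAut
  isAut? (c , d) = Finₚ.all? (λ v → fn d (fn c v) Fin.≟ v) ×-dec (Finₚ.all? (λ v → fn c (fn d v) Fin.≟ v)
    ×-dec Finₚ.all? (λ u → Finₚ.all? (λ v → adj (fn c u) (fn c v) Bool.≟ adj u v)))
  A : Set
  A = Σ (Code × Code) (λ cd → True (isAut? cd))
  isAut : (σ : A) → IsAut (proj₁ σ)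
  isAut σ = toWitness (proj₂ σ)
  act act⁻¹ : A → V → V
  act   ((c , d) , _) = fn c
  act⁻¹ ((c , d) , _) = fn d
  left : ∀ σ v → act⁻¹ σ (act σ v) ≡ v
  left σ = proj₁ (isAut σ)
  right : ∀ σ v → act σ (act⁻¹ σ v) ≡ v
  right σ = proj₁ (proj₂ (isAut σ))
  pres : ∀ σ u v → adj (act σ u) (act σ v) ≡ adj u v
  pres σ = proj₂ (proj₂ (isAut σ))
  pres⁻¹ : ∀ σ u v → adj (act⁻¹ σ u) (act⁻¹ σ v) ≡ adj u v
  pres⁻¹ σ u v = trans (sym (pres σ _ _)) (cong₂ adj (right σ u) (right σ v))
  _≟A_ : DecidableEquality A
  σ ≟A τ with Prodₚ.≡-dec Fin._≟_ Fin._≟_ (proj₁ σ) (proj₁ τ)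
  ... | yes e = yes (Σ-True-≡ isAut? e)
  ... | no ne = no (ne ∘ cong proj₁)
  ext : ∀ {σ τ} → (∀ v → act σ v ≡ act τ v) → σ ≡ τ
  ext {σ} {τ} e = Σ-True-≡ isAut? (cong₂ _,_ (finToFun-injective e) (finToFun-injective e⁻¹))
    where
    e⁻¹ : ∀ v → act⁻¹ σ v ≡ act⁻¹ τ v
    e⁻¹ v = trans (cong (act⁻¹ σ) (sym (right τ v))) (trans (cong (act⁻¹ σ) (sym (e (act⁻¹ τ v)))) (left σ _))
  mk : (f g : V → V) → (∀ v → g (f v) ≡ v) → (∀ v → f (g v) ≡ v) → (∀ u v → adj (f u) (f v) ≡ adj u v) → A
  mk f g gf fg p = (funToFin f , funToFin g) , fromWitness
      ((λ v → trans (G _) (trans (cong g (F v)) (gf v))) , (λ v → trans (F _) (trans (cong f (G v)) (fg v)))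
      , λ u v → trans (cong₂ adj (F u) (F v)) (p u v))
    where
    F : ∀ v → fn (funToFin f) v ≡ f v
    F = Finₚ.finToFun-funToFin f
    G : ∀ v → fn (funToFin g) v ≡ g v
    G = Finₚ.finToFun-funToFin g

-- Orbits and cubic graphs

-- `t` is a transversal: `t e` carries the base point `e₁` to `e`. Dividing an element by the
-- transversal element with the same image leaves a member of the stabiliser.
orbit-stabiliser : {G E : Set} {P : E → Set} (_·_ : G → G → G) (inv : G → G) (act : G → E → E) →
  (∀ a s → inv a · (a · s) ≡ s) → (∀ a s → a · (inv a · s) ≡ s) →
  (∀ a b e → act (a · b) e ≡ act a (act b e)) → (∀ a e → act (inv a) (act a e) ≡ e) →
  (e₁ : E) → (∀ a → P (act a e₁)) → (t : E → G) → (∀ {e} → P e → act (t e) e₁ ≡ e) →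
  (EG : Enum {G} (λ _ → ⊤)) (EP : Enum P) (ES : Enum (λ a → act a e₁ ≡ e₁)) → card EG ≡ card EP * card ES
orbit-stabiliser _·_ inv act invˡ invʳ act-· act-inv e₁ stays t trans-t EG EP ES =
  trans (card-bij EG (enum-× EP ES)
    (λ a → act a e₁ , inv (t (act a e₁)) · a) (λ (e , s) → t e · s)
    (λ {a} _ → stays a , trans (act-· _ _ _) (trans (cong (act (inv (t (act a e₁)))) (sym (trans-t (stays a)))) (act-inv _ _)))
    (λ _ → tt)
    (λ {a} _ → invʳ _ _)
    (λ {(e , s)} (p , q) → back e s p q))
  (card-× EP ES)
  where
  back : ∀ e s → _ → act s e₁ ≡ e₁ → (act (t e · s) e₁ , inv (t (act (t e · s) e₁)) · (t e · s)) ≡ (e , s)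
  back e s p q with act (t e · s) e₁ | trans (act-· (t e) s e₁) (trans (cong (act (t e)) q) (trans-t p))
  ... | _ | refl = cong (e ,_) (invˡ (t e) s)

injective⇒surjective : ∀ {n} (f : Fin n → Fin n) → (∀ {i j} → f i ≡ f j → i ≡ j) → ∀ j → ∃ λ i → f i ≡ j
injective⇒surjective {suc n} f inj j with Finₚ.any? (λ i → f i Fin.≟ j)
... | yes p = p
... | no ¬p = contradiction (Finₚ.injective⇒≤ {f = g} g-inj) 1+n≰n
  where
  j≢f : ∀ i → j ≢ f i
  j≢f i e = ¬p (i , sym e)
  g : Fin (suc n) → Fin n
  g i = Fin.punchOut (j≢f i)
  g-inj : ∀ {i i′} → g i ≡ g i′ → i ≡ i′
  g-inj {i} {i′} e = inj (Finₚ.punchOut-injective (j≢f i) (j≢f i′) e)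

module CubicGraph (Γ : Graph) (cubic : GraphNotions.IsCubic Γ) where
  open Graph Γ using (size; adj)
  open GraphNotions Γ using (V)

  Nbr : V → V → Set
  Nbr v w = adj v w ≡ true

  nbr? : ∀ v w → Dec (Nbr v w)
  nbr? v w = adj v w Bool.≟ true

  nbrs : ∀ v → Enum (Nbr v)
  nbrs v = enum-⇔ proj₂ (tt ,_) (enum-filter (nbr? v) (enum-Fin size))

  length-filter-sum : ∀ v (ws : List V) → length (filter (nbr? v) ws) ≡ sum (map (λ w → if adj v w then 1 else 0) ws)
  length-filter-sum v [] = refl
  length-filter-sum v (w ∷ ws) with adj v w
  ... | true  = cong suc (length-filter-sum v ws)
  ... | false = length-filter-sum v ws

  card-nbrs : ∀ v → card (nbrs v) ≡ 3
  card-nbrs v = trans (length-filter-sum v (allFin size)) (cubic v)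

  Arc : V × V → Set
  Arc (u , v) = Nbr u v

  arcs : Enum Arc
  arcs = enum-⇔ proj₂ (λ p → (tt , tt) , p) (enum-filter (λ (u , v) → nbr? u v) (enum-× (enum-Fin size) (enum-Fin size)))

  card-arcs : card arcs ≡ size * 3
  card-arcs = trans (rows (allFin size)) (cong (_* 3) (card-Fin size))
    where
    row : ∀ u (vs : List V) → length (filter (λ (u , v) → nbr? u v) (map (u ,_) vs)) ≡ length (filter (nbr? u) vs)
    row u [] = refl
    row u (v ∷ vs) with adj u v
    ... | true  = cong suc (row u vs)
    ... | false = row u vs
    rows : ∀ us → length (filter (λ (u , v) → nbr? u v) (cartesianProduct us (allFin size))) ≡ length us * 3
    rows [] = refl
    rows (u ∷ us) = trans (cong length (filter-++ (λ (u , v) → nbr? u v) (map (u ,_) (allFin size)) _))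
      (trans (length-++ (filter (λ (u , v) → nbr? u v) (map (u ,_) (allFin size))))
        (cong₂ _+_ (trans (row u (allFin size)) (card-nbrs u)) (rows us)))

  some-nbr : ∀ v → ∃ (Nbr v)
  some-nbr v = pick (list (nbrs v)) (sound (nbrs v)) (card-nbrs v)
    where
    pick : ∀ ws → (∀ {w} → w ∈ ws → Nbr v w) → length ws ≡ 3 → ∃ (Nbr v)
    pick (w ∷ _) s _ = w , s (here refl)

card≡0⇒∉ : {A : Set} {P : A → Set} (E : Enum P) → card E ≡ 0 → ∀ {a} → ¬ P a
card≡0⇒∉ E e {a} p = absurd (list E) (complete E p) e
  where
  absurd : ∀ xs → a ∈ xs → length xs ≢ 0
  absurd (_ ∷ _) _ ()

∈⇒card≢0 : {A : Set} {P : A → Set} (E : Enum P) → ∀ {a} → P a → card E ≢ 0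
∈⇒card≢0 E p e = card≡0⇒∉ E e p

-- The number of moved points is a multiple of 3, and one fixed point out of three leaves at most
-- two to be moved.
fix-one⇒fix-all : {A : Set} (_≟A_ : DecidableEquality A) {P : A → Set} (E : Enum P) → card E ≡ 3 → (f : A → A) →
  (∀ {a} → P a → P (f a)) → (∀ {a} → P a → f (f (f a)) ≡ a) → ∀ {w} → P w → f w ≡ w → ∀ {u} → P u → f u ≡ u
fix-one⇒fix-all _≟A_ {P} E E3 f Pf f³ {w} Pw fw {u} Pu with f u ≟A u
... | yes e = e
... | no ne = contradiction (Pu , ne) (card≡0⇒∉ Mv (small 3∣Mv total (∈⇒card≢0 Fx (Pw , fw))))
  where
  Fx = enum-filter (λ a → f a ≟A a) E
  Mv = enum-filter (λ a → ¬? (f a ≟A a)) E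
  total : card Fx + card Mv ≡ 3
  total = trans (sym (card-split (λ a → f a ≟A a) E)) E3
  3∣Mv : 3 ∣ card Mv
  3∣Mv = ∣m+n∣m⇒∣n (subst (3 ∣_) (sym total) ∣-refl) (proj₂ (3∣card-fix-cube _≟A_ f Pf f³ (E , subst (3 ∣_) (sym E3) ∣-refl)))
  small : ∀ {m n} → 3 ∣ n → m + n ≡ 3 → m ≢ 0 → n ≡ 0
  small (divides zero refl) _ _ = refl
  small {zero} _ _ ne = contradiction refl ne
  small {suc m} (divides (suc q) refl) e _ = contradiction (≤-reflexive e) (<⇒≱ (s≤s (≤-trans (m≤m+n 3 (q * 3)) (m≤n+m (3 + q * 3) m))))

module _ {A : Set} (_≟A_ : DecidableEquality A) where

  open import Data.List.Membership.DecPropositional _≟A_ using (_∈?_)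

  three-cover : {P : A → Set} (E : Enum P) → card E ≡ 3 → ∀ {a b c} → P a → P b → P c →
    a ≢ b → a ≢ c → b ≢ c → ∀ {d} → P d → d ≡ a ⊎ d ≡ b ⊎ d ≡ c
  three-cover {P} E E3 {a} {b} {c} Pa Pb Pc ab ac bc {d} Pd = cases (d ∈? L)
    where
    L : List A
    L = a ∷ b ∷ c ∷ []
    EL : Enum (λ x → P x × x ∈ L)
    EL = enum-filter (_∈? L) E
    rest : Enum (λ x → P x × x ∉ L)
    rest = enum-filter (λ x → ¬? (x ∈? L)) E
    inP : ∀ {x} → x ∈ L → P x
    inP (here refl)                 = Pa
    inP (there (here refl))         = Pb
    inP (there (there (here refl))) = Pc
    L3 : card EL ≡ 3
    L3 = unique-length (unique EL) ((ab ∷ ac ∷ []) ∷ (bc ∷ []) ∷ [] ∷ [])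
      (proj₂ ∘ sound EL) (λ x∈ → complete EL (inP x∈ , x∈))
    cases : Dec (d ∈ L) → d ≡ a ⊎ d ≡ b ⊎ d ≡ c
    cases (yes (here e))                 = inj₁ e
    cases (yes (there (here e)))         = inj₂ (inj₁ e)
    cases (yes (there (there (here e)))) = inj₂ (inj₂ e)
    cases (no d∉) = contradiction (Pd , d∉) (card≡0⇒∉ rest
      (+-cancelˡ-≡ 3 _ 0 (trans (cong (_+ card rest) (sym L3)) (trans (sym (card-split (_∈? L) E)) E3))))

-- The normaliser of a semiregular group of automorphisms

module BiCayleyAction (H : FinGroup) (Γ : Graph) (bicayley : GraphNotions.IsBiCayleyOver Γ H) where
  open FinGroupProps H
  open Graph Γ using (size; adj)
  open GraphNotions Γ using (V; Aut) renaming (act to actAut)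

  ρ : Elem → V → V
  ρ = actAut ∘ proj₁ bicayley

  ρ-homo : ∀ g h v → ρ (g ∙ h) v ≡ ρ g (ρ h v)
  ρ-homo = proj₁ (proj₂ bicayley)

  ρ-adj : ∀ g u v → adj (ρ g u) (ρ g v) ≡ adj u v
  ρ-adj g = Aut.preserve (proj₁ bicayley g)

  -- The homomorphism law makes `ρ ε` idempotent, and an idempotent permutation is the identity.
  ρ-ε : ∀ v → ρ ε v ≡ v
  ρ-ε v = trans (sym (Perm.inverseˡ perm)) (trans (cong (perm ⟨$⟩ˡ_) (trans (sym (ρ-homo ε ε v)) (cong (λ g → ρ g v) (identityˡ ε)))) (Perm.inverseˡ perm))
    where
    perm = Aut.perm (proj₁ bicayley ε)

  ρ-inverseˡ : ∀ g v → ρ (g ⁻¹) (ρ g v) ≡ v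
  ρ-inverseˡ g v = trans (sym (ρ-homo _ _ v)) (trans (cong (λ h → ρ h v) (inverseˡ g)) (ρ-ε v))

  ρ-inverseʳ : ∀ g v → ρ g (ρ (g ⁻¹) v) ≡ v
  ρ-inverseʳ g v = trans (sym (ρ-homo _ _ v)) (trans (cong (λ h → ρ h v) (inverseʳ g)) (ρ-ε v))

  ρ-semiregular : ∀ {g h v} → ρ g v ≡ ρ h v → g ≡ h
  ρ-semiregular {g} {h} {v} e = sym (trans (sym (⁻¹-involutive h)) (sym (inverseʳ-unique (h ⁻¹) g
    (proj₁ (proj₂ (proj₂ bicayley)) _ v (trans (ρ-homo _ _ v) (trans (cong (ρ (h ⁻¹)) e) (ρ-inverseˡ h v)))))))

  base : Fin 2 → V
  base Fin.zero    = proj₁ (proj₂ (proj₂ (proj₂ bicayley)))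
  base (Fin.suc _) = proj₁ (proj₂ (proj₂ (proj₂ (proj₂ bicayley))))

  v₀ : V
  v₀ = base Fin.zero

  different-orbits : ∀ {g h} → ρ g v₀ ≢ ρ h (base (Fin.suc Fin.zero))
  different-orbits {g} {h} e = proj₁ (proj₂ (proj₂ (proj₂ (proj₂ (proj₂ bicayley)))))
    (h ⁻¹ ∙ g , trans (ρ-homo _ _ _) (trans (cong (ρ (h ⁻¹)) e) (ρ-inverseˡ h _)))

  locate : ∀ v → ∃₂ λ s g → ρ g (base s) ≡ v
  locate v = go (proj₂ (proj₂ (proj₂ (proj₂ (proj₂ (proj₂ bicayley))))) v)
    where
    go : (∃ λ g → ρ g (base Fin.zero) ≡ v) ⊎ (∃ λ g → ρ g (base (Fin.suc Fin.zero)) ≡ v) → ∃₂ λ s g → ρ g (base s) ≡ v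
    go (inj₁ (g , e)) = Fin.zero , g , e
    go (inj₂ (g , e)) = Fin.suc Fin.zero , g , e

  side : V → Fin 2
  side v = proj₁ (locate v)

  elem : V → Elem
  elem v = proj₁ (proj₂ (locate v))

  ρ-elem : ∀ v → ρ (elem v) (base (side v)) ≡ v
  ρ-elem v = proj₂ (proj₂ (locate v))

  unique-position : ∀ s t {g h} → ρ g (base s) ≡ ρ h (base t) → s ≡ t × g ≡ h
  unique-position Fin.zero Fin.zero e = refl , ρ-semiregular e
  unique-position Fin.zero (Fin.suc Fin.zero) e = contradiction e different-orbits
  unique-position (Fin.suc Fin.zero) Fin.zero e = contradiction (sym e) different-orbits
  unique-position (Fin.suc Fin.zero) (Fin.suc Fin.zero) e = refl , ρ-semiregular e

  position-ρ : ∀ g v → side (ρ g v) ≡ side v × elem (ρ g v) ≡ g ∙ elem v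
  position-ρ g v = unique-position (side (ρ g v)) (side v)
    (trans (ρ-elem (ρ g v)) (trans (cong (ρ g) (sym (ρ-elem v))) (sym (ρ-homo _ _ _))))

  side-ρ : ∀ g v → side (ρ g v) ≡ side v
  side-ρ g v = proj₁ (position-ρ g v)

  elem-ρ : ∀ g v → elem (ρ g v) ≡ g ∙ elem v
  elem-ρ g v = proj₂ (position-ρ g v)

  position-base : ∀ s → side (base s) ≡ s × elem (base s) ≡ ε
  position-base s = unique-position (side (base s)) s (trans (ρ-elem (base s)) (sym (ρ-ε _)))

  elem≡ε⇒base : ∀ {v} → elem v ≡ ε → v ≡ base (side v)
  elem≡ε⇒base {v} e = trans (sym (ρ-elem v)) (trans (cong (λ g → ρ g (base (side v))) e) (ρ-ε _))

  size≡2*order : size ≡ 2 * order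
  size≡2*order = trans (sym (card-Fin size)) (trans
    (card-bij (enum-Fin size) (enum-× (enum-Fin 2) (enum-Fin order))
      (λ v → side v , elem v) (λ (s , g) → ρ g (base s)) (λ _ → tt , tt) (λ _ → tt)
      (λ {v} _ → ρ-elem v)
      (λ {(s , g)} _ → let (p , q) = unique-position (side (ρ g (base s))) s (ρ-elem (ρ g (base s))) in cong₂ _,_ p q))
    (trans (card-× (enum-Fin 2) (enum-Fin order)) (cong₂ _*_ (card-Fin 2) (card-Fin order))))

module NormaliserElement (H : FinGroup) (M : Metacyclic H) (k : ℕ) (order≡3^k : FinGroup.order H ≡ 3 ^ k)
    (Γ : Graph) (cubic : GraphNotions.IsCubic Γ) (edge-transitive : GraphNotions.IsEdgeTransitive Γ)
    (bicayley : GraphNotions.IsBiCayleyOver Γ H) (AG : AutomorphismGroup Γ) where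
  open FinGroupProps H
  open Graph Γ using (size; adj)
  open GraphNotions Γ using (V; Aut) renaming (act to actAut)
  open AutomorphismGroup AG
  open BiCayleyAction H Γ bicayley
  open CubicGraph Γ cubic
  open ≡-Reasoning

  R : Elem → A
  R g = fromAut (proj₁ bicayley g)

  act-R : ∀ g v → act (R g) v ≡ ρ g v
  act-R g = act-from (proj₁ bicayley g)

  -- ν picks the representative of the coset ρ(H)σ lying in X.
  ν : A → A
  ν σ = R (elem (act σ v₀) ⁻¹) ∘A σ

  act-ν : ∀ σ v → act (ν σ) v ≡ ρ (elem (act σ v₀) ⁻¹) (act σ v)
  act-ν σ v = trans (act-∘ _ σ v) (act-R _ _)

  X : A → Set
  X σ = elem (act σ v₀) ≡ ε

  X? : Decidable X
  X? σ = elem (act σ v₀) ≟ᵉ ε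

  X-ν : ∀ σ → X (ν σ)
  X-ν σ = trans (cong elem (act-ν σ v₀)) (trans (elem-ρ _ _) (inverseˡ _))

  ν-X : ∀ {σ} → X σ → ν σ ≡ σ
  ν-X {σ} e = ext λ v → trans (act-ν σ v) (trans (cong (λ g → ρ (g ⁻¹) (act σ v)) e) (trans (cong (λ g → ρ g (act σ v)) ε⁻¹≈ε) (ρ-ε _)))

  ν-coset : ∀ {σ τ} g → (∀ v → act τ v ≡ ρ g (act σ v)) → ν τ ≡ ν σ
  ν-coset {σ} {τ} g e = ext λ v → begin
    act (ν τ) v                                        ≡⟨ act-ν τ v ⟩
    ρ (elem (act τ v₀) ⁻¹) (act τ v)                   ≡⟨ cong₂ (λ u w → ρ (elem u ⁻¹) w) (e v₀) (e v) ⟩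
    ρ (elem (ρ g (act σ v₀)) ⁻¹) (ρ g (act σ v))       ≡⟨ cong (λ h → ρ (h ⁻¹) (ρ g (act σ v))) (elem-ρ g (act σ v₀)) ⟩
    ρ ((g ∙ elem (act σ v₀)) ⁻¹) (ρ g (act σ v))       ≡⟨ cong (λ h → ρ h (ρ g (act σ v))) (⁻¹-anti-homo-∙ g _) ⟩
    ρ (elem (act σ v₀) ⁻¹ ∙ g ⁻¹) (ρ g (act σ v))      ≡⟨ ρ-homo _ _ _ ⟩
    ρ (elem (act σ v₀) ⁻¹) (ρ (g ⁻¹) (ρ g (act σ v)))  ≡⟨ cong (ρ _) (ρ-inverseˡ g _) ⟩
    ρ (elem (act σ v₀) ⁻¹) (act σ v)                   ≡⟨ act-ν σ v ⟨
    act (ν σ) v                                        ∎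

  -- Right multiplication by ρ(g) on the cosets ρ(H)σ, transported to their representatives in `X`.
  f : Elem → A → A
  f g σ = ν (σ ∘A R g)

  act-∘R : ∀ σ g v → act (σ ∘A R g) v ≡ act σ (ρ g v)
  act-∘R σ g v = trans (act-∘ σ (R g) v) (cong (act σ) (act-R g v))

  f-f : ∀ g h σ → f g (f h σ) ≡ f (h ∙ g) σ
  f-f g h σ = ν-coset d λ v → begin
    act (f h σ ∘A R g) v                    ≡⟨ act-∘R (f h σ) g v ⟩
    act (f h σ) (ρ g v)                     ≡⟨ act-ν (σ ∘A R h) (ρ g v) ⟩
    ρ d (act (σ ∘A R h) (ρ g v))            ≡⟨ cong (ρ d) (act-∘R σ h (ρ g v)) ⟩
    ρ d (act σ (ρ h (ρ g v)))               ≡⟨ cong (ρ d ∘ act σ) (ρ-homo h g v) ⟨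
    ρ d (act σ (ρ (h ∙ g) v))               ≡⟨ cong (ρ d) (act-∘R σ (h ∙ g) v) ⟨
    ρ d (act (σ ∘A R (h ∙ g)) v)            ∎
    where
    d : Elem
    d = elem (act (σ ∘A R h) v₀) ⁻¹

  f-ε : ∀ {σ} → X σ → f ε σ ≡ σ
  f-ε {σ} x = trans (ν-coset ε (λ v → trans (act-∘R σ ε v) (trans (cong (act σ) (ρ-ε v)) (sym (ρ-ε _))))) (ν-X x)

  iter-f : ∀ g n {σ} → X σ → iter (f g) n σ ≡ f (pow g n) σ
  iter-f g zero    x = sym (f-ε x)
  iter-f g (suc n) {σ} x = trans (cong (f g) (iter-f g n x)) (trans (f-f g (pow g n) σ) (cong (λ h → f h σ) (sym (pow-suc′ g n))))

  enumX : Enum X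
  enumX = enum-⇔ proj₂ (tt ,_) (enum-filter X? enumA)

  card-A : card enumA ≡ card enumX * order
  card-A = trans (card-bij enumA (enum-× enumX (enum-Fin order))
      (λ σ → ν σ , elem (act σ v₀)) (λ (τ , h) → R h ∘A τ) (λ {σ} _ → X-ν σ , tt) (λ _ → tt)
      (λ {σ} _ → ext λ v → trans (act-∘ _ _ v) (trans (act-R _ _) (trans (cong (ρ _) (act-ν σ v)) (ρ-inverseʳ _ _))))
      (λ {(τ , h)} (x , _) → back τ h x))
    (trans (card-× enumX (enum-Fin order)) (cong (card enumX *_) (card-Fin order)))
    where
    act-Rτ : ∀ τ h v → act (R h ∘A τ) v ≡ ρ h (act τ v)
    act-Rτ τ h v = trans (act-∘ (R h) τ v) (act-R h (act τ v))
    back : ∀ τ h → X τ → (ν (R h ∘A τ) , elem (act (R h ∘A τ) v₀)) ≡ (τ , h)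
    back τ h x = cong₂ _,_ (trans (ν-coset h (act-Rτ τ h)) (ν-X x))
      (trans (cong elem (act-Rτ τ h v₀)) (trans (elem-ρ h _) (trans (cong (h ∙_) x) (identityʳ h))))

  -- Edge-transitivity may fail to reverse an edge. Adjoining a formal reversal of arcs gives a
  -- group, twice as large as `A`, that is transitive on arcs.
  AB : Set
  AB = A × Bool

  turn : Bool → V × V → V × V
  turn false (u , v) = u , v
  turn true  (u , v) = v , u

  apply : AB → V × V → V × V
  apply (σ , b) (u , v) = turn b (act σ u , act σ v)

  e₁ : V × V
  e₁ = v₀ , proj₁ (some-nbr v₀)

  apply-arc : ∀ a {e} → Arc e → Arc (apply a e)
  apply-arc (σ , false) {u , v} p = trans (preserve σ u v) p
  apply-arc (σ , true)  {u , v} p = trans (Graph.sym Γ _ _) (trans (preserve σ u v) p)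

  to-arc : V × V → AB
  to-arc (x , y) = go (nbr? x y)
    where
    go : Dec (Nbr x y) → AB
    -- An arbitrary value: the transversal is total but matters only on arcs.
    go (no _)  = one , false
    go (yes p) = pick (edge-transitive v₀ (proj₁ (some-nbr v₀)) x y (proj₂ (some-nbr v₀)) p)
      where
      pick : (∃ λ (σ : Aut) → (actAut σ v₀ ≡ x × actAut σ (proj₁ (some-nbr v₀)) ≡ y) ⊎ (actAut σ v₀ ≡ y × actAut σ (proj₁ (some-nbr v₀)) ≡ x)) → AB
      pick (σ , inj₁ _) = fromAut σ , false
      pick (σ , inj₂ _) = fromAut σ , true

  apply-to-arc : ∀ {e} → Arc e → apply (to-arc e) e₁ ≡ e
  apply-to-arc {x , y} p with nbr? x y
  ... | no ne = contradiction p ne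
  ... | yes p′ with edge-transitive v₀ (proj₁ (some-nbr v₀)) x y (proj₂ (some-nbr v₀)) p′
  ... | σ , inj₁ (e , e′) = cong₂ _,_ (trans (act-from σ _) e) (trans (act-from σ _) e′)
  ... | σ , inj₂ (e , e′) = cong₂ _,_ (trans (act-from σ _) e′) (trans (act-from σ _) e)

  enumStab : Enum (λ a → apply a e₁ ≡ e₁)
  enumStab = enum-⇔ proj₂ (λ p → (tt , tt) , p) (enum-filter (λ a → Prodₚ.≡-dec Fin._≟_ Fin._≟_ (apply a e₁) e₁) (enum-× enumA enum-Bool))

  card-AB : card enumA * 2 ≡ size * 3 * card enumStab
  card-AB = trans (sym (card-× enumA enum-Bool)) (trans
    (orbit-stabiliser _·_ inv′ apply
      (λ (σ , b) (τ , b′) → cong₂ _,_ (ext λ v → trans (act-∘ _ _ v) (trans (cong (act (inv σ)) (act-∘ σ τ v)) (act-invˡ σ _))) (xor² b b′))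
      (λ (σ , b) (τ , b′) → cong₂ _,_ (ext λ v → trans (act-∘ _ _ v) (trans (cong (act σ) (act-∘ _ τ v)) (act-invʳ σ _))) (xor² b b′))
      apply-· apply-inv e₁ (λ a → apply-arc a (proj₂ (some-nbr v₀))) to-arc apply-to-arc
      (enum-⇔ (λ _ → tt) (λ _ → tt , tt) (enum-× enumA enum-Bool)) arcs enumStab)
    (cong (_* card enumStab) card-arcs))
    where
    _·_ : AB → AB → AB
    (σ , b) · (τ , b′) = σ ∘A τ , b xor b′
    inv′ : AB → AB
    inv′ (σ , b) = inv σ , b
    xor² : ∀ b b′ → b xor (b xor b′) ≡ b′
    xor² false b′ = refl
    xor² true false = refl
    xor² true true = refl
    turn-turn : ∀ b b′ e → turn (b xor b′) e ≡ turn b (turn b′ e)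
    turn-turn false b′ e = refl
    turn-turn true false e = refl
    turn-turn true true e = refl
    apply-turn : ∀ σ b b′ u v → turn b (act σ (proj₁ (turn b′ (u , v))) , act σ (proj₂ (turn b′ (u , v)))) ≡ turn b (turn b′ (act σ u , act σ v))
    apply-turn σ b false u v = refl
    apply-turn σ b true  u v = refl
    apply-· : ∀ a b e → apply (a · b) e ≡ apply a (apply b e)
    apply-· (σ , b) (τ , b′) (u , v) = trans (cong₂ (λ x y → turn (b xor b′) (x , y)) (act-∘ σ τ u) (act-∘ σ τ v))
      (trans (turn-turn b b′ _) (sym (apply-turn σ b b′ (act τ u) (act τ v))))
    apply-inv : ∀ a e → apply (inv′ a) (apply a e) ≡ e
    apply-inv (σ , false) (u , v) = cong₂ _,_ (act-invˡ σ u) (act-invˡ σ v)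
    apply-inv (σ , true)  (u , v) = cong₂ _,_ (act-invˡ σ u) (act-invˡ σ v)

  -- Counting arcs gives 2|A| = 6|H| · |stabiliser|, while |A| = |X| · |H|. Hence |X| is three times
  -- the order of the stabiliser.
  3∣card-X : 3∣card _≟A_ X
  3∣card-X = enumX , divides (card enumStab) (trans 3stab (*-comm 3 (card enumStab)))
    where
    instance
      nz : NonZero (order * 2)
      nz = subst (λ n → NonZero (n * 2)) (sym order≡3^k) (m*n≢0 (3 ^ k) 2 {{m^n≢0 3 k}})
    rearrange : ∀ o s → 2 * o * 3 * s ≡ 3 * s * (o * 2)
    rearrange = solve-∀
    3stab : card enumX ≡ 3 * card enumStab
    3stab = *-cancelʳ-≡ (card enumX) (3 * card enumStab) (order * 2) (begin
      card enumX * (order * 2)              ≡⟨ *-assoc (card enumX) order 2 ⟨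
      card enumX * order * 2                ≡⟨ cong (_* 2) card-A ⟨
      card enumA * 2                        ≡⟨ card-AB ⟩
      size * 3 * card enumStab              ≡⟨ cong (λ n → n * 3 * card enumStab) size≡2*order ⟩
      2 * order * 3 * card enumStab         ≡⟨ rearrange order (card enumStab) ⟩
      3 * card enumStab * (order * 2)       ∎)

  -- The inclusion of σρ(H)σ⁻¹ in ρ(H), which is an equality by finiteness. The chosen `g′` later
  -- becomes the value of α at `g`.
  Nrm : A → Set
  Nrm σ = ∀ g → ∃ λ g′ → ∀ v → act σ (ρ g v) ≡ ρ g′ (act σ v)

  open Metacyclic M

  -- A coset ρ(H)σ is fixed by all of H exactly when σ normalises ρ(H). The fixed points are taken
  -- for `g` and then for `h`, so two cyclic actions suffice; `h` preserves the fixed points of `g`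
  -- because h g = g^r h.
  3∣card-normaliser : 3∣card _≟A_ (λ σ → X σ × Nrm σ)
  3∣card-normaliser = 3∣card-⇔ _≟A_ to from
    (3∣card-fix _≟A_ (f h) k (λ {σ} ((x , e)) → (X-ν _ , h-preserves σ x e)) (λ (x , _) → torsion h x)
      (3∣card-fix _≟A_ (f g) k (λ _ → X-ν _) (torsion g) 3∣card-X))
    where
    torsion : ∀ u {σ} → X σ → iter (f u) (3 ^ k) σ ≡ σ
    torsion u {σ} x = trans (iter-f u (3 ^ k) x) (trans (cong (λ w → f w σ) (subst (λ n → pow u n ≡ ε) order≡3^k (pow-order u))) (f-ε x))
    pow-fixed : ∀ u n {σ} → X σ → f u σ ≡ σ → f (pow u n) σ ≡ σ
    pow-fixed u n x e = trans (sym (iter-f u n x)) (iter-fix (f u) n e)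
    h-preserves : ∀ σ → X σ → f g σ ≡ σ → f g (f h σ) ≡ f h σ
    h-preserves σ x e = trans (f-f g h σ) (trans (cong (λ w → f w σ) conj) (trans (sym (f-f h (pow g r) σ)) (cong (f h) (pow-fixed g r x e))))
    to : ∀ {σ} → (X σ × f g σ ≡ σ) × f h σ ≡ σ → X σ × Nrm σ
    to {σ} ((x , eg) , eh) = x , λ u → d u , λ v → begin
        act σ (ρ u v)                             ≡⟨ act-∘R σ u v ⟨
        act (σ ∘A R u) v                          ≡⟨ ρ-inverseʳ (d u) _ ⟨
        ρ (d u) (ρ (d u ⁻¹) (act (σ ∘A R u) v))   ≡⟨ cong (ρ (d u)) (act-ν (σ ∘A R u) v) ⟨
        ρ (d u) (act (f u σ) v)                   ≡⟨ cong (λ τ → ρ (d u) (act τ v)) (fixed u (span u)) ⟩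
        ρ (d u) (act σ v)                         ∎
      where
      d : Elem → Elem
      d u = elem (act (σ ∘A R u) v₀)
      fixed : ∀ u → (∃₂ λ i j → u ≡ pow g i ∙ pow h j) → f u σ ≡ σ
      fixed _ (i , j , refl) = trans (sym (f-f (pow h j) (pow g i) σ)) (trans (cong (f (pow h j)) (pow-fixed g i x eg)) (pow-fixed h j x eh))
    from : ∀ {σ} → X σ × Nrm σ → (X σ × f g σ ≡ σ) × f h σ ≡ σ
    from {σ} (x , n) = (x , fixed g) , fixed h
      where
      fixed : ∀ u → f u σ ≡ σ
      fixed u = trans (ν-coset (proj₁ (n u)) (λ v → trans (act-∘R σ u v) (proj₂ (n u) v))) (ν-X x)

  Nrm-∘ : ∀ {σ τ} → Nrm σ → Nrm τ → Nrm (σ ∘A τ)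
  Nrm-∘ {σ} {τ} m n u = proj₁ (m (proj₁ (n u))) , λ v → begin
    act (σ ∘A τ) (ρ u v)      ≡⟨ act-∘ σ τ _ ⟩
    act σ (act τ (ρ u v))     ≡⟨ cong (act σ) (proj₂ (n u) v) ⟩
    act σ (ρ _ (act τ v))     ≡⟨ proj₂ (m _) _ ⟩
    ρ _ (act σ (act τ v))     ≡⟨ cong (ρ _) (act-∘ σ τ v) ⟨
    ρ _ (act (σ ∘A τ) v)      ∎

  act-injective : ∀ σ {u v} → act σ u ≡ act σ v → u ≡ v
  act-injective σ {u} {v} e = trans (sym (act-invˡ σ u)) (trans (cong (act (inv σ)) e) (act-invˡ σ v))

  -- Conjugation by σ is injective on H and therefore surjective, so each `u` is the conjugate of
  -- some element `a`.
  Nrm-inv : ∀ {σ} → Nrm σ → Nrm (inv σ)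
  Nrm-inv {σ} n u = finish (injective⇒surjective (λ a → proj₁ (n a)) inj u)
    where
    inj : ∀ {a b} → proj₁ (n a) ≡ proj₁ (n b) → a ≡ b
    inj {a} {b} e = ρ-semiregular {v = v₀} (act-injective σ (trans (proj₂ (n a) v₀) (trans (cong (λ w → ρ w (act σ v₀)) e) (sym (proj₂ (n b) v₀)))))
    finish : (∃ λ a → proj₁ (n a) ≡ u) → ∃ λ u′ → ∀ v → act (inv σ) (ρ u v) ≡ ρ u′ (act (inv σ) v)
    finish (a , refl) = a , λ v → act-injective σ (begin
      act σ (act (inv σ) (ρ u v))   ≡⟨ act-invʳ σ _ ⟩
      ρ u v                         ≡⟨ cong (ρ u) (act-invʳ σ v) ⟨
      ρ u (act σ (act (inv σ) v))   ≡⟨ proj₂ (n a) _ ⟨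
      act σ (ρ a (act (inv σ) v))   ∎)

  N₀ : A → Set
  N₀ σ = Nrm σ × act σ v₀ ≡ v₀

  N₀-∘ : ∀ {σ τ} → N₀ σ → N₀ τ → N₀ (σ ∘A τ)
  N₀-∘ {σ} {τ} (m , e) (n , e′) = Nrm-∘ {σ} {τ} m n , trans (act-∘ σ τ v₀) (trans (cong (act σ) e′) e)

  N₀-inv : ∀ {σ} → N₀ σ → N₀ (inv σ)
  N₀-inv {σ} (m , e) = Nrm-inv m , trans (cong (act (inv σ)) (sym e)) (act-invˡ σ v₀)

  N₀-one : N₀ one
  N₀-one = (λ g → g , λ v → trans (act-one _) (cong (ρ g) (sym (act-one v)))) , act-one v₀

  X-fixes : ∀ {σ} → act σ v₀ ≡ v₀ → X σ
  X-fixes e = trans (cong elem e) (proj₂ (position-base Fin.zero))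

  -- A normalising σ in `X` sends v₀ to one of the two base vertices. Those that send it to the
  -- second are either absent or form a coset of the stabiliser, so the total is once or twice the
  -- order of the stabiliser, and 2 is prime to 3.
  3∣card-N₀ : 3∣card _≟A_ N₀
  3∣card-N₀ = 3∣card-⇔ _≟A_ (λ ((_ , n) , e) → n , e) (λ (n , e) → (X-fixes e , n) , e) (E₀ , divisible (list E₁) refl)
    where
    fix? : Decidable (λ σ → act σ v₀ ≡ v₀)
    fix? σ = act σ v₀ Fin.≟ v₀
    E = proj₁ 3∣card-normaliser
    E₀ = enum-filter fix? E
    E₁ = enum-filter (¬? ∘ fix?) E
    total : 3 ∣ card E₀ + card E₁
    total = subst (3 ∣_) (card-split fix? E) (proj₂ 3∣card-normaliser)
    other-base : ∀ {σ} → X σ → act σ v₀ ≢ v₀ → act σ v₀ ≡ base (Fin.suc Fin.zero)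
    other-base {σ} x ne = go (side (act σ v₀)) (elem≡ε⇒base x)
      where
      go : ∀ s → act σ v₀ ≡ base s → act σ v₀ ≡ base (Fin.suc Fin.zero)
      go Fin.zero e = contradiction e ne
      go (Fin.suc Fin.zero) e = e
    double : ∀ n → 3 ∣ n + n → 3 ∣ n
    double n d = ∣m+n∣m⇒∣n (subst (3 ∣_) (arith n) (∣n⇒∣m*n n ∣-refl)) d
      where
      arith : ∀ n → n * 3 ≡ n + n + n
      arith = solve-∀
    divisible : ∀ τs → list E₁ ≡ τs → 3 ∣ card E₀
    divisible [] e = subst (3 ∣_) (trans (cong (card E₀ +_) (cong length e)) (+-identityʳ _)) total
    divisible (τ ∷ _) e = double (card E₀) (subst (λ n → 3 ∣ card E₀ + n) (sym same) total)
      where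
      Pτ : (X τ × Nrm τ) × act τ v₀ ≢ v₀
      Pτ = sound E₁ (subst (τ ∈_) (sym e) (here refl))
      forth : ∀ {σ} → (X σ × Nrm σ) × act σ v₀ ≡ v₀ → (X (τ ∘A σ) × Nrm (τ ∘A σ)) × act (τ ∘A σ) v₀ ≢ v₀
      forth {σ} ((_ , n) , e) = (trans (cong elem τσ) (proj₁ (proj₁ Pτ)) , Nrm-∘ {τ} {σ} (proj₂ (proj₁ Pτ)) n) , λ e′ → proj₂ Pτ (trans (sym τσ) e′)
        where
        τσ : act (τ ∘A σ) v₀ ≡ act τ v₀
        τσ = trans (act-∘ τ σ v₀) (cong (act τ) e)
      back : ∀ {σ} → (X σ × Nrm σ) × act σ v₀ ≢ v₀ → (X (inv τ ∘A σ) × Nrm (inv τ ∘A σ)) × act (inv τ ∘A σ) v₀ ≡ v₀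
      back {σ} ((x , n) , ne) = (X-fixes e′ , Nrm-∘ {inv τ} {σ} (Nrm-inv (proj₂ (proj₁ Pτ))) n) , e′
        where
        e′ : act (inv τ ∘A σ) v₀ ≡ v₀
        e′ = trans (act-∘ (inv τ) σ v₀) (trans (cong (act (inv τ))
          (trans (other-base x ne) (sym (other-base (proj₁ (proj₁ Pτ)) (proj₂ Pτ))))) (act-invˡ τ v₀))
      same : card E₀ ≡ card E₁
      same = card-bij E₀ E₁ (τ ∘A_) (inv τ ∘A_)
        (λ {σ} → forth {σ}) (λ {σ} → back {σ})
        (λ {σ} _ → ext λ v → trans (act-∘ _ _ v) (trans (cong (act (inv τ)) (act-∘ τ σ v)) (act-invˡ τ _)))
        (λ {σ} _ → ext λ v → trans (act-∘ _ _ v) (trans (cong (act τ) (act-∘ _ σ v)) (act-invʳ τ _)))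

  -- McKay's proof of Cauchy's theorem: rotate the triples (a, b, (ab)⁻¹).
  order-three : ∃ λ σ → N₀ σ × σ ≢ one × (∀ v → act σ (act σ (act σ v)) ≡ v)
  -- The pairs fixed by the rotation are the (a, a) with a³ = 1. The pair of identities is one of
  -- them, so a number divisible by 3 forces another.
  order-three = finish (3∣card-other _≟AA_ fixed ((N₀-one , N₀-one) , cong₂ _,_ refl
      inv-one))
    where
    _≟AA_ : DecidableEquality (A × A)
    _≟AA_ = Prodₚ.≡-dec _≟A_ _≟A_
    inv-one : inv (one ∘A one) ≡ one
    inv-one = ext λ v → act-injective (one ∘A one) (trans (act-invʳ _ v) (sym (trans (act-∘ one one _) (trans (act-one _) (trans (act-one _) (act-one v))))))
    rotate : A × A → A × A
    rotate (a , b) = b , inv (a ∘A b)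
    N² : A × A → Set
    N² (a , b) = N₀ a × N₀ b
    3∣card-N² : 3∣card _≟AA_ N²
    3∣card-N² = enum-× (proj₁ 3∣card-N₀) (proj₁ 3∣card-N₀) , subst (3 ∣_) (sym (card-× (proj₁ 3∣card-N₀) (proj₁ 3∣card-N₀))) (∣m⇒∣m*n _ (proj₂ 3∣card-N₀))
    rotate-N² : ∀ {ab} → N² ab → N² (rotate ab)
    rotate-N² (p , q) = q , N₀-inv (N₀-∘ p q)
    back : ∀ a b v → act b (act (inv (a ∘A b)) v) ≡ act (inv a) v
    back a b v = act-injective a (trans (sym (act-∘ a b _)) (trans (act-invʳ (a ∘A b) v) (sym (act-invʳ a v))))
    inv-unique : ∀ {σ τ} → (∀ v → act σ v ≡ act (inv τ) v) → inv σ ≡ τ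
    inv-unique {σ} {τ} e = ext λ v → act-injective σ (trans (act-invʳ σ v) (sym (trans (e _) (act-invˡ τ v))))
    step : ∀ a b → inv (b ∘A inv (a ∘A b)) ≡ a
    step a b = inv-unique λ v → trans (act-∘ b _ v) (back a b v)
    rotate³ : ∀ {ab} → N² ab → rotate (rotate (rotate ab)) ≡ ab
    rotate³ {a , b} _ = cong₂ _,_ (step a b) (trans (cong (λ c → inv (inv (a ∘A b) ∘A c)) (step a b)) (inv-unique λ v →
      trans (act-∘ _ a v) (trans (sym (act-invˡ b _)) (cong (act (inv b)) (trans (back a b (act a v)) (act-invˡ a v))))))
    fixed : 3∣card _≟AA_ (λ ab → N² ab × rotate ab ≡ ab)
    fixed = 3∣card-fix-cube _≟AA_ rotate rotate-N² rotate³ 3∣card-N²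
    finish : (∃ λ ab → (N² ab × rotate ab ≡ ab) × ab ≢ (one , one)) → ∃ λ σ → N₀ σ × σ ≢ one × (∀ v → act σ (act σ (act σ v)) ≡ v)
    finish ((a , b) , ((p , _) , e) , ne) = cube (cong proj₁ e) (cong proj₂ e) p ne
      where
      cube : b ≡ a → inv (a ∘A b) ≡ b → N₀ a → (a , b) ≢ (one , one) → ∃ λ σ → N₀ σ × σ ≢ one × (∀ v → act σ (act σ (act σ v)) ≡ v)
      cube refl e p ne = a , p , (λ { refl → ne refl }) , λ v → trans (sym (act-∘ a a _)) (trans (cong (act (a ∘A a)) (cong (λ τ → act τ v) (sym e))) (act-invʳ (a ∘A a) v))

-- Haar graphs

pattern side₀ = Fin.zero
pattern side₁ = Fin.suc Fin.zero

-- Γ is BiCay(H, ∅, ∅, {1, x, y}) up to replacing H by its opposite group, vertex (i , h) being h_i.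
record Haar (H : FinGroup) (Γ : Graph) (x y : GroupNotions.Elem H) : Set where
  open FinGroup H
  open Graph Γ
  field
    vertex       : Fin 2 × Fin order → Fin size
    coord        : Fin size → Fin 2 × Fin order
    vertex-coord : ∀ v → vertex (coord v) ≡ v
    coord-vertex : ∀ p → coord (vertex p) ≡ p
    adj-same     : ∀ s h k → adj (vertex (s , h)) (vertex (s , k)) ≡ false
    adj-cross    : ∀ h k → adj (vertex (side₀ , h)) (vertex (side₁ , k)) ≡ true →
                   k ≡ h ⊎ k ≡ h ∙ x ⊎ k ≡ h ∙ y
    cross-adj    : ∀ h k → k ≡ h ⊎ k ≡ h ∙ x ⊎ k ≡ h ∙ y →
                   adj (vertex (side₀ , h)) (vertex (side₁ , k)) ≡ true

-- Seen from the other side, the step k = h x becomes h = k x⁻¹.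
haar-dual : ∀ {H Γ x y} → Haar H Γ x y → Haar H Γ (FinGroup._⁻¹ H x) (FinGroup._⁻¹ H y)
haar-dual {H} {Γ} {x} {y} G = record
  { vertex = vertex ∘ flip ; coord = flip ∘ coord
  ; vertex-coord = λ v → trans (cong vertex (flip² (coord v))) (vertex-coord v)
  ; coord-vertex = λ p → trans (cong flip (coord-vertex (flip p))) (flip² p)
  ; adj-same = λ { side₀ → adj-same side₁ ; side₁ → adj-same side₀ }
  ; adj-cross = λ h k e → backward (adj-cross k h (trans (Graph.sym Γ _ _) e))
  ; cross-adj = λ h k e → trans (Graph.sym Γ _ _) (cross-adj k h (forward e)) }
  where
  open FinGroupProps H
  open Haar G
  flip : Fin 2 × Elem → Fin 2 × Elem
  flip (side₀ , h) = side₁ , h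
  flip (side₁ , h) = side₀ , h
  flip² : ∀ p → flip (flip p) ≡ p
  flip² (side₀ , h) = refl
  flip² (side₁ , h) = refl
  backward : ∀ {h k} → h ≡ k ⊎ h ≡ k ∙ x ⊎ h ≡ k ∙ y → k ≡ h ⊎ k ≡ h ∙ x ⁻¹ ⊎ k ≡ h ∙ y ⁻¹
  backward (inj₁ refl)        = inj₁ refl
  backward (inj₂ (inj₁ refl)) = inj₂ (inj₁ (sym (//-rightDividesʳ _ _)))
  backward (inj₂ (inj₂ refl)) = inj₂ (inj₂ (sym (//-rightDividesʳ _ _)))
  forward : ∀ {h k} → k ≡ h ⊎ k ≡ h ∙ x ⁻¹ ⊎ k ≡ h ∙ y ⁻¹ → h ≡ k ⊎ h ≡ k ∙ x ⊎ h ≡ k ∙ y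
  forward (inj₁ refl)        = inj₁ refl
  forward (inj₂ (inj₁ refl)) = inj₂ (inj₁ (sym (//-rightDividesˡ _ _)))
  forward (inj₂ (inj₂ refl)) = inj₂ (inj₂ (sym (//-rightDividesˡ _ _)))

-- Isomorphism with the bi-Cayley graphs on normal forms

bool-≡ : ∀ {a b} → (a ≡ true → b ≡ true) → (b ≡ true → a ≡ true) → a ≡ b
bool-≡ {false} {false} f g = refl
bool-≡ {false} {true}  f g = g refl
bool-≡ {true}  {b}     f g = sym (f refl)

∨₃⁻ : ∀ a b c → a ∨ (b ∨ (c ∨ false)) ≡ true → a ≡ true ⊎ b ≡ true ⊎ c ≡ true
∨₃⁻ true  _     _    _ = inj₁ refl
∨₃⁻ false true  _    _ = inj₂ (inj₁ refl)
∨₃⁻ false false true _ = inj₂ (inj₂ refl)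

∨₃⁺ : ∀ a b c → a ≡ true ⊎ b ≡ true ⊎ c ≡ true → a ∨ (b ∨ (c ∨ false)) ≡ true
∨₃⁺ true  _     _    _                  = refl
∨₃⁺ false true  _    _                  = refl
∨₃⁺ false false true _                  = refl
∨₃⁺ false false false (inj₂ (inj₂ ()))

-- The number (n - j) + i lies strictly between 0 and 2n, so as a multiple of n it must be n itself.
residue-≡ : ∀ {n i j} → i < n → j < n → n ∣ (n ∸ j) + i → i ≡ j
residue-≡ {n} {i} {j} i<n j<n (divides zero e) = contradiction (m+n≡0⇒m≡0 (n ∸ j) e) (m>n⇒m∸n≢0 j<n)
residue-≡ {n} {i} {j} i<n j<n (divides (suc zero) e) = +-cancelˡ-≡ (n ∸ j) i j
  (trans e (trans (+-identityʳ n) (sym (m∸n+n≡m (<⇒≤ j<n)))))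
residue-≡ {n} {i} {j} i<n j<n (divides (suc (suc l)) e) = contradiction e (<⇒≢ (begin-strict
  (n ∸ j) + i     <⟨ +-mono-≤-< (m∸n≤m n j) i<n ⟩
  n + n           ≤⟨ +-monoʳ-≤ n (m≤m+n n (l * n)) ⟩
  n + (n + l * n) ∎))
  where open ≤-Reasoning

module Isomorphism (H : FinGroup) {q p r : ℕ} .{{_ : NonZero q}} .{{_ : NonZero p}}
    {a b : GroupNotions.Elem H} (K : Coordinates H q p r a b) where
  open FinGroupProps H
  open Coordinates K

  pow-% : ∀ {u n} .{{_ : NonZero n}} → pow u n ≡ ε → ∀ m → pow u (toℕ (m mod n)) ≡ pow u m
  pow-% {u} {n} e m = begin
    pow u (toℕ (m mod n))              ≡⟨ cong (pow u) (Finₚ.toℕ-fromℕ< (m%n<n m n)) ⟩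
    pow u (m % n)                      ≡⟨ identityʳ _ ⟨
    pow u (m % n) ∙ ε                  ≡⟨ cong (pow u (m % n) ∙_) (trans (pow-* u (m / n) n) (trans (cong (λ w → pow w (m / n)) e) (pow-ε (m / n)))) ⟨
    pow u (m % n) ∙ pow u (m / n * n)  ≡⟨ pow-+ u (m % n) (m / n * n) ⟨
    pow u (m % n + m / n * n)          ≡⟨ cong (pow u) (m≡m%n+[m/n]*n m n) ⟨
    pow u m                            ∎
    where open ≡-Reasoning

  -- The pair (j , i), which stands for b^j a^i, is sent to the reversed word. This makes `θ` an
  -- anti-isomorphism and turns the left multiplications in `BiCay` into the right multiplications
  -- in `Haar`.
  θ : MC q p → Elem
  θ (j , i) = pow a (toℕ i) ∙ pow b (toℕ j)

  θ-elt : ∀ j i → θ (elt q p j i) ≡ pow a i ∙ pow b j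
  θ-elt j i = cong₂ _∙_ (pow-% aᵖ i) (pow-% bᑫ j)

  θ-mul : ∀ m n → θ (mulMC q p r m n) ≡ θ n ∙ θ m
  θ-mul (j , i) (l , k) = begin
    θ (elt q p (toℕ j + toℕ l) (toℕ i * r ^ toℕ l + toℕ k))
      ≡⟨ θ-elt (toℕ j + toℕ l) (toℕ i * r ^ toℕ l + toℕ k) ⟩
    pow a (toℕ i * r ^ toℕ l + toℕ k) ∙ pow b (toℕ j + toℕ l)
      ≡⟨ cong₂ (λ m n → pow a m ∙ pow b n) (+-comm (toℕ i * r ^ toℕ l) (toℕ k)) (+-comm (toℕ j) (toℕ l)) ⟩
    pow a (toℕ k + toℕ i * r ^ toℕ l) ∙ pow b (toℕ l + toℕ j)
      ≡⟨ cong₂ _∙_ (pow-+ a (toℕ k) _) (pow-+ b (toℕ l) (toℕ j)) ⟩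
    (pow a (toℕ k) ∙ pow a (toℕ i * r ^ toℕ l)) ∙ (pow b (toℕ l) ∙ pow b (toℕ j))
      ≡⟨ solve 4 (λ a b c d → (a ⊕ b) ⊕ (c ⊕ d) ⊜ a ⊕ ((b ⊕ c) ⊕ d)) refl _ _ _ _ ⟩
    pow a (toℕ k) ∙ ((pow a (toℕ i * r ^ toℕ l) ∙ pow b (toℕ l)) ∙ pow b (toℕ j))
      ≡⟨ cong (λ w → pow a (toℕ k) ∙ (w ∙ pow b (toℕ j))) (pow-conj r conj (toℕ l) (toℕ i)) ⟨
    pow a (toℕ k) ∙ ((pow b (toℕ l) ∙ pow a (toℕ i)) ∙ pow b (toℕ j))
      ≡⟨ solve 4 (λ a b c d → a ⊕ ((b ⊕ c) ⊕ d) ⊜ (a ⊕ b) ⊕ (c ⊕ d)) refl _ _ _ _ ⟩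
    (pow a (toℕ k) ∙ pow b (toℕ l)) ∙ (pow a (toℕ i) ∙ pow b (toℕ j)) ∎
    where open ≡-Reasoning

  θ-injective : ∀ {m n} → θ m ≡ θ n → m ≡ n
  θ-injective {j , i} {l , k} e = cong₂ _,_
      (Finₚ.toℕ-injective (residue-≡ (Finₚ.toℕ<n j) (Finₚ.toℕ<n l) (subst (q ∣_) (+-comm (toℕ j) _) (proj₂ rel))))
      (Finₚ.toℕ-injective (residue-≡ (Finₚ.toℕ<n i) (Finₚ.toℕ<n k) (proj₁ rel)))
    where
    open ≡-Reasoning
    i′ j′ : ℕ
    i′ = p ∸ toℕ k
    j′ = q ∸ toℕ l
    rel : p ∣ i′ + toℕ i × q ∣ toℕ j + j′
    rel = indep (i′ + toℕ i) (toℕ j + j′) (begin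
      pow a (i′ + toℕ i) ∙ pow b (toℕ j + j′)
        ≡⟨ cong₂ _∙_ (pow-+ a i′ (toℕ i)) (pow-+ b (toℕ j) j′) ⟩
      (pow a i′ ∙ pow a (toℕ i)) ∙ (pow b (toℕ j) ∙ pow b j′)
        ≡⟨ solve 4 (λ a b c d → (a ⊕ b) ⊕ (c ⊕ d) ⊜ a ⊕ ((b ⊕ c) ⊕ d)) refl _ _ _ _ ⟩
      pow a i′ ∙ (θ (j , i) ∙ pow b j′)
        ≡⟨ cong (λ w → pow a i′ ∙ (w ∙ pow b j′)) e ⟩
      pow a i′ ∙ (θ (l , k) ∙ pow b j′)
        ≡⟨ solve 4 (λ a b c d → a ⊕ ((b ⊕ c) ⊕ d) ⊜ (a ⊕ b) ⊕ (c ⊕ d)) refl _ _ _ _ ⟩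
      (pow a i′ ∙ pow a (toℕ k)) ∙ (pow b (toℕ l) ∙ pow b j′)
        ≡⟨ cong₂ _∙_ (pow-+ a i′ (toℕ k)) (pow-+ b (toℕ l) j′) ⟨
      pow a (i′ + toℕ k) ∙ pow b (toℕ l + j′)
        ≡⟨ cong₂ (λ m n → pow a m ∙ pow b n) (m∸n+n≡m (<⇒≤ (Finₚ.toℕ<n k))) (m+[n∸m]≡n (<⇒≤ (Finₚ.toℕ<n l))) ⟩
      pow a p ∙ pow b q
        ≡⟨ cong₂ _∙_ aᵖ bᑫ ⟩
      ε ∙ ε
        ≡⟨ identityˡ ε ⟩
      ε ∎)

  θ⁻¹ : Elem → MC q p
  θ⁻¹ u = elt q p (proj₁ (proj₂ (span u))) (proj₁ (span u))

  θθ⁻¹ : ∀ u → θ (θ⁻¹ u) ≡ u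
  θθ⁻¹ u = trans (θ-elt (proj₁ (proj₂ (span u))) (proj₁ (span u))) (sym (proj₂ (proj₂ (span u))))

  θ⁻¹θ : ∀ m → θ⁻¹ (θ m) ≡ m
  θ⁻¹θ m = θ-injective {θ⁻¹ (θ m)} {m} (θθ⁻¹ (θ m))

  module Transport {Γ : Graph} {x y : Elem} (G : Haar H Γ x y) (one σ τ : MC q p)
      (θ-one : θ one ≡ ε) (θ-σ : θ σ ≡ x) (θ-τ : θ τ ≡ y) where
    open Haar G
    open Graph Γ using (adj)
    open BiCayley (_≟MC_ {q} {p}) (mulMC q p r)

    S : List (MC q p)
    S = one ∷ σ ∷ τ ∷ []

    hit : MC q p → MC q p → MC q p → Bool
    hit s h k = does (mulMC q p r s h ≟MC k)

    hit⇒ : ∀ s h k → hit s h k ≡ true → θ k ≡ θ h ∙ θ s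
    hit⇒ s h k e with mulMC q p r s h ≟MC k
    ... | yes refl = θ-mul s h

    ⇒hit : ∀ s h k → θ k ≡ θ h ∙ θ s → hit s h k ≡ true
    ⇒hit s h k e with mulMC q p r s h ≟MC k
    ... | yes _ = refl
    ... | no ne = contradiction (θ-injective {mulMC q p r s h} {k} (trans (θ-mul s h) (sym e))) ne

    inMul⇒ : ∀ h k → inMul S h k ≡ true → θ k ≡ θ h ⊎ θ k ≡ θ h ∙ x ⊎ θ k ≡ θ h ∙ y
    inMul⇒ h k e with ∨₃⁻ (hit one h k) (hit σ h k) (hit τ h k) e
    ... | inj₁ e₁        = inj₁ (trans (hit⇒ one h k e₁) (trans (cong (θ h ∙_) θ-one) (identityʳ _)))
    ... | inj₂ (inj₁ e₂) = inj₂ (inj₁ (trans (hit⇒ σ h k e₂) (cong (θ h ∙_) θ-σ)))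
    ... | inj₂ (inj₂ e₃) = inj₂ (inj₂ (trans (hit⇒ τ h k e₃) (cong (θ h ∙_) θ-τ)))

    ⇒inMul : ∀ h k → θ k ≡ θ h ⊎ θ k ≡ θ h ∙ x ⊎ θ k ≡ θ h ∙ y → inMul S h k ≡ true
    ⇒inMul h k e = ∨₃⁺ (hit one h k) (hit σ h k) (hit τ h k) (hits e)
      where
      hits : θ k ≡ θ h ⊎ θ k ≡ θ h ∙ x ⊎ θ k ≡ θ h ∙ y → hit one h k ≡ true ⊎ hit σ h k ≡ true ⊎ hit τ h k ≡ true
      hits (inj₁ e)        = inj₁ (⇒hit one h k (trans e (sym (trans (cong (θ h ∙_) θ-one) (identityʳ _)))))
      hits (inj₂ (inj₁ e)) = inj₂ (inj₁ (⇒hit σ h k (trans e (cong (θ h ∙_) (sym θ-σ)))))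
      hits (inj₂ (inj₂ e)) = inj₂ (inj₂ (⇒hit τ h k (trans e (cong (θ h ∙_) (sym θ-τ)))))

    cross : ∀ h k → inMul S h k ≡ adj (vertex (side₀ , θ h)) (vertex (side₁ , θ k))
    cross h k = bool-≡ (cross-adj (θ h) (θ k) ∘ inMul⇒ h k) (⇒inMul h k ∘ adj-cross (θ h) (θ k))

    point : Fin 2 × MC q p → Fin 2 × Elem
    point (s , m) = s , θ m

    adj-≡ : ∀ m n → BiCay [] [] S m n ≡ adj (vertex (point m)) (vertex (point n))
    adj-≡ (side₀ , h) (side₀ , k) = sym (adj-same side₀ (θ h) (θ k))
    adj-≡ (side₁ , h) (side₁ , k) = sym (adj-same side₁ (θ h) (θ k))
    adj-≡ (side₀ , h) (side₁ , k) = cross h k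
    adj-≡ (side₁ , h) (side₀ , k) = trans (cross k h) (Graph.sym Γ _ _)

    iso : GraphNotions.IsIsoTo Γ (BiCay [] [] S)
    iso = mk↔ₛ′ to from to-from from-to ,
        λ u v → trans (adj-≡ (to u) (to v)) (cong₂ adj (from-to u) (from-to v))
      where
      unpoint : Fin 2 × Elem → Fin 2 × MC q p
      unpoint (s , u) = s , θ⁻¹ u
      to : GraphNotions.V Γ → Fin 2 × MC q p
      to v = unpoint (coord v)
      from : Fin 2 × MC q p → GraphNotions.V Γ
      from = vertex ∘ point
      to-from : ∀ m → to (from m) ≡ m
      to-from (s , m) = trans (cong unpoint (coord-vertex (s , θ m))) (cong (s ,_) (θ⁻¹θ m))
      from-to : ∀ v → from (to v) ≡ v
      from-to v = trans (cong vertex (cong (proj₁ (coord v) ,_) (θθ⁻¹ (proj₂ (coord v))))) (vertex-coord v)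

Γ-iso : ∀ {H Γ x y} t → Haar H Γ x y → Γ-Coordinates H t x y → GraphNotions.IsIsoTo Γ (Γ-adj t)
Γ-iso {H} {Γ} {x} {y} t G K = Transport.iso G (elt q p 0 0) (elt q p 0 1) (elt q p 1 (p * (1 + q) ∸ (1 + q)))
    (trans (θ-elt 0 0) (identityˡ ε)) (trans (θ-elt 0 1) (trans (identityʳ _) (pow-1 x))) θ-τ
  where
  q p : ℕ
  q = 3 ^ t
  p = 3 ^ suc t
  instance
    nzq : NonZero q
    nzq = m^n≢0 3 t
    nzp : NonZero p
    nzp = m^n≢0 3 (suc t)
  open FinGroupProps H
  open Isomorphism H K
  open Coordinates K
  open ≡-Reasoning
  e : ℕ
  e = p * (1 + q) ∸ (1 + q)
  e≡ : e + (1 + q) ≡ (1 + q) * p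
  e≡ = trans (m∸n+n≡m (m≤n*m (1 + q) p)) (*-comm p (1 + q))
  b : Elem
  b = y ∙ x
  θ-τ : θ (elt q p 1 e) ≡ y
  -- After multiplication by x, `conj` carries x across b as x^(1 + q); this cancels x^e, since e is
  -- -(1 + q) modulo p.
  θ-τ = ∙-cancelʳ x _ _ (begin
    θ (elt q p 1 e) ∙ x                ≡⟨ cong (_∙ x) (trans (θ-elt 1 e) (cong (pow x e ∙_) (pow-1 b))) ⟩
    (pow x e ∙ b) ∙ x                  ≡⟨ assoc _ _ _ ⟩
    pow x e ∙ (b ∙ x)                  ≡⟨ cong (pow x e ∙_) conj ⟩
    pow x e ∙ (pow x (1 + q) ∙ b)      ≡⟨ assoc _ _ _ ⟨
    (pow x e ∙ pow x (1 + q)) ∙ b      ≡⟨ cong (_∙ b) (pow-+ x e (1 + q)) ⟨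
    pow x (e + (1 + q)) ∙ b            ≡⟨ cong (λ n → pow x n ∙ b) e≡ ⟩
    pow x ((1 + q) * p) ∙ b            ≡⟨ cong (_∙ b) (trans (pow-* x (1 + q) p) (trans (cong (λ w → pow w (1 + q)) aᵖ) (pow-ε (1 + q)))) ⟩
    ε ∙ b                              ≡⟨ identityˡ b ⟩
    y ∙ x                              ∎)

Σ-iso : ∀ {H Γ x y} t → Haar H Γ x y → Σ-Coordinates H t x y → GraphNotions.IsIsoTo Γ (Σ-adj t)
Σ-iso {H} {Γ} {x} {y} t G K = Transport.iso G (elt q q 0 0) (elt q q 1 0) (elt q q (q ∸ 1) 1)
    (trans (θ-elt 0 0) (identityˡ ε)) (trans (θ-elt 1 0) (trans (identityˡ _) (pow-1 x))) θ-τ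
  where
  q : ℕ
  q = 3 ^ suc t
  instance
    nzq : NonZero q
    nzq = m^n≢0 3 (suc t)
  open FinGroupProps H
  open Isomorphism H K
  open Coordinates K
  open ≡-Reasoning
  θ-τ : θ (elt q q (q ∸ 1) 1) ≡ y
  θ-τ = ∙-cancelʳ x _ _ (begin
    θ (elt q q (q ∸ 1) 1) ∙ x          ≡⟨ cong (_∙ x) (trans (θ-elt (q ∸ 1) 1) (cong (_∙ pow x (q ∸ 1)) (pow-1 (y ∙ x)))) ⟩
    ((y ∙ x) ∙ pow x (q ∸ 1)) ∙ x      ≡⟨ assoc _ _ _ ⟩
    (y ∙ x) ∙ (pow x (q ∸ 1) ∙ x)      ≡⟨ cong ((y ∙ x) ∙_) (pow-suc′ x (q ∸ 1)) ⟨
    (y ∙ x) ∙ pow x (1 + (q ∸ 1))      ≡⟨ cong (λ n → (y ∙ x) ∙ pow x n) (m+[n∸m]≡n (m^n>0 3 (suc t))) ⟩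
    (y ∙ x) ∙ pow x q                  ≡⟨ cong ((y ∙ x) ∙_) bᑫ ⟩
    (y ∙ x) ∙ ε                        ≡⟨ identityʳ _ ⟩
    y ∙ x                              ∎)

-- The action of an automorphism of order three

module TrigonalAction (H : FinGroup) (Γ : Graph) (connected : GraphNotions.IsConnected Γ) (cubic : GraphNotions.IsCubic Γ)
    (bicayley : GraphNotions.IsBiCayleyOver Γ H) (φ : GraphNotions.V Γ → GraphNotions.V Γ)
    (φ-adj : ∀ u v → Graph.adj Γ (φ u) (φ v) ≡ Graph.adj Γ u v)
    (φ³ : ∀ v → φ (φ (φ v)) ≡ v)
    (φ-normal : ∀ g → ∃ λ g′ → ∀ v → φ (BiCayleyAction.ρ H Γ bicayley g v) ≡ BiCayleyAction.ρ H Γ bicayley g′ (φ v))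
    (φ-v₀ : φ (BiCayleyAction.v₀ H Γ bicayley) ≡ BiCayleyAction.v₀ H Γ bicayley)
    (φ-nontrivial : ¬ (∀ v → φ v ≡ v)) where
  open FinGroupProps H
  open Graph Γ using (size; adj)
  open GraphNotions Γ using (V; Walk) renaming (here to stop; step to _then_)
  open BiCayleyAction H Γ bicayley
  open CubicGraph Γ cubic
  open ≡-Reasoning

  α : Elem → Elem
  α g = proj₁ (φ-normal g)

  φ-ρ : ∀ g v → φ (ρ g v) ≡ ρ (α g) (φ v)
  φ-ρ g = proj₂ (φ-normal g)

  α-homo : ∀ g h → α (g ∙ h) ≡ α g ∙ α h
  α-homo g h = ρ-semiregular {v = φ v₀} (begin
    ρ (α (g ∙ h)) (φ v₀)        ≡⟨ φ-ρ (g ∙ h) v₀ ⟨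
    φ (ρ (g ∙ h) v₀)            ≡⟨ cong φ (ρ-homo g h v₀) ⟩
    φ (ρ g (ρ h v₀))            ≡⟨ φ-ρ g _ ⟩
    ρ (α g) (φ (ρ h v₀))        ≡⟨ cong (ρ (α g)) (φ-ρ h v₀) ⟩
    ρ (α g) (ρ (α h) (φ v₀))    ≡⟨ ρ-homo _ _ _ ⟨
    ρ (α g ∙ α h) (φ v₀)        ∎)

  nbr-sym : ∀ {u v} → Nbr u v → Nbr v u
  nbr-sym {u} {v} e = trans (Graph.sym Γ v u) e

  nbr-ρ : ∀ g {u v} → Nbr u v → Nbr (ρ g u) (ρ g v)
  nbr-ρ g {u} {v} e = trans (ρ-adj g u v) e

  nbr-φ : ∀ {u v} → Nbr u v → Nbr (φ u) (φ v)
  nbr-φ {u} {v} e = trans (φ-adj u v) e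

  nbr-back : ∀ g {u v} → Nbr (ρ g u) v → Nbr u (ρ (g ⁻¹) v)
  nbr-back g {u} {v} e = subst (λ w → Nbr w (ρ (g ⁻¹) v)) (ρ-inverseˡ g u) (nbr-ρ (g ⁻¹) e)

  -- Connectedness forces an edge between the two orbits. Translating it by H gives v₀ a neighbour
  -- on the other side, before anything is known about edges inside an orbit.
  crossing : ∀ {u v} → Walk u v → side u ≡ side₀ → side v ≡ side₁ → ∃₂ λ a b → Nbr a b × side a ≡ side₀ × side b ≡ side₁
  crossing stop p q = contradiction (trans (sym p) q) λ ()
  crossing (_then_ {u} {v} e walk) p q with side v in eq
  ... | side₀ = crossing walk eq q
  ... | side₁ = u , v , e , p , eq

  bridge : ∃ λ w → Nbr v₀ w × side w ≡ side₁
  bridge = go (crossing (connected v₀ (base side₁)) (proj₁ (position-base side₀)) (proj₁ (position-base side₁)))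
    where
    go : (∃₂ λ a b → Nbr a b × side a ≡ side₀ × side b ≡ side₁) → ∃ λ w → Nbr v₀ w × side w ≡ side₁
    go (a , b , e , p , q) = ρ (elem a ⁻¹) b ,
      nbr-back (elem a) (subst (λ c → Nbr c b) (trans (sym (ρ-elem a)) (cong (λ s → ρ (elem a) (base s)) p)) e) ,
      trans (side-ρ _ b) q

  w : V
  w = proj₁ bridge

  v₀w : Nbr v₀ w
  v₀w = proj₁ (proj₂ bridge)

  side-w : side w ≡ side₁
  side-w = proj₂ (proj₂ bridge)

  root-of : Fin 2 → V
  root-of side₀ = v₀
  root-of side₁ = w

  -- The second orbit is measured from `w` instead of its given base vertex, so that the edge from
  -- v₀ to `w` contributes the identity to the connection set.
  coord : V → Fin 2 × Elem
  coord v = place (side v) (elem v)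
    where
    place : Fin 2 → Elem → Fin 2 × Elem
    place side₀ g = side₀ , g
    place side₁ g = side₁ , g ∙ elem w ⁻¹

  vertex : Fin 2 × Elem → V
  vertex (s , g) = ρ g (root-of s)

  ρ-w : ∀ g → ρ (g ∙ elem w) (base side₁) ≡ ρ g w
  ρ-w g = trans (ρ-homo g (elem w) _) (cong (ρ g) (trans (cong (λ s → ρ (elem w) (base s)) (sym side-w)) (ρ-elem w)))

  vertex-coord : ∀ v → vertex (coord v) ≡ v
  vertex-coord v with side v | elem v | ρ-elem v
  ... | side₀ | g | e = e
  ... | side₁ | g | e = trans (sym (ρ-w _)) (trans (cong (λ h → ρ h (base side₁)) (//-rightDividesˡ (elem w) g)) e)

  vertex-injective : ∀ p q → vertex p ≡ vertex q → p ≡ q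
  vertex-injective (side₀ , g) (side₀ , h) e = cong (side₀ ,_) (ρ-semiregular e)
  vertex-injective (side₁ , g) (side₁ , h) e = cong (side₁ ,_) (ρ-semiregular e)
  vertex-injective (side₀ , g) (side₁ , h) e = contradiction (trans e (sym (ρ-w h))) different-orbits
  vertex-injective (side₁ , g) (side₀ , h) e = contradiction (trans (sym e) (sym (ρ-w g))) different-orbits

  coord-vertex : ∀ p → coord (vertex p) ≡ p
  coord-vertex p = vertex-injective (coord (vertex p)) p (vertex-coord (vertex p))

  -- If φ fixed w it would fix both neighbourhoods N(v₀), N(w), hence everything by normality and connectedness.
  φ-w≢w : φ w ≢ w
  φ-w≢w φw = φ-nontrivial λ v → spread (connected v₀ v) φ-v₀
    where
    fixed-root : ∀ s → φ (root-of s) ≡ root-of s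
    fixed-root side₀ = φ-v₀
    fixed-root side₁ = φw
    fix-nbrs : ∀ {r u} → φ r ≡ r → Nbr r u → φ u ≡ u → ∀ {v} → Nbr r v → φ v ≡ v
    fix-nbrs {r} φr ru φu = fix-one⇒fix-all Fin._≟_ (nbrs r) (card-nbrs r) φ
      (λ {v} e → subst (λ t → Nbr t (φ v)) φr (nbr-φ e)) (λ {v} _ → φ³ v) ru φu
    fixed-nbrs : ∀ s {v} → Nbr (root-of s) v → φ v ≡ v
    fixed-nbrs side₀ = fix-nbrs φ-v₀ v₀w φw
    fixed-nbrs side₁ = fix-nbrs φw (nbr-sym v₀w) φ-v₀
    step : ∀ p {b} → Nbr (vertex p) b → φ (vertex p) ≡ vertex p → φ b ≡ b
    step (s , g) {b} e fixed = begin
      φ b                                 ≡⟨ cong φ (ρ-inverseʳ g b) ⟨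
      φ (ρ g (ρ (g ⁻¹) b))                ≡⟨ φ-ρ g _ ⟩
      ρ (α g) (φ (ρ (g ⁻¹) b))            ≡⟨ cong₂ ρ αg (fixed-nbrs s (nbr-back g e)) ⟩
      ρ g (ρ (g ⁻¹) b)                    ≡⟨ ρ-inverseʳ g b ⟩
      b                                   ∎
      where
      αg : α g ≡ g
      -- Both the root and its translate by g are fixed by φ, so α(g) and g move the root to the
      -- same vertex.
      αg = ρ-semiregular {v = root-of s} (trans (cong (ρ (α g)) (sym (fixed-root s))) (trans (sym (φ-ρ g _)) fixed))
    spread : ∀ {a b} → Walk a b → φ a ≡ a → φ b ≡ b
    spread stop e = e
    spread (_then_ {u} {v} e walk) fu = spread walk (step (coord u) (subst (λ t → Nbr t v) (sym (vertex-coord u)) e)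
      (subst (λ t → φ t ≡ t) (sym (vertex-coord u)) fu))

  φ-side₀ : ∀ g → φ (ρ g v₀) ≡ ρ (α g) v₀
  φ-side₀ g = trans (φ-ρ g v₀) (cong (ρ (α g)) φ-v₀)

  -- φ normalises H and fixes v₀, so it maps the orbit of v₀ into itself. If φ w lay in that orbit,
  -- so would φ³ w, which is w.
  shift : ∃ λ x → φ w ≡ ρ x w
  shift = go (coord (φ w)) (vertex-coord (φ w))
    where
    go : ∀ p → vertex p ≡ φ w → ∃ λ x → φ w ≡ ρ x w
    go (side₁ , x) e = x , sym e
    go (side₀ , g) e = contradiction (begin
      ρ (α (α g)) v₀       ≡⟨ φ-side₀ (α g) ⟨
      φ (ρ (α g) v₀)       ≡⟨ cong φ (φ-side₀ g) ⟨
      φ (φ (ρ g v₀))       ≡⟨ cong (φ ∘ φ) e ⟩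
      φ (φ (φ w))          ≡⟨ φ³ w ⟩
      w                    ≡⟨ ρ-ε w ⟨
      ρ ε w                ≡⟨ ρ-w ε ⟨
      ρ (ε ∙ elem w) (base side₁) ∎) different-orbits

  x z y : Elem
  x = proj₁ shift
  z = α x
  y = z ∙ x

  φ-side₁ : ∀ g → φ (ρ g w) ≡ ρ (α g ∙ x) w
  φ-side₁ g = trans (φ-ρ g w) (trans (cong (ρ (α g)) (proj₂ shift)) (sym (ρ-homo _ _ _)))

  φφw : φ (φ w) ≡ ρ y w
  φφw = trans (cong φ (proj₂ shift)) (φ-side₁ x)

  trace : α (α x) ∙ (α x ∙ x) ≡ ε
  trace = ρ-semiregular {v = w} (begin
    ρ (α z ∙ (z ∙ x)) w   ≡⟨ cong (λ g → ρ g w) (trans (sym (assoc _ _ _)) (cong (_∙ x) (sym (α-homo z x)))) ⟩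
    ρ (α y ∙ x) w         ≡⟨ φ-side₁ y ⟨
    φ (ρ y w)             ≡⟨ cong φ φφw ⟨
    φ (φ (φ w))           ≡⟨ φ³ w ⟩
    w                     ≡⟨ ρ-ε w ⟨
    ρ ε w                 ∎)

  φφw≢w : φ (φ w) ≢ w
  φφw≢w e = φ-w≢w (trans (cong φ (sym e)) (φ³ w))

  φφw≢φw : φ (φ w) ≢ φ w
  φφw≢φw e = φ-w≢w (trans (sym e) (trans (sym (cong φ e)) (φ³ w)))

  nbr-v₀-φ : ∀ {v} → Nbr v₀ v → Nbr v₀ (φ v)
  nbr-v₀-φ {v} e = subst (λ t → Nbr t (φ v)) φ-v₀ (nbr-φ e)

  nbrs-v₀ : ∀ {v} → Nbr v₀ v → v ≡ w ⊎ v ≡ ρ x w ⊎ v ≡ ρ y w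
  nbrs-v₀ {v} e = translate (three-cover Fin._≟_ (nbrs v₀) (card-nbrs v₀) v₀w (nbr-v₀-φ v₀w) (nbr-v₀-φ (nbr-v₀-φ v₀w))
      (φ-w≢w ∘ sym) (φφw≢w ∘ sym) (φφw≢φw ∘ sym) e)
    where
    translate : v ≡ w ⊎ v ≡ φ w ⊎ v ≡ φ (φ w) → v ≡ w ⊎ v ≡ ρ x w ⊎ v ≡ ρ y w
    translate (inj₁ e)        = inj₁ e
    translate (inj₂ (inj₁ e)) = inj₂ (inj₁ (trans e (proj₂ shift)))
    translate (inj₂ (inj₂ e)) = inj₂ (inj₂ (trans e φφw))

  v₀-xw : Nbr v₀ (ρ x w)
  v₀-xw = subst (Nbr v₀) (proj₂ shift) (nbr-v₀-φ v₀w)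

  v₀-yw : Nbr v₀ (ρ y w)
  v₀-yw = subst (Nbr v₀) φφw (nbr-v₀-φ (nbr-v₀-φ v₀w))

  reverse-edge : ∀ g → Nbr v₀ (ρ g w) → Nbr w (ρ (g ⁻¹) v₀)
  reverse-edge g e = nbr-back g (nbr-sym e)

  x≢ε : x ≢ ε
  x≢ε e = φ-w≢w (trans (proj₂ shift) (trans (cong (λ g → ρ g w) e) (ρ-ε w)))

  y≢ε : y ≢ ε
  y≢ε e = φφw≢w (trans φφw (trans (cong (λ g → ρ g w) e) (ρ-ε w)))

  x≢y : x ≢ y
  x≢y e = φφw≢φw (trans φφw (trans (cong (λ g → ρ g w) (sym e)) (sym (proj₂ shift))))

  nbrs-w : ∀ {v} → Nbr w v → v ≡ v₀ ⊎ v ≡ ρ (x ⁻¹) v₀ ⊎ v ≡ ρ (y ⁻¹) v₀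
  nbrs-w = three-cover Fin._≟_ (nbrs w) (card-nbrs w) (nbr-sym v₀w) (reverse-edge x v₀-xw) (reverse-edge y v₀-yw)
    (λ e → x≢ε (⁻¹-injective (trans (sym (ρ-semiregular (trans (ρ-ε v₀) e))) (sym ε⁻¹≈ε))))
    (λ e → y≢ε (⁻¹-injective (trans (sym (ρ-semiregular (trans (ρ-ε v₀) e))) (sym ε⁻¹≈ε))))
    (λ e → x≢y (⁻¹-injective (ρ-semiregular e)))

  move : ∀ g h {r s} → Nbr (ρ g r) (ρ h s) → Nbr r (ρ (g ⁻¹ ∙ h) s)
  move g h {r} e = subst (Nbr r) (sym (ρ-homo _ _ _)) (nbr-back g e)

  -- The three neighbours already found for v₀ all lie in the orbit of `w`, and those of `w` in the
  -- orbit of v₀; being cubic leaves room for no others.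
  same-side : ∀ s g h → ¬ Nbr (vertex (s , g)) (vertex (s , h))
  same-side side₀ g h e = impossible (nbrs-v₀ (move g h e))
    where
    impossible : ∀ {k} → ¬ (ρ k v₀ ≡ w ⊎ ρ k v₀ ≡ ρ x w ⊎ ρ k v₀ ≡ ρ y w)
    impossible {k} (inj₁ e)        = contradiction (vertex-injective (side₀ , k) (side₁ , ε) (trans e (sym (ρ-ε w)))) λ ()
    impossible {k} (inj₂ (inj₁ e)) = contradiction (vertex-injective (side₀ , k) (side₁ , x) e) λ ()
    impossible {k} (inj₂ (inj₂ e)) = contradiction (vertex-injective (side₀ , k) (side₁ , y) e) λ ()
  same-side side₁ g h e = impossible (nbrs-w (move g h e))
    where
    impossible : ∀ {k} → ¬ (ρ k w ≡ v₀ ⊎ ρ k w ≡ ρ (x ⁻¹) v₀ ⊎ ρ k w ≡ ρ (y ⁻¹) v₀)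
    impossible {k} (inj₁ e)        = contradiction (vertex-injective (side₁ , k) (side₀ , ε) (trans e (sym (ρ-ε v₀)))) λ ()
    impossible {k} (inj₂ (inj₁ e)) = contradiction (vertex-injective (side₁ , k) (side₀ , x ⁻¹) e) λ ()
    impossible {k} (inj₂ (inj₂ e)) = contradiction (vertex-injective (side₁ , k) (side₀ , y ⁻¹) e) λ ()

  adj-cross : ∀ g h → Nbr (ρ g v₀) (ρ h w) → h ≡ g ⊎ h ≡ g ∙ x ⊎ h ≡ g ∙ y
  adj-cross g h e = solve-for (nbrs-v₀ (move g h e))
    where
    shifted : ∀ {k} → ρ (g ⁻¹ ∙ h) w ≡ ρ k w → h ≡ g ∙ k
    shifted {k} e = begin
      h                ≡⟨ identityˡ h ⟨
      ε ∙ h            ≡⟨ cong (_∙ h) (inverseʳ g) ⟨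
      (g ∙ g ⁻¹) ∙ h   ≡⟨ assoc _ _ _ ⟩
      g ∙ (g ⁻¹ ∙ h)   ≡⟨ cong (g ∙_) (ρ-semiregular e) ⟩
      g ∙ k            ∎
    solve-for : ρ (g ⁻¹ ∙ h) w ≡ w ⊎ ρ (g ⁻¹ ∙ h) w ≡ ρ x w ⊎ ρ (g ⁻¹ ∙ h) w ≡ ρ y w → h ≡ g ⊎ h ≡ g ∙ x ⊎ h ≡ g ∙ y
    solve-for (inj₁ e)        = inj₁ (trans (shifted (trans e (sym (ρ-ε w)))) (identityʳ g))
    solve-for (inj₂ (inj₁ e)) = inj₂ (inj₁ (shifted e))
    solve-for (inj₂ (inj₂ e)) = inj₂ (inj₂ (shifted e))

  cross-adj : ∀ g h → h ≡ g ⊎ h ≡ g ∙ x ⊎ h ≡ g ∙ y → Nbr (ρ g v₀) (ρ h w)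
  cross-adj g _ (inj₁ refl)        = nbr-ρ g v₀w
  cross-adj g _ (inj₂ (inj₁ refl)) = subst (Nbr (ρ g v₀)) (sym (ρ-homo g x w)) (nbr-ρ g v₀-xw)
  cross-adj g _ (inj₂ (inj₂ refl)) = subst (Nbr (ρ g v₀)) (sym (ρ-homo g y w)) (nbr-ρ g v₀-yw)

  haar : Haar H Γ x y
  haar = record
    { vertex = vertex ; coord = coord ; vertex-coord = vertex-coord ; coord-vertex = coord-vertex
    ; adj-same = λ s g h → ¬-not (same-side s g h)
    ; adj-cross = adj-cross ; cross-adj = cross-adj }

  -- Along a walk from v₀ to `ρ u v₀` the group coordinate is unchanged or multiplied on the right
  -- by x, y or an inverse of these, and y is a product of z and x.
  generates : ∀ P → IsSubgroup P → P x → P z → ∀ u → P u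
  generates P sub Px Pz u = subst (P ∘ proj₂) (coord-vertex (side₀ , u))
      (along (connected v₀ (ρ u v₀)) (subst (P ∘ proj₂) (sym (trans (cong coord (sym (ρ-ε v₀))) (coord-vertex (side₀ , ε)))) ε∈))
    where
    open IsSubgroup sub
    Py : P y
    Py = ∙∈ Pz Px
    right : ∀ {g h} → P g → h ≡ g ⊎ h ≡ g ∙ x ⊎ h ≡ g ∙ y → P h
    right Pg (inj₁ refl)        = Pg
    right Pg (inj₂ (inj₁ refl)) = ∙∈ Pg Px
    right Pg (inj₂ (inj₂ refl)) = ∙∈ Pg Py
    left : ∀ {g h} → P h → h ≡ g ⊎ h ≡ g ∙ x ⊎ h ≡ g ∙ y → P g
    left Ph (inj₁ refl)        = Ph
    left Ph (inj₂ (inj₁ refl)) = subst P (//-rightDividesʳ _ _) (∙∈ Ph (⁻¹∈ Px))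
    left Ph (inj₂ (inj₂ refl)) = subst P (//-rightDividesʳ _ _) (∙∈ Ph (⁻¹∈ Py))
    step : ∀ p q → Nbr (vertex p) (vertex q) → P (proj₂ p) → P (proj₂ q)
    step (side₀ , g) (side₀ , h) e = contradiction e (same-side side₀ g h)
    step (side₁ , g) (side₁ , h) e = contradiction e (same-side side₁ g h)
    step (side₀ , g) (side₁ , h) e Pg = right Pg (adj-cross g h e)
    step (side₁ , h) (side₀ , g) e Ph = left Ph (adj-cross g h (nbr-sym e))
    along : ∀ {a b} → Walk a b → P (proj₂ (coord a)) → P (proj₂ (coord b))
    along stop p = p
    along (_then_ {a} {b} e walk) p = along walk (step (coord a) (coord b)
      (trans (cong₂ adj (vertex-coord a) (vertex-coord b)) e) p)

-- Choice of the commutator and identification of the graph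

generated-abelian : (H : FinGroup) (x z : GroupNotions.Elem H) →
  (∀ P → GroupNotions.IsSubgroup H P → P x → P z → ∀ u → P u) →
  FinGroup._∙_ H x z ≡ FinGroup._∙_ H z x → GroupNotions.IsAbelian H
generated-abelian H x z gen xz u v = gen (Comm u) (centraliser u) (sym (commutes x refl xz u)) (sym (commutes z (sym xz) refl u)) v
  where
  open FinGroupProps H
  centraliser : ∀ u → IsSubgroup (Comm u)
  centraliser u = record { ε∈ = comm-ε u ; ∙∈ = comm-∙ ; ⁻¹∈ = comm-inv }
  commutes : ∀ u → Comm u x → Comm u z → ∀ v → Comm u v
  commutes u ux uz = gen (Comm u) (centraliser u) ux uz

theorem1p2 : (H : FinGroup) (Γ : Graph) →
    GroupNotions.IsInnerAbelian H → GroupNotions.IsMetacyclic H → GroupNotions.Is3Group H →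
    GraphNotions.IsConnected Γ → GraphNotions.IsCubic Γ → GraphNotions.IsEdgeTransitive Γ →
    GraphNotions.IsBiCayleyOver Γ H →
    ∃ λ (t : ℕ) → 1 ≤ t × (GraphNotions.IsIsoTo Γ (Γ-adj t) ⊎ GraphNotions.IsIsoTo Γ (Σ-adj t))
theorem1p2 H Γ inner metacyclic (k , order≡3^k) connected cubic edge-transitive bicayley = conclude order-three
  where
  open FinGroupProps H
  M : Metacyclic H
  M = metacyclic-generators H metacyclic
  cc : CubeCommutators H
  cc = InnerAbelian.cubeCommutators H M k order≡3^k inner
  AG : AutomorphismGroup Γ
  AG = automorphismGroup Γ
  open AutomorphismGroup AG
  open NormaliserElement H M k order≡3^k Γ cubic edge-transitive bicayley AG using (N₀; order-three)
  Result : Set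
  Result = ∃ λ (t : ℕ) → 1 ≤ t × (GraphNotions.IsIsoTo Γ (Γ-adj t) ⊎ GraphNotions.IsIsoTo Γ (Σ-adj t))
  isomorphic : ∀ {x y} → Haar H Γ x y → Classified H x y → Result
  isomorphic G (t , 1≤t , inj₁ (inj₁ K)) = t , 1≤t , inj₁ (Γ-iso t G K)
  isomorphic G (t , 1≤t , inj₁ (inj₂ K)) = t , 1≤t , inj₁ (Γ-iso t (haar-dual G) K)
  isomorphic G (t , 1≤t , inj₂ (inj₁ K)) = t , 1≤t , inj₂ (Σ-iso t G K)
  isomorphic G (t , 1≤t , inj₂ (inj₂ K)) = t , 1≤t , inj₂ (Σ-iso t (haar-dual G) K)
  conclude : (∃ λ σ → N₀ σ × σ ≢ one × (∀ v → act σ (act σ (act σ v)) ≡ v)) → Result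
  conclude (σ , (normal , fixes) , σ≢one , cube) = isomorphic haar (classify (commute x z))
    where
    open TrigonalAction H Γ connected cubic bicayley (act σ) (preserve σ) cube normal fixes
      (λ trivial → σ≢one (ext λ v → trans (trivial v) (sym (act-one v))))
    open CubeCommutators cc
    classify : (∃ λ n → x ∙ z ≡ pow c n ∙ (z ∙ x)) → Classified H x y
    -- H is not abelian and is generated by x and z, so their commutator `pow c n` is nontrivial. It
    -- takes the place of `c`, which removes the choice between `c` and its inverse from the
    -- commutator and leaves it in the powers of x.
    classify (n , xz) = finish (renormalise H cc n nontrivial)
      where
      nontrivial : pow c n ≢ ε
      nontrivial e = proj₁ inner (generated-abelian H x z generates (trans xz (trans (cong (_∙ (z ∙ x)) e) (identityˡ _))))
      finish : (Σ (CubeCommutators H) λ cc′ → CubeCommutators.c cc′ ≡ pow c n) → Classified H x y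
      finish (cc′ , c′≡) = Trigonal.classified H cc′ k order≡3^k α α-homo x trace
        (trans xz (cong (_∙ (z ∙ x)) (sym c′≡))) generates
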